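{- Let $H$ be a connected hypergraph in which every hyperedge contains more than two vertices, let $w_{1}:V(H)\to\{0,1\}$ be an initial configuration that is not identically zero, and let $w_{2}:V(H)\to\{0,1\}$ be a configuration. There is a polynomial time algorithm that tests whether $w_{2}$ is a recurrent state for the nondeterministic hyperedge switching process on $H$ started at $w_{1}$.
   Context: A configuration assigns to each vertex a value in $\{0,1\}$ (1 meaning the vertex carries a ball). Nondeterministic hyperedge switching process: at each step one chooses a hyperedge $l$ containing at least one vertex with value $1$, and replaces the configuration $x$ by $x^{(l)}$, where $x^{(l)}(v)=1+x(v) \pmod 2$ for $v\in l$ and $x^{(l)}(v)=x(v)$ otherwise. A state $s$ is recurrent for the process started at $w_1$ if for every infinite path $\pi=(\pi_0=w_1,\pi_1,\ldots)$ of the process and every $n$, $s$ is reachable from $\pi_n$ by a finite sequence of moves. -}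

module Defs where

open import Data.Bool.Base using (Bool; true; false; _xor_)
open import Data.Fin.Base using (Fin)
open import Data.Fin.Subset using (Subset; _∈_)
open import Data.List.Base as List using (List; []; _∷_; [_]; _++_; concatMap)
import Data.List.Membership.Propositional as Listed
open import Data.Maybe.Base using (Maybe; just; nothing)
open import Data.Nat.Base using (ℕ; zero; suc)
open import Data.Nat.GeneralisedArithmetic using (iterate)
open import Data.Product.Base using (Σ-syntax; ∃-syntax; _×_; _,_; proj₁)
open import Data.Vec.Base as Vec using (Vec; lookup; zipWith; replicate; toList)
open import Function.Bundles using (_↔_)
open import Function.Definitions using (Injective)
open import Relation.Binary.Construct.Closure.ReflexiveTransitive using (Star)
open import Relation.Binary.PropositionalEquality using (_≡_; _≢_)
open import Relation.Nullary.Reflects using (Reflects)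

------------------------------------------------------------------------
-- Hypergraphs and the switching process

-- The vertex set is Fin n.  The list enumerates the set of hyperedges; its
-- order, and possible repetitions in it, play no role.
Hypergraph : ℕ → Set
Hypergraph n = List (Subset n)

_is-hyperedge-of_ : ∀ {n} → Subset n → Hypergraph n → Set
l is-hyperedge-of H = l Listed.∈ H

Adjacent : ∀ {n} → Hypergraph n → Fin n → Fin n → Set
Adjacent H u v = ∃[ l ] l is-hyperedge-of H × u ∈ l × v ∈ l

Connected : ∀ {n} → Hypergraph n → Set
Connected H = ∀ u v → Star (Adjacent H) u v

Configuration : ℕ → Set
Configuration n = Vec Bool n

HasBall : ∀ {n} → Configuration n → Fin n → Set
HasBall x v = lookup x v ≡ true

IdenticallyZero : ∀ {n} → Configuration n → Set
IdenticallyZero x = ∀ v → lookup x v ≡ false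

-- A subset is its own characteristic vector, so this adds 1 modulo 2 exactly
-- at the vertices of l.
switch : ∀ {n} → Subset n → Configuration n → Configuration n
switch l x = zipWith _xor_ l x

Move : ∀ {n} → Hypergraph n → Configuration n → Configuration n → Set
Move H x y =
  ∃[ l ] l is-hyperedge-of H × (∃[ v ] v ∈ l × HasBall x v) × y ≡ switch l x

Reachable : ∀ {n} → Hypergraph n → Configuration n → Configuration n → Set
Reachable H = Star (Move H)

InfinitePath : ∀ {n} → Hypergraph n → Configuration n → (ℕ → Configuration n) → Set
InfinitePath H w π = π 0 ≡ w × (∀ i → Move H (π i) (π (suc i)))

Recurrent : ∀ {n} → Hypergraph n → Configuration n → Configuration n → Set
Recurrent H w s = ∀ π → InfinitePath H w π → ∀ i → Reachable H (π i) s

------------------------------------------------------------------------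
-- Deterministic multi-tape Turing machines

Finite : Set → Set
Finite A = ∃[ n ] (A ↔ Fin n)

data Direction : Set where
  left right stay : Direction

-- A tape, infinite in both directions: cells beyond the ends of the lists are
-- blank.  Both lists start with the cell next to the head.
record Tape (Γ : Set) : Set where
  constructor tape
  field
    before  : List Γ
    current : Γ
    after   : List Γ

open Tape public

record TuringMachine (Σ : Set) : Set₁ where
  field
    Γ               : Set
    Γ-finite        : Finite Γ
    blank           : Γ
    input           : Σ → Γ
    input-injective : Injective _≡_ _≡_ input
    input-nonblank  : ∀ a → input a ≢ blank
    State           : Set
    State-finite    : Finite State
    start           : State
    -- just true: accepting; just false: rejecting; nothing: not halting.
    verdict         : State → Maybe Bool
    -- Number of tapes besides the input tape.
    extraTapes      : ℕ
    δ               : State → Vec Γ (suc extraTapes) →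
                      State × Vec (Γ × Direction) (suc extraTapes)

module _ {Σ : Set} (M : TuringMachine Σ) where
  open TuringMachine M

  shift : Direction → Tape Γ → Tape Γ
  shift left  (tape []       a rs)       = tape [] blank (a ∷ rs)
  shift left  (tape (l ∷ ls) a rs)       = tape ls l (a ∷ rs)
  shift right (tape ls       a [])       = tape (a ∷ ls) blank []
  shift right (tape ls       a (r ∷ rs)) = tape (a ∷ ls) r rs
  shift stay  t                          = t

  act : Γ × Direction → Tape Γ → Tape Γ
  act (a , d) t = shift d (tape (before t) a (after t))

  Snapshot : Set
  Snapshot = State × Vec (Tape Γ) (suc extraTapes)

  step : Snapshot → Snapshot
  step (q , ts) with verdict q
  ... | just _  = q , ts
  ... | nothing = let q′ , as = δ q (Vec.map current ts) in q′ , zipWith act as ts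

  load : List Σ → Tape Γ
  load []       = tape [] blank []
  load (a ∷ as) = tape [] (input a) (List.map input as)

  initial : List Σ → Snapshot
  initial as = start , load as Vec.∷ replicate extraTapes (tape [] blank [])

  verdictAfter : ℕ → List Σ → Maybe Bool
  verdictAfter t as = verdict (proj₁ (iterate step (initial as) t))

-- Since halted machines do not move, a verdict after exactly t steps is one
-- reached within t steps.
DecidesWithin : {Σ : Set} → TuringMachine Σ → ℕ → List Σ → Set → Set
DecidesWithin M t as P = Σ[ b ∈ Bool ] verdictAfter M t as ≡ just b × Reflects P b

------------------------------------------------------------------------
-- Encoding of instances

data Symbol : Set where
  bit : Bool → Symbol
  sep : Symbol

encodeRow : ∀ {n} → Vec Bool n → List Symbol
encodeRow x = List.map bit (toList x) ++ [ sep ]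

-- Two configurations followed by the rows of the incidence matrix.
encode : ∀ {n} → Hypergraph n → Configuration n → Configuration n → List Symbol
encode H w₁ w₂ = encodeRow w₁ ++ encodeRow w₂ ++ concatMap encodeRow H

{-# OPTIONS --safe #-}
module Submission where

-- Call two vertices twins if they lie in the same hyperedges. Suppose first that
-- some hyperedge contains three pairwise non-twin vertices or that w₁ differs on
-- two twins. Then every nonzero configuration reaches every configuration other
-- than 𝟙 in its coset modulo the span of the hyperedges: an obstruction would
-- force the balls near some hyperedge, and then near all of them, to behave like
-- tokens on a graph. In the other case the balls are tokens on the graph of the
-- twin classes, which move along edges and annihilate in pairs or at loops;
-- the recurrent configurations are those of the coset with at most two tokens, or
-- at most one if there is a loop. The exception is that no infinite path exists
-- at all, which happens only if w₁ and all hyperedges are full.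
--
-- The coset is tested by Gaussian elimination, and the remaining conditions by
-- comparing triples of rows: a hyperedge l consists of at most two twin classes
-- iff, for some hyperedge a, all rows are constant on l ∩ a and on l ∖ a.

open import Defs
open import Data.Fin.Subset using (Subset; ∣_∣)
open import Data.List.Base using (length)
open import Data.Nat.Base using (ℕ; _+_; _*_; _^_; _<_)
open import Data.Product.Base using (Σ-syntax)
open import Relation.Nullary.Negation.Core using (¬_)

open import Data.Bool.Base using (Bool; true; false; not; _xor_; _∧_; _∨_; if_then_else_)
open import Data.Bool.ListAction using (any)
import Data.Bool.Properties as 𝔹
open import Data.Empty using (⊥; ⊥-elim)
open import Data.Fin.Base as Fin using (Fin; zero; suc; _↑ʳ_)
open import Data.Fin.Patterns
import Data.Fin.Properties as Fin
import Data.Fin.Subset.Properties as Subset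
open import Data.List.Base as List using (List; []; _∷_; _++_; _ʳ++_; concatMap; foldl; reverse)
import Data.List.Membership.Propositional as Listed
import Data.List.Membership.Propositional.Properties as Listed
import Data.List.Properties as List
import Data.List.Relation.Unary.All as All
import Data.List.Relation.Unary.All.Properties as All
import Data.List.Relation.Unary.Any as Any
open import Data.List.Relation.Unary.Any using (here; there)
open import Data.Maybe.Base using (just; nothing; is-just; Maybe)
open import Data.Nat.Base using (zero; suc; _≤_; z≤n; s≤s; _∸_)
open import Data.Nat.GeneralisedArithmetic using (iterate)
import Data.Nat.Properties as ℕ
open import Data.Nat.Solver using (module +-*-Solver)
open import Data.Product.Base using (∃-syntax; _×_; _,_; proj₁; proj₂)
open import Data.Sum.Base as Sum using (_⊎_; inj₁; inj₂)
open import Data.Sum.Function.Propositional using (_⊎-↔_)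
open import Data.Unit.Base using (⊤; tt)
open import Data.Vec.Base as Vec using (Vec; []; _∷_; lookup; zipWith; replicate; tabulate; toList; _[_]≔_)
import Data.Vec.Properties as Vec
open import Function.Base using (_∘_)
open import Function.Bundles using (mk↔ₛ′)
open import Function.Construct.Composition using (_↔-∘_)
open import Function.Construct.Symmetry using (↔-sym)
open import Relation.Binary.Construct.Closure.ReflexiveTransitive using (Star; ε; _◅_; _◅◅_)
open import Relation.Binary.PropositionalEquality hiding ([_])
open import Relation.Nullary using (Dec; yes; no; Reflects; ofʸ; ofⁿ; contradiction)
open import Relation.Nullary.Decidable using (_×-dec_; _⊎-dec_; ¬?; map′; does; dec-true; dec-false)

-- A switch empties every vertex that made it legal, so undoing it takes another vertex of the
-- hyperedge, one that was empty before. Finding such vertices is the main difficulty of the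
-- combinatorial part. To show that some incidence pattern is impossible, one gives a short list of
-- legal switches from a reachable state to an unreachable one. Whether the list is legal depends on
-- the incidences of at most four vertices, so this is left to computation. The lists come from the
-- token picture: `l` and `g` are two adjacent edges of a graph, one token lies elsewhere, and the
-- states that would have three tokens are unreachable.
--
-- The full configuration needs separate care, since an illegal switch gives useful information only
-- if some vertex is empty both before and after it. Case distinctions on reachability are
-- constructive because there are finitely many configurations.
--
-- On the machine side, programs consist of loops that make exactly one turn per input symbol. A
-- polynomial time bound then follows for every program by recursion on its syntax, and no program
-- needs an analysis of its own.

private variable
  n : ℕ

-- Configurations form an elementary abelian 2-group

infixr 6 _⊕_
_⊕_ : Configuration n → Configuration n → Configuration n
_⊕_ = switch

𝟘 𝟙 : Configuration n
𝟘 = replicate _ false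
𝟙 = replicate _ true

ext : {x y : Configuration n} → (∀ v → lookup x v ≡ lookup y v) → x ≡ y
ext {x = x} {y} eq =
  trans (sym (Vec.tabulate∘lookup x)) (trans (Vec.tabulate-cong eq) (Vec.tabulate∘lookup y))

⊕-at : (x y : Configuration n) (v : Fin n) → lookup (x ⊕ y) v ≡ lookup x v xor lookup y v
⊕-at x y v = Vec.lookup-zipWith _xor_ v x y

𝟘-at : (v : Fin n) → lookup 𝟘 v ≡ false
𝟘-at v = Vec.lookup-replicate v false

𝟙-at : (v : Fin n) → lookup 𝟙 v ≡ true
𝟙-at v = Vec.lookup-replicate v true

⊕-comm : (x y : Configuration n) → x ⊕ y ≡ y ⊕ x
⊕-comm = Vec.zipWith-comm 𝔹.xor-comm

⊕-assoc : (x y z : Configuration n) → (x ⊕ y) ⊕ z ≡ x ⊕ (y ⊕ z)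
⊕-assoc = Vec.zipWith-assoc 𝔹.xor-assoc

⊕-identityˡ : (x : Configuration n) → 𝟘 ⊕ x ≡ x
⊕-identityˡ = Vec.zipWith-identityˡ 𝔹.xor-identityˡ

⊕-self : (x : Configuration n) → x ⊕ x ≡ 𝟘
⊕-self []      = refl
⊕-self (b ∷ x) = cong₂ _∷_ (𝔹.xor-same b) (⊕-self x)

⊕-identityʳ : (x : Configuration n) → x ⊕ 𝟘 ≡ x
⊕-identityʳ x = trans (⊕-comm x 𝟘) (⊕-identityˡ x)

⊕-cancel : (x y : Configuration n) → x ⊕ (x ⊕ y) ≡ y
⊕-cancel x y = begin
  x ⊕ (x ⊕ y)  ≡⟨ ⊕-assoc x x y ⟨
  (x ⊕ x) ⊕ y  ≡⟨ cong (_⊕ y) (⊕-self x) ⟩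
  𝟘 ⊕ y        ≡⟨ ⊕-identityˡ y ⟩
  y            ∎
  where open ≡-Reasoning

⊕-swap : (x y z : Configuration n) → x ⊕ (y ⊕ z) ≡ y ⊕ (x ⊕ z)
⊕-swap x y z = begin
  x ⊕ (y ⊕ z)  ≡⟨ ⊕-assoc x y z ⟨
  (x ⊕ y) ⊕ z  ≡⟨ cong (_⊕ z) (⊕-comm x y) ⟩
  (y ⊕ x) ⊕ z  ≡⟨ ⊕-assoc y x z ⟩
  y ⊕ (x ⊕ z)  ∎
  where open ≡-Reasoning

⊕≡𝟘⇒≡ : {x y : Configuration n} → x ⊕ y ≡ 𝟘 → x ≡ y
⊕≡𝟘⇒≡ {x = x} {y} eq =
  sym (trans (sym (⊕-cancel x y)) (trans (cong (x ⊕_) eq) (⊕-identityʳ x)))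

⊕-moveˡ : {x y z : Configuration n} → x ⊕ y ≡ z → y ≡ x ⊕ z
⊕-moveˡ {x = x} {y} refl = sym (⊕-cancel x y)

true≢false : true ≢ false
true≢false ()

≢true⇒≡false : ∀ {b} → b ≢ true → b ≡ false
≢true⇒≡false = 𝔹.¬-not

≢false⇒≡true : ∀ {b} → b ≢ false → b ≡ true
≢false⇒≡true = 𝔹.¬-not

_≟ᶜ_ : (x y : Configuration n) → Dec (x ≡ y)
_≟ᶜ_ = Vec.≡-dec 𝔹._≟_

≢𝟘⇒ball : {x : Configuration n} → x ≢ 𝟘 → ∃[ v ] lookup x v ≡ true
≢𝟘⇒ball {x = x} x≢𝟘 with Fin.any? (λ v → lookup x v 𝔹.≟ true)
... | yes ball = ball
... | no none  =
  contradiction (ext λ v → trans (≢true⇒≡false λ eq → none (v , eq)) (sym (𝟘-at v))) x≢𝟘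

≢𝟙⇒gap : {x : Configuration n} → x ≢ 𝟙 → ∃[ v ] lookup x v ≡ false
≢𝟙⇒gap {x = x} x≢𝟙 with Fin.any? (λ v → lookup x v 𝔹.≟ false)
... | yes gap = gap
... | no none =
  contradiction (ext λ v → trans (≢false⇒≡true λ eq → none (v , eq)) (sym (𝟙-at v))) x≢𝟙

ball⇒≢𝟘 : {x : Configuration n} {v : Fin n} → lookup x v ≡ true → x ≢ 𝟘
ball⇒≢𝟘 {v = v} on refl = true≢false (trans (sym on) (𝟘-at v))

gap⇒≢𝟙 : {x : Configuration n} {v : Fin n} → lookup x v ≡ false → x ≢ 𝟙
gap⇒≢𝟙 {v = v} off refl = true≢false (trans (sym (𝟙-at v)) off)

-- Decidability of reachability

module _ {A : Set} {R : A → A → Set} (_≟_ : (x y : A) → Dec (x ≡ y)) (R? : ∀ x y → Dec (R x y)) where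

  -- Paths all of whose inner vertices are listed, decided as in Warshall's algorithm.
  Via : List A → A → A → Set
  Via []       x y = (x ≡ y) ⊎ R x y
  Via (z ∷ zs) x y = Via zs x y ⊎ (Via zs x z × Via zs z y)

  via? : ∀ zs x y → Dec (Via zs x y)
  via? []       x y = (x ≟ y) ⊎-dec R? x y
  via? (z ∷ zs) x y = via? zs x y ⊎-dec (via? zs x z ×-dec via? zs z y)

  via-sound : ∀ zs {x y} → Via zs x y → Star R x y
  via-sound []       (inj₁ refl)    = ε
  via-sound []       (inj₂ r)       = r ◅ ε
  via-sound (z ∷ zs) (inj₁ p)       = via-sound zs p
  via-sound (z ∷ zs) (inj₂ (p , q)) = via-sound zs p ◅◅ via-sound zs q

  via-refl : ∀ zs {x} → Via zs x x
  via-refl []       = inj₁ refl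
  via-refl (z ∷ zs) = inj₁ (via-refl zs)

  via-step : ∀ zs {x y} → R x y → Via zs x y
  via-step []       r = inj₂ r
  via-step (z ∷ zs) r = inj₁ (via-step zs r)

  via-trans : ∀ zs {x w y} → w Listed.∈ zs → Via zs x w → Via zs w y → Via zs x y
  via-trans (z ∷ zs) (here refl) p q = inj₂ (to p , from q)
    where
    to : ∀ {x} → Via (z ∷ zs) x z → Via zs x z
    to (inj₁ p)       = p
    to (inj₂ (p , _)) = p
    from : ∀ {y} → Via (z ∷ zs) z y → Via zs z y
    from (inj₁ q)       = q
    from (inj₂ (_ , q)) = q
  via-trans (z ∷ zs) (there w∈) (inj₁ p)       (inj₁ q)       = inj₁ (via-trans zs w∈ p q)
  via-trans (z ∷ zs) (there w∈) (inj₁ p)       (inj₂ (q , r)) = inj₂ (via-trans zs w∈ p q , r)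
  via-trans (z ∷ zs) (there w∈) (inj₂ (p , q)) (inj₁ r)       = inj₂ (p , via-trans zs w∈ q r)
  -- Both halves visit `z`: the closed detour from `z` over `w` back to `z` is cut out.
  via-trans (z ∷ zs) (there w∈) (inj₂ (p , _)) (inj₂ (_ , r)) = inj₂ (p , r)

  star? : ∀ zs → (∀ x → x Listed.∈ zs) → ∀ x y → Dec (Star R x y)
  star? zs all x y = map′ (via-sound zs) complete (via? zs x y)
    where
    complete : ∀ {x y} → Star R x y → Via zs x y
    complete ε       = via-refl zs
    complete (r ◅ p) = via-trans zs (all _) (via-step zs r) (complete p)

configurations : ∀ n → List (Configuration n)
configurations zero    = [] ∷ []
configurations (suc n) =
  List.map (true ∷_) (configurations n) List.++ List.map (false ∷_) (configurations n)

∈-configurations : (x : Configuration n) → x Listed.∈ configurations n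
∈-configurations []          = here refl
∈-configurations (true  ∷ x) = Listed.∈-++⁺ˡ (Listed.∈-map⁺ (true ∷_) (∈-configurations x))
∈-configurations (false ∷ x) =
  Listed.∈-++⁺ʳ (List.map (true ∷_) (configurations _)) (Listed.∈-map⁺ (false ∷_) (∈-configurations x))

-- The span of the hyperedges, and sets of states closed under moves

module _ (H : Hypergraph n) where

  data Span : Configuration n → Set where
    zero : Span 𝟘
    add  : ∀ {l z} → l is-hyperedge-of H → Span z → Span (l ⊕ z)

  -- Later instantiated with the set of states reachable from a fixed one. The obstruction argument
  -- works with closed sets so that "unreachable" is simply the complement of `P`.
  Closed : (Configuration n → Set) → Set
  Closed P = ∀ {l y v} → l is-hyperedge-of H → lookup l v ≡ true → lookup y v ≡ true → P y → P (l ⊕ y)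

module _ {H : Hypergraph n} where

  span-⊕ : ∀ {y z} → Span H y → Span H z → Span H (y ⊕ z)
  span-⊕ {z = z} zero    q = subst (Span H) (sym (⊕-identityˡ z)) q
  span-⊕ (add {l} {y} l∈ p) q = subst (Span H) (sym (⊕-assoc l y _)) (add l∈ (span-⊕ p q))

  span-edge : ∀ {l} → l is-hyperedge-of H → Span H l
  span-edge l∈ = subst (Span H) (⊕-identityʳ _) (add l∈ zero)

  move : ∀ {l v} (x : Configuration n) → l is-hyperedge-of H → lookup l v ≡ true → lookup x v ≡ true → Move H x (l ⊕ x)
  move {l} {v} x l∈ lv xv = l , l∈ , (v , Vec.lookup⇒[]= v l lv , xv) , refl

  reach-span : ∀ {x y} → Reachable H x y → Span H (x ⊕ y)
  reach-span {x} ε = subst (Span H) (sym (⊕-self x)) zero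
  reach-span {x} {y} ((l , l∈ , _ , refl) ◅ p) =
    subst (Span H) (trans (cong (l ⊕_) (⊕-assoc l x y)) (⊕-cancel l (x ⊕ y))) (add l∈ (reach-span p))

  reach-closed : ∀ {x} → Closed H (Reachable H x)
  reach-closed {y = y} l∈ lv yv p = p ◅◅ (move y l∈ lv yv ◅ ε)

  move? : ∀ x y → Dec (Move H x y)
  move? x y = map′ to from (Any.any? (λ l → Fin.any? (λ v → (lookup l v 𝔹.≟ true) ×-dec (lookup x v 𝔹.≟ true)) ×-dec (y ≟ᶜ (l ⊕ x))) H)
    where
    to : Any.Any _ H → Move H x y
    to a with Listed.find a
    ... | l , l∈ , (v , lv , xv) , eq = l , l∈ , (v , Vec.lookup⇒[]= v l lv , xv) , eq
    from : Move H x y → Any.Any _ H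
    from (l , l∈ , (v , v∈l , xv) , eq) = Listed.lose l∈ ((v , Vec.[]=⇒lookup v∈l , xv) , eq)

  reachable? : ∀ x y → Dec (Reachable H x y)
  reachable? = star? _≟ᶜ_ move? (configurations n) ∈-configurations

-- A state is recorded as a word telling which hyperedges of a fixed list have
-- been switched an odd number of times; whether a switch is legal then depends
-- only on the incidences of finitely many witnessing vertices.

module Play {H : Hypergraph n} {P : Configuration n → Set} (closed : Closed H P) (x : Configuration n) where

  Word : ℕ → Set
  Word = Vec Bool

  state : ∀ {m} → Vec (Subset n) m → Word m → Configuration n
  state []       []          = x
  state (e ∷ es) (true  ∷ w) = e ⊕ state es w
  state (e ∷ es) (false ∷ w) = state es w

  toggle : ∀ {m} → Fin m → Word m → Word m
  toggle i w = Vec.updateAt w i not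

  state-toggle : ∀ {m} (es : Vec (Subset n) m) i w → lookup es i ⊕ state es w ≡ state es (toggle i w)
  state-toggle (e ∷ es) zero    (true  ∷ w) = ⊕-cancel e (state es w)
  state-toggle (e ∷ es) zero    (false ∷ w) = refl
  state-toggle (e ∷ es) (suc i) (true  ∷ w) =
    trans (⊕-swap (lookup es i) e (state es w)) (cong (e ⊕_) (state-toggle es i w))
  state-toggle (e ∷ es) (suc i) (false ∷ w) = state-toggle es i w

  -- All that is needed of a witnessing vertex: its value in `x` and its incidences with the listed
  -- hyperedges determine its value in every `state`.
  Pattern : ℕ → Set
  Pattern m = Bool × Vec Bool m

  pattern-of : ∀ {m} → Vec (Subset n) m → Fin n → Pattern m
  pattern-of es v = lookup x v , Vec.map (λ e → lookup e v) es

  value : ∀ {m} → Pattern m → Word m → Bool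
  value (b , [])     []          = b
  value (b , c ∷ cs) (true  ∷ w) = c xor value (b , cs) w
  value (b , c ∷ cs) (false ∷ w) = value (b , cs) w

  state-at : ∀ {m} (es : Vec (Subset n) m) w v → lookup (state es w) v ≡ value (pattern-of es v) w
  state-at []       []          v = refl
  state-at (e ∷ es) (true  ∷ w) v = trans (⊕-at e (state es w) v) (cong (lookup e v xor_) (state-at es w v))
  state-at (e ∷ es) (false ∷ w) v = state-at es w v

  -- A move `(i , j)` switches hyperedge `i` on the strength of a ball at witness `j`.
  legal : ∀ {m k} → Vec (Pattern m) k → Word m → List (Fin m × Fin k) → Bool
  legal ps w []             = true
  legal ps w ((i , j) ∷ ms) =
    lookup (proj₂ (lookup ps j)) i ∧ value (lookup ps j) w ∧ legal ps (toggle i w) ms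

  final : ∀ {m k} → Word m → List (Fin m × Fin k) → Word m
  final w []             = w
  final w ((i , _) ∷ ms) = final (toggle i w) ms

  -- Once the patterns of the witnesses are concrete, `legal ps w ms` computes to `true`. A
  -- combinatorial argument is then given by its list of moves and `refl`.
  play : ∀ {m k} (es : Vec (Subset n) m) → (∀ i → lookup es i is-hyperedge-of H) →
         (vs : Vec (Fin n) k) (ps : Vec (Pattern m) k) → Vec.map (pattern-of es) vs ≡ ps →
         (w : Word m) (ms : List (Fin m × Fin k)) → legal ps w ms ≡ true →
         P (state es w) → P (state es (final w ms))
  play es es∈ vs ps eq w []             ok p = p
  play es es∈ vs ps eq w ((i , j) ∷ ms) ok p =
    play es es∈ vs ps eq (toggle i w) ms (𝔹.∧-conicalʳ (value τ w) _ rest)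
      (subst P (state-toggle es i w) (closed (es∈ i) on-edge on-state p))
    where
    τ = lookup ps j
    rest = 𝔹.∧-conicalʳ (lookup (proj₂ τ) i) _ ok
    τ-eq : pattern-of es (lookup vs j) ≡ τ
    τ-eq = trans (sym (Vec.lookup-map j (pattern-of es) vs)) (cong (λ qs → lookup qs j) eq)
    on-edge : lookup (lookup es i) (lookup vs j) ≡ true
    on-edge = trans (sym (Vec.lookup-map i (λ e → lookup e (lookup vs j)) es))
                (trans (cong (λ τ → lookup (proj₂ τ) i) τ-eq) (𝔹.∧-conicalˡ _ _ ok))
    on-state : lookup (state es w) (lookup vs j) ≡ true
    on-state = trans (state-at es w (lookup vs j))
                 (trans (cong (λ τ → value τ w) τ-eq) (𝔹.∧-conicalˡ (value τ w) _ rest))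

-- Obstructions to reachability and what they say about the hyperedges

Uniform : (l a s : Subset n) → Set
Uniform l a s =
  ∀ u v → lookup l u ≡ true → lookup l v ≡ true → lookup a u ≡ lookup a v → lookup s u ≡ lookup s v

span-agree : ∀ {H : Hypergraph n} {u v z} →
             (∀ {s} → s is-hyperedge-of H → lookup s u ≡ lookup s v) → Span H z → lookup z u ≡ lookup z v
span-agree {u = u} {v} eq zero = trans (𝟘-at u) (sym (𝟘-at v))
span-agree {u = u} {v} eq (add {l} {z} l∈ p) =
  trans (⊕-at l z u) (trans (cong₂ _xor_ (eq l∈) (span-agree eq p)) (sym (⊕-at l z v)))

differ : {x y : Configuration n} → x ≢ y →
         ∃[ v ] (lookup x v ≡ true × lookup y v ≡ false ⊎ lookup x v ≡ false × lookup y v ≡ true)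
differ {x = x} {y} x≢y with Fin.any? (λ v → ¬? (lookup x v 𝔹.≟ lookup y v))
... | no none = contradiction (ext λ v → 𝔹-stable v) x≢y
  where
  𝔹-stable : ∀ v → lookup x v ≡ lookup y v
  𝔹-stable v with lookup x v 𝔹.≟ lookup y v
  ... | yes eq = eq
  ... | no neq = contradiction (v , neq) none
... | yes (v , neq) with lookup x v in xv | lookup y v in yv
...   | true  | true  = contradiction refl neq
...   | true  | false = v , inj₁ (xv , yv)
...   | false | true  = v , inj₂ (xv , yv)
...   | false | false = contradiction refl neq

-- Applied to `l` and `g`: the part of `l` outside `g`, the intersection, and the part of `g`
-- outside `l`. In the token picture these are the three vertices of a path with edges `l` and `g`.
data Part : Set where
  first both second : Part

⟦_⟧ᵖ : Part → Bool → Bool → Bool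
⟦ first  ⟧ᵖ a b = a ∧ not b
⟦ both   ⟧ᵖ a b = a ∧ b
⟦ second ⟧ᵖ a b = not a ∧ b

mirror : Part → Part
mirror first  = second
mirror both   = both
mirror second = first

mirror-correct : ∀ k a b → ⟦ k ⟧ᵖ a b ≡ ⟦ mirror k ⟧ᵖ b a
mirror-correct first  true  true  = refl
mirror-correct first  true  false = refl
mirror-correct first  false true  = refl
mirror-correct first  false false = refl
mirror-correct both   a     b     = 𝔹.∧-comm a b
mirror-correct second true  true  = refl
mirror-correct second true  false = refl
mirror-correct second false true  = refl
mirror-correct second false false = refl

-- `P` stands for the states reachable from a nonzero configuration. The argument has to carry a
-- ball towards a given hyperedge; `origin` provides one in the case that the state at hand is 𝟘,
-- from which no move is possible.
module Obstruction
  {H : Hypergraph n} (connected : Connected H)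
  (nonempty : ∀ {l} → l is-hyperedge-of H → ∃[ v ] lookup l v ≡ true)
  {P : Configuration n → Set} (P? : ∀ x → Dec (P x)) (closed : Closed H P)
  (origin : P 𝟘 → ∃[ l ] l is-hyperedge-of H × P l)
  where

  avoids : ∀ {x l} → l is-hyperedge-of H → P x → ¬ P (l ⊕ x) → ∀ {v} → lookup l v ≡ true → lookup x v ≡ false
  avoids l∈ px nl lv = ≢true⇒≡false λ xv → nl (closed l∈ lv xv px)

  -- Think of x as having one token outside l ∪ g: adding l, g or both makes three.
  record Blocked (x : Configuration n) (l g : Subset n) : Set where
    field
      l∈  : l is-hyperedge-of H
      g∈  : g is-hyperedge-of H
      px  : P x
      ¬l  : ¬ P (l ⊕ x)
      ¬g  : ¬ P (g ⊕ x)
      ¬lg : ¬ P (l ⊕ g ⊕ x)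
      hub : Fin n
      l-hub : lookup l hub ≡ true
      g-hub : lookup g hub ≡ true

    x-l : ∀ {v} → lookup l v ≡ true → lookup x v ≡ false
    x-l = avoids l∈ px ¬l

  open Blocked

  flip : ∀ {x l g} → Blocked x l g → Blocked x g l
  flip {x} {l} {g} B = record
    { l∈ = g∈ B ; g∈ = l∈ B ; px = px B ; ¬l = ¬g B ; ¬g = ¬l B
    ; ¬lg = λ p → ¬lg B (subst P (⊕-swap g l x) p)
    ; hub = hub B ; l-hub = g-hub B ; g-hub = l-hub B }

  module Words₃ (x e l g : Configuration n) (e∈ : e is-hyperedge-of H)
                (l∈ : l is-hyperedge-of H) (g∈ : g is-hyperedge-of H) where
    open Play {H = H} {P} closed x public

    at : ∀ {v b c₀ c₁ c₂} → lookup x v ≡ b → lookup e v ≡ c₀ → lookup l v ≡ c₁ → lookup g v ≡ c₂ →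
         pattern-of (e ∷ l ∷ g ∷ []) v ≡ (b , c₀ ∷ c₁ ∷ c₂ ∷ [])
    at refl refl refl refl = refl

    run : ∀ {k} {vs : Vec (Fin n) k} {ps} → Vec.map (pattern-of (e ∷ l ∷ g ∷ [])) vs ≡ ps →
          ∀ w ms → legal ps w ms ≡ true → P (state (e ∷ l ∷ g ∷ []) w) → P (state (e ∷ l ∷ g ∷ []) (final w ms))
    run {vs = vs} {ps} eq = play (e ∷ l ∷ g ∷ []) (λ { 0F → e∈ ; 1F → l∈ ; 2F → g∈ }) vs ps eq

  nil≡ : {A : Set} → _≡_ {A = Vec A 0} [] []
  nil≡ = refl

  _∷≡_ : ∀ {A : Set} {k} {a b : A} {as bs : Vec A k} → a ≡ b → as ≡ bs → a Vec.∷ as ≡ b ∷ bs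
  refl ∷≡ refl = refl
  infixr 5 _∷≡_

  -- On the vertices that are empty in `x`, `e` is exactly one part of `l` and `g`, and this part
  -- contains such a vertex. In the token picture, switching `e` brings the token to one of the
  -- three vertices of the path.
  Spreads : (x l g e : Configuration n) → Part → Set
  Spreads x l g e k =
    (∀ {v} → lookup x v ≡ false → lookup e v ≡ ⟦ k ⟧ᵖ (lookup l v) (lookup g v)) ×
    ∃[ t ] lookup x t ≡ false × ⟦ k ⟧ᵖ (lookup l t) (lookup g t) ≡ true

  -- A vertex where `e` deviates from the predicted part allows to switch `l` or `g` or both while
  -- `e` is on and then to switch `e` back, which leaves a state forbidden by `Blocked`.
  spreads-l : ∀ {x l g e t} → Blocked x l g → e is-hyperedge-of H → P (e ⊕ x) →
              lookup e t ≡ true → lookup l t ≡ true → ∃[ k ] Spreads x l g e k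
  spreads-l {x} {l} {g} {e} {t} B e∈ pe et lt with lookup g t in gt
  ... | true  = both , shape , t , x-l B lt , cong₂ _∧_ lt gt
    where
    open Words₃ x e l g e∈ (l∈ B) (g∈ B)
    τ = at (x-l B lt) et lt gt
    w = true ∷ false ∷ false ∷ []
    shape : ∀ {v} → lookup x v ≡ false → lookup e v ≡ lookup l v ∧ lookup g v
    shape {v} xv with lookup e v in ev | lookup l v in lv | lookup g v in gv
    ... | true  | true  | true  = refl
    ... | true  | true  | false =
      ⊥-elim (¬g B (run (τ ∷≡ at xv ev lv gv ∷≡ nil≡) w ((2F , 0F) ∷ (0F , 1F) ∷ []) refl pe))
    ... | true  | false | _     =
      ⊥-elim (¬l B (run (τ ∷≡ at xv ev lv gv ∷≡ nil≡) w ((1F , 0F) ∷ (0F , 1F) ∷ []) refl pe))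
    ... | false | true  | true  =
      ⊥-elim (¬lg B (run (τ ∷≡ at xv ev lv gv ∷≡ nil≡) w ((1F , 0F) ∷ (2F , 1F) ∷ (0F , 0F) ∷ []) refl pe))
    ... | false | true  | false = refl
    ... | false | false | _     = refl
  ... | false = first , shape , t , x-l B lt , cong₂ (λ a b → a ∧ not b) lt gt
    where
    open Words₃ x e l g e∈ (l∈ B) (g∈ B)
    τ = at (x-l B lt) et lt gt
    w = true ∷ false ∷ false ∷ []
    shape : ∀ {v} → lookup x v ≡ false → lookup e v ≡ lookup l v ∧ not (lookup g v)
    shape {v} xv with lookup e v in ev | lookup l v in lv | lookup g v in gv
    ... | true  | true  | true  =
      ⊥-elim (¬g B (run (τ ∷≡ at xv ev lv gv ∷≡ nil≡) w ((2F , 1F) ∷ (0F , 0F) ∷ []) refl pe))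
    ... | true  | true  | false = refl
    ... | true  | false | _     =
      ⊥-elim (¬l B (run (τ ∷≡ at xv ev lv gv ∷≡ nil≡) w ((1F , 0F) ∷ (0F , 1F) ∷ []) refl pe))
    ... | false | true  | true  = refl
    ... | false | false | _     = refl
    -- A vertex of `l` outside both `e` and `g`. Here the moves also depend on the common vertex of
    -- `l` and `g`, which admits `g`.
    ... | false | true  | false with lookup e (hub B) in eh
    ...   | true  =
      ⊥-elim (¬g B (run (τ ∷≡ at (x-l B (l-hub B)) eh (l-hub B) (g-hub B) ∷≡ nil≡) w
        ((2F , 1F) ∷ (0F , 0F) ∷ []) refl pe))
    ...   | false =
      ⊥-elim (¬g B (run (τ ∷≡ at xv ev lv gv ∷≡ at (x-l B (l-hub B)) eh (l-hub B) (g-hub B) ∷≡ nil≡) w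
        ((1F , 0F) ∷ (2F , 2F) ∷ (1F , 1F) ∷ (0F , 0F) ∷ []) refl pe))

  Touches : (e l g : Subset n) → Set
  Touches e l g = ∃[ t ] lookup e t ≡ true × (lookup l t ≡ true ⊎ lookup g t ≡ true)

  touches? : ∀ e l g → Dec (Touches e l g)
  touches? e l g = Fin.any? λ t →
    (lookup e t 𝔹.≟ true) ×-dec ((lookup l t 𝔹.≟ true) ⊎-dec (lookup g t 𝔹.≟ true))

  spreads : ∀ {x l g e} → Blocked x l g → e is-hyperedge-of H → P (e ⊕ x) →
            Touches e l g → ∃[ k ] Spreads x l g e k
  spreads B e∈ pe (t , et , inj₁ lt) = spreads-l B e∈ pe et lt
  spreads {l = l} {g} B e∈ pe (t , et , inj₂ gt) with spreads-l (flip B) e∈ pe et gt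
  ... | k , shape , u , xu , ku =
    mirror k , (λ {v} xv → trans (shape xv) (mirror-correct k (lookup g v) (lookup l v))) ,
    u , xu , trans (sym (mirror-correct k (lookup g u) (lookup l u))) ku

  -- Were s not constant on one of the parts of l, this part could neither be
  -- emptied nor filled once s is switched, and its hyperedges could be used
  -- freely until one of the forbidden states is reached.
  module _ {x l g e} (B : Blocked x l g) (e∈ : e is-hyperedge-of H) (pe : P (e ⊕ x))
           {s} (s∈ : s is-hyperedge-of H) where

    private
      open Play {H = H} {P} closed x

      es : Vec (Subset n) 4
      es = e ∷ l ∷ g ∷ s ∷ []

      Shape : Part → Set
      Shape k = ∀ {v} → lookup x v ≡ false → lookup e v ≡ ⟦ k ⟧ᵖ (lookup l v) (lookup g v)

      at : ∀ {k v a b c} → Shape k → lookup x v ≡ false → lookup l v ≡ a → lookup g v ≡ b →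
           lookup s v ≡ c → pattern-of es v ≡ (false , ⟦ k ⟧ᵖ a b ∷ a ∷ b ∷ c ∷ [])
      at {v = v} shape xv refl refl refl =
        cong₂ _,_ xv (cong (_∷ lookup l v ∷ lookup g v ∷ lookup s v ∷ []) (shape xv))

      run : ∀ {k} {vs : Vec (Fin n) k} {ps} → Vec.map (pattern-of es) vs ≡ ps →
            ∀ ms → legal ps (true ∷ false ∷ false ∷ false ∷ []) ms ≡ true →
            P (state es (final (true ∷ false ∷ false ∷ false ∷ []) ms))
      run {vs = vs} {ps} eq ms ok =
        play es (λ { 0F → e∈ ; 1F → l∈ B ; 2F → g∈ B ; 3F → s∈ }) vs ps eq _ ms ok pe

    part-split : ∀ k {u v} → Spreads x l g e k → lookup l u ≡ true → lookup l v ≡ true →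
                 lookup g u ≡ lookup g v → lookup s u ≡ true → lookup s v ≡ false → ⊥
    part-split k {u} {v} (shape , t , xt , kt) lu lv guv su sv
      with lookup g u in gu | lookup l t in lt | lookup g t in gt | lookup s t in st | lookup s (hub B) in sh
    -- In every case `s` is switched on and off again, both times by a ball at `u`. While it is on,
    -- `u` and `v` hold different values, because all other hyperedges in play agree on them; so one
    -- of the two can always serve as a witness.
    part-split both {u} {v} (shape , t , xt , kt) lu lv guv su sv | true | _ | _ | _ | _ =
      ¬lg B (run (at {both} shape (x-l B lu) lu gu su
              ∷≡ at {both} shape (x-l B lv) lv (sym guv) sv ∷≡ nil≡)
        ((3F , 0F) ∷ (1F , 1F) ∷ (2F , 0F) ∷ (0F , 1F) ∷ (3F , 0F) ∷ []) refl)
    part-split first {u} {v} (shape , t , xt , kt) lu lv guv su sv | true | true | false | true | _ =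
      ¬lg B (run (at {first} shape (x-l B lu) lu gu su
              ∷≡ at {first} shape (x-l B lv) lv (sym guv) sv
              ∷≡ at {first} shape xt lt gt st ∷≡ nil≡)
        ((1F , 2F) ∷ (3F , 0F) ∷ (0F , 2F) ∷ (2F , 1F) ∷ (3F , 0F) ∷ []) refl)
    part-split first {u} {v} (shape , t , xt , kt) lu lv guv su sv | true | true | false | false | _ =
      ¬lg B (run (at {first} shape (x-l B lu) lu gu su
              ∷≡ at {first} shape (x-l B lv) lv (sym guv) sv
              ∷≡ at {first} shape xt lt gt st ∷≡ nil≡)
        ((1F , 2F) ∷ (3F , 0F) ∷ (1F , 1F) ∷ (0F , 2F) ∷ (1F , 0F) ∷ (2F , 1F) ∷ (3F , 0F) ∷ []) refl)
    part-split second {u} {v} (shape , t , xt , kt) lu lv guv su sv | true | false | true | true | _ =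
      ¬lg B (run (at {second} shape (x-l B lu) lu gu su
              ∷≡ at {second} shape (x-l B lv) lv (sym guv) sv
              ∷≡ at {second} shape xt lt gt st ∷≡ nil≡)
        ((2F , 2F) ∷ (3F , 0F) ∷ (0F , 2F) ∷ (1F , 1F) ∷ (3F , 0F) ∷ []) refl)
    part-split second {u} {v} (shape , t , xt , kt) lu lv guv su sv | true | false | true | false | _ =
      ¬lg B (run (at {second} shape (x-l B lu) lu gu su
              ∷≡ at {second} shape (x-l B lv) lv (sym guv) sv
              ∷≡ at {second} shape xt lt gt st ∷≡ nil≡)
        ((2F , 2F) ∷ (3F , 0F) ∷ (2F , 1F) ∷ (0F , 2F) ∷ (2F , 0F) ∷ (1F , 1F) ∷ (3F , 0F) ∷ []) refl)
    part-split first {u} {v} (shape , t , xt , kt) lu lv guv su sv | false | _ | _ | _ | true =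
      ¬g B (run (at {first} shape (x-l B lu) lu gu su
              ∷≡ at {first} shape (x-l B lv) lv (sym guv) sv
              ∷≡ at {first} shape (x-l B (l-hub B)) (l-hub B) (g-hub B) sh ∷≡ nil≡)
        ((3F , 0F) ∷ (2F , 2F) ∷ (0F , 1F) ∷ (3F , 0F) ∷ []) refl)
    part-split first {u} {v} (shape , t , xt , kt) lu lv guv su sv | false | _ | _ | _ | false =
      ¬g B (run (at {first} shape (x-l B lu) lu gu su
              ∷≡ at {first} shape (x-l B lv) lv (sym guv) sv
              ∷≡ at {first} shape (x-l B (l-hub B)) (l-hub B) (g-hub B) sh ∷≡ nil≡)
        ((3F , 0F) ∷ (1F , 1F) ∷ (2F , 2F) ∷ (1F , 0F) ∷ (0F , 1F) ∷ (3F , 0F) ∷ []) refl)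
    part-split both {u} {v} (shape , t , xt , kt) lu lv guv su sv | false | _ | _ | _ | true =
      ¬g B (run (at {both} shape (x-l B lu) lu gu su
              ∷≡ at {both} shape (x-l B lv) lv (sym guv) sv
              ∷≡ at {both} shape (x-l B (l-hub B)) (l-hub B) (g-hub B) sh ∷≡ nil≡)
        ((1F , 2F) ∷ (3F , 0F) ∷ (0F , 2F) ∷ (1F , 1F) ∷ (2F , 2F) ∷ (3F , 0F) ∷ []) refl)
    part-split both {u} {v} (shape , t , xt , kt) lu lv guv su sv | false | _ | _ | _ | false =
      ¬g B (run (at {both} shape (x-l B lu) lu gu su
              ∷≡ at {both} shape (x-l B lv) lv (sym guv) sv
              ∷≡ at {both} shape (x-l B (l-hub B)) (l-hub B) (g-hub B) sh ∷≡ nil≡)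
        ((1F , 2F) ∷ (3F , 0F) ∷ (1F , 1F) ∷ (0F , 2F) ∷ (1F , 0F) ∷ (2F , 2F) ∷ (1F , 1F) ∷ (3F , 0F) ∷ []) refl)
    part-split second {u} {v} (shape , t , xt , kt) lu lv guv su sv | false | false | true | true | _ =
      ¬g B (run (at {second} shape (x-l B lu) lu gu su
              ∷≡ at {second} shape (x-l B lv) lv (sym guv) sv
              ∷≡ at {second} shape (x-l B (l-hub B)) (l-hub B) (g-hub B) sh
              ∷≡ at {second} shape xt lt gt st ∷≡ nil≡)
        ((2F , 3F) ∷ (1F , 2F) ∷ (3F , 0F) ∷ (0F , 3F) ∷ (1F , 1F) ∷ (3F , 0F) ∷ []) refl)
    part-split second {u} {v} (shape , t , xt , kt) lu lv guv su sv | false | false | true | false | true =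
      ¬g B (run (at {second} shape (x-l B lu) lu gu su
              ∷≡ at {second} shape (x-l B lv) lv (sym guv) sv
              ∷≡ at {second} shape (x-l B (l-hub B)) (l-hub B) (g-hub B) sh
              ∷≡ at {second} shape xt lt gt st ∷≡ nil≡)
        ((2F , 3F) ∷ (1F , 2F) ∷ (3F , 0F) ∷ (2F , 2F) ∷ (0F , 3F) ∷ (1F , 1F) ∷ (2F , 2F) ∷ (3F , 0F) ∷ []) refl)
    part-split second {u} {v} (shape , t , xt , kt) lu lv guv su sv | false | false | true | false | false =
      ¬g B (run (at {second} shape (x-l B lu) lu gu su
              ∷≡ at {second} shape (x-l B lv) lv (sym guv) sv
              ∷≡ at {second} shape (x-l B (l-hub B)) (l-hub B) (g-hub B) sh
              ∷≡ at {second} shape xt lt gt st ∷≡ nil≡)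
        ((2F , 3F) ∷ (1F , 2F) ∷ (3F , 0F) ∷ (1F , 1F) ∷ (2F , 2F) ∷ (0F , 3F) ∷ (1F , 0F) ∷ (2F , 2F) ∷ (1F , 1F) ∷ (3F , 0F) ∷ []) refl)

    uniform : ∀ k → Spreads x l g e k → Uniform l g s
    uniform k sp u v lu lv guv with lookup s u in su | lookup s v in sv
    ... | true  | true  = refl
    ... | true  | false = ⊥-elim (part-split k sp lu lv guv su sv)
    ... | false | true  = ⊥-elim (part-split k sp lv lu (sym guv) sv su)
    ... | false | false = refl

  -- If `s` cannot be switched, it forms a new path together with `l`. If it can, it brings the
  -- token onto the path `l`, `g`. The token is then walked on to an end of that path, and `s`
  -- together with the edge that it meets away from this end forms the new path.
  propagate : ∀ {x l g s m} → Blocked x l g → s is-hyperedge-of H → lookup s m ≡ true → lookup l m ≡ true →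
              ∃[ y ] ∃[ h ] Blocked y s h
  propagate {x} {l} {g} {s} {m} B s∈ sm lm with P? (s ⊕ x)
  ... | no ¬s with s ≟ᶜ l
  ...   | yes refl = x , g , B
  ...   | no s≢l = x , l , record
    { l∈ = s∈ ; g∈ = l∈ B ; px = px B ; ¬l = ¬s ; ¬g = ¬l B ; ¬lg = ¬sl ; hub = m ; l-hub = sm ; g-hub = lm }
    where
    open Words₃ x s l g s∈ (l∈ B) (g∈ B)
    ¬sl : ¬ P (s ⊕ l ⊕ x)
    -- One of the two distinct hyperedges has a vertex outside the other, and there it can be
    -- switched back.
    ¬sl p with differ s≢l
    ... | v , inj₁ (sv , lv) =
      ¬l B (run (at (avoids s∈ (px B) ¬s sv) sv lv refl ∷≡ nil≡) (true ∷ true ∷ false ∷ []) ((0F , 0F) ∷ []) refl p)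
    ... | v , inj₂ (sv , lv) =
      ¬s (run (at (x-l B lv) sv lv refl ∷≡ nil≡) (true ∷ true ∷ false ∷ []) ((1F , 0F) ∷ []) refl p)
  propagate {x} {l} {g} {s} {m} B s∈ sm lm | yes ps with spreads-l B s∈ ps sm lm
  ... | both , shape , _ = s ⊕ l ⊕ x , g , record
    { l∈ = s∈ ; g∈ = g∈ B
    ; px = run (at (x-l B lm) sm lm refl ∷≡ nil≡) (true ∷ false ∷ false ∷ []) ((1F , 0F) ∷ []) refl ps
    ; ¬l = λ p → ¬l B (subst P (⊕-cancel s (l ⊕ x)) p)
    ; ¬g = λ p → ¬lg B (run (at (x-l B (l-hub B)) s-hub (l-hub B) (g-hub B) ∷≡ nil≡) (true ∷ true ∷ true ∷ [])
                           ((0F , 0F) ∷ []) refl (subst P gsl p))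
    ; ¬lg = λ p → ¬lg B (subst P (trans (cong (s ⊕_) gsl) (⊕-cancel s (l ⊕ g ⊕ x))) p)
    ; hub = hub B ; l-hub = s-hub ; g-hub = g-hub B }
    where
    open Words₃ x s l g s∈ (l∈ B) (g∈ B)
    s-hub : lookup s (hub B) ≡ true
    s-hub = trans (shape (x-l B (l-hub B))) (cong₂ _∧_ (l-hub B) (g-hub B))
    gsl : g ⊕ s ⊕ l ⊕ x ≡ s ⊕ l ⊕ g ⊕ x
    gsl = trans (⊕-swap g s (l ⊕ x)) (cong (s ⊕_) (⊕-swap g l x))
  ... | first , shape , _ = s ⊕ l ⊕ g ⊕ x , l , record
    { l∈ = s∈ ; g∈ = l∈ B
    ; px = run (at (x-l B lm) sm lm refl ∷≡ at (x-l B (l-hub B)) s-hub (l-hub B) (g-hub B) ∷≡ nil≡)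
             (true ∷ false ∷ false ∷ []) ((1F , 0F) ∷ (2F , 1F) ∷ []) refl ps
    ; ¬l = λ p → ¬lg B (subst P (⊕-cancel s (l ⊕ g ⊕ x)) p)
    ; ¬g = λ p → ¬g B (run (at (x-l B lm) sm lm g-m ∷≡ nil≡) (true ∷ false ∷ true ∷ []) ((0F , 0F) ∷ []) refl
                         (subst P lslg p))
    ; ¬lg = λ p → ¬g B (subst P (trans (cong (s ⊕_) lslg) (⊕-cancel s (g ⊕ x))) p)
    ; hub = m ; l-hub = sm ; g-hub = lm }
    where
    open Words₃ x s l g s∈ (l∈ B) (g∈ B)
    s-hub : lookup s (hub B) ≡ false
    s-hub = trans (shape (x-l B (l-hub B))) (cong₂ (λ a b → a ∧ not b) (l-hub B) (g-hub B))
    g-m : lookup g m ≡ false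
    g-m with lookup g m | trans (sym sm) (trans (shape (x-l B lm)) (cong (_∧ not (lookup g m)) lm))
    ... | false | _ = refl
    lslg : l ⊕ s ⊕ l ⊕ g ⊕ x ≡ s ⊕ g ⊕ x
    lslg = trans (⊕-swap l s (l ⊕ g ⊕ x)) (cong (s ⊕_) (⊕-cancel l (g ⊕ x)))
  ... | second , shape , _ =
    contradiction (trans (sym sm) (trans (shape (x-l B lm)) (cong (λ a → not a ∧ lookup g m) lm))) true≢false

  -- As `f` avoids `l` and `g`, it can be switched back at `v` also after these have been switched;
  -- so the forbidden states stay forbidden.
  advance : ∀ {x l g f v} → Blocked x l g → f is-hyperedge-of H → P (f ⊕ x) → ¬ Touches f l g →
            lookup f v ≡ true → lookup x v ≡ false → Blocked (f ⊕ x) l g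
  advance {x} {l} {g} {f} {v} B f∈ pf free fv xv = record
    { l∈ = l∈ B ; g∈ = g∈ B ; px = pf
    ; ¬l = λ p → ¬l B (run τ (true ∷ true ∷ false ∷ []) ((0F , 0F) ∷ []) refl (subst P (⊕-swap l f x) p))
    ; ¬g = λ p → ¬g B (run τ (true ∷ false ∷ true ∷ []) ((0F , 0F) ∷ []) refl (subst P (⊕-swap g f x) p))
    ; ¬lg = λ p → ¬lg B (run τ (true ∷ true ∷ true ∷ []) ((0F , 0F) ∷ []) refl
                    (subst P (trans (cong (l ⊕_) (⊕-swap g f x)) (⊕-swap l f (g ⊕ x))) p))
    ; hub = hub B ; l-hub = l-hub B ; g-hub = g-hub B }
    where
    open Words₃ x f l g f∈ (l∈ B) (g∈ B)
    τ = at xv fv (≢true⇒≡false λ lv → free (v , fv , inj₁ lv)) (≢true⇒≡false λ gv → free (v , fv , inj₂ gv)) ∷≡ nil≡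

  Fed : (l g : Subset n) → Set
  Fed l g = ∃[ x ] ∃[ e ] Blocked x l g × e is-hyperedge-of H × P (e ⊕ x) × Touches e l g

  -- A ball is carried along the path. The first hyperedge that meets `l` or `g` contains the ball,
  -- hence can be switched, and is the `e` that `spreads` asks for.
  feed-along : ∀ {x l g v w} → Blocked x l g → lookup x v ≡ true → Star (Adjacent H) v w → lookup l w ≡ true → Fed l g
  feed-along B xv ε lw = contradiction (trans (sym xv) (x-l B lw)) true≢false
  feed-along {x} {l} {g} B xv (_◅_ {j = v₁} (f , f∈ , v∈f , v₁∈f) path) lw
    with touches? f l g | closed f∈ (Vec.[]=⇒lookup v∈f) xv (px B) | lookup x v₁ in xv₁
  ... | yes touch | pf | _     = x , f , B , f∈ , pf , touch
  ... | no free   | pf | true  = feed-along B xv₁ path lw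
  ... | no free   | pf | false =
    feed-along (advance B f∈ pf free (Vec.[]=⇒lookup v₁∈f) xv₁)
      (trans (⊕-at f x v₁) (cong₂ _xor_ (Vec.[]=⇒lookup v₁∈f) xv₁)) path lw

  feed : ∀ {x l g} → Blocked x l g → Fed l g
  feed {x} {l} {g} B with x ≟ᶜ 𝟘
  ... | no x≢𝟘 with ≢𝟘⇒ball x≢𝟘
  ...   | v , xv = feed-along B xv (connected v (hub B)) (l-hub B)
  feed {x} {l} {g} B | yes refl with origin (px B)
  ...   | f , f∈ , pf with touches? f l g | nonempty f∈ | subst P (sym (⊕-identityʳ f)) pf
  ...     | yes touch | _ | pf′ = 𝟘 , f , B , f∈ , pf′ , touch
  ...     | no free | v , fv | pf′ =
    feed-along (advance B f∈ pf′ free fv (𝟘-at v))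
      (trans (⊕-at f 𝟘 v) (cong₂ _xor_ fv (𝟘-at v))) (connected v (hub B)) (l-hub B)

  -- Now an empty vertex travels towards `l`. The first hyperedge `f` that meets `l` is the second
  -- edge of the blocked pair: could it be switched, then `l` could be switched at the common vertex
  -- and `f` switched back at the empty vertex `v`.
  barrier-along : ∀ {x l v w} → l is-hyperedge-of H → P x → ¬ P (l ⊕ x) → lookup x v ≡ false → lookup l v ≡ false →
                  Star (Adjacent H) v w → lookup l w ≡ true → ∃[ y ] ∃[ g ] Blocked y l g
  barrier-along l∈ px nl xv lv ε lw = contradiction (trans (sym lw) lv) true≢false
  barrier-along {x} {l} {v} l∈ px nl xv lv (_◅_ {j = v₁} (f , f∈ , v∈f , v₁∈f) path) lw
    with touches? f l l | Vec.[]=⇒lookup v∈f | Vec.[]=⇒lookup v₁∈f | lookup x v₁ in xv₁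
  ... | yes (t , ft , touch) | fv | _ | _ = x , f , record
    { l∈ = l∈ ; g∈ = f∈ ; px = px ; ¬l = nl
    ; ¬g = λ p → nl (run (at xt ft lt lt ∷≡ at xv fv lv lv ∷≡ nil≡) (true ∷ false ∷ false ∷ [])
                      ((1F , 0F) ∷ (0F , 1F) ∷ []) refl p)
    ; ¬lg = λ p → nl (run (at xv fv lv lv ∷≡ nil≡) (true ∷ true ∷ false ∷ []) ((0F , 0F) ∷ []) refl
                       (subst P (⊕-swap l f x) p))
    ; hub = t ; l-hub = lt ; g-hub = ft }
    where
    open Words₃ x f l l f∈ l∈ l∈
    lt : lookup l t ≡ true
    lt = Sum.reduce touch
    xt = avoids l∈ px nl lt
  ... | no free | fv | fv₁ | false =
    barrier-along l∈ px nl xv₁ (≢true⇒≡false λ lv₁ → free (v₁ , fv₁ , inj₁ lv₁)) path lw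
  ... | no free | fv | fv₁ | true =
    barrier-along l∈ (closed f∈ fv₁ xv₁ px)
      (λ p → nl (run (at xv fv lv lv ∷≡ nil≡) (true ∷ true ∷ false ∷ []) ((0F , 0F) ∷ []) refl
                   (subst P (⊕-swap l f x) p)))
      (trans (⊕-at f x v₁) (cong₂ _xor_ fv₁ xv₁)) (≢true⇒≡false λ lv₁ → free (v₁ , fv₁ , inj₁ lv₁)) path lw
    where open Words₃ x f l l f∈ l∈ l∈

  -- Where `l ⊕ x` vanishes, `l` and `x` both do, since a ball of `x` on `l` would make the switch
  -- legal. This is the empty vertex to start from.
  barrier⇒blocked : ∀ {x l} → l is-hyperedge-of H → P x → ¬ P (l ⊕ x) → l ⊕ x ≢ 𝟙 → ∃[ y ] ∃[ g ] Blocked y l g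
  barrier⇒blocked {x} {l} l∈ px nl z≢𝟙 with ≢𝟙⇒gap z≢𝟙 | nonempty l∈
  ... | v , zv | w , lw with lookup x v in xv | lookup l v in lv | trans (sym (⊕-at l x v)) zv
  ...   | false | false | _ = barrier-along l∈ px nl xv lv (connected v w) lw
  ...   | true  | true  | _ = contradiction (closed l∈ lv xv px) nl

  blocked-along : ∀ {x l g u w h} → Blocked x l g → lookup l u ≡ true → Star (Adjacent H) u w →
                  h is-hyperedge-of H → lookup h w ≡ true → ∃[ y ] ∃[ f ] Blocked y h f
  blocked-along B lu ε h∈ hw = propagate B h∈ hw lu
  blocked-along B lu ((f , f∈ , u∈f , u₁∈f) ◅ path) h∈ hw with propagate B f∈ (Vec.[]=⇒lookup u∈f) lu
  ... | _ , _ , B′ = blocked-along B′ (Vec.[]=⇒lookup u₁∈f) path h∈ hw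

  -- The state `y` is returned in order to extend uniformity from hyperedges to configurations: on
  -- `h`, where `y` vanishes, a configuration in the coset of `y` coincides with an element of the
  -- span.
  barrier⇒uniform : ∀ {x l} → l is-hyperedge-of H → P x → ¬ P (l ⊕ x) → l ⊕ x ≢ 𝟙 →
    ∀ {h} → h is-hyperedge-of H →
    ∃[ a ] a is-hyperedge-of H × (∀ {s} → s is-hyperedge-of H → Uniform h a s) ×
    ∃[ y ] P y × (∀ v → lookup h v ≡ true → lookup y v ≡ false)
  barrier⇒uniform l∈ px nl z≢𝟙 h∈ with barrier⇒blocked l∈ px nl z≢𝟙 | nonempty h∈
  ... | _ , _ , B | w , hw with blocked-along B (l-hub B) (connected (hub B) w) h∈ hw
  ...   | _ , a , B′ with feed B′
  ...     | y , e , B″ , e∈ , pe , touch with spreads B″ e∈ pe touch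
  ...       | k , sp = a , g∈ B″ , (λ s∈ → uniform B″ e∈ pe s∈ k sp) , y , Blocked.px B″ , (λ v hv → x-l B″ hv)

-- Mixing: reaching the whole coset except 𝟙

module _ {H : Hypergraph n} (connected : Connected H)
         (nonempty : ∀ {l} → l is-hyperedge-of H → ∃[ v ] lookup l v ≡ true) where

  -- The state before the first visit to 𝟘 equals the hyperedge that is switched there.
  reach-𝟘 : ∀ {x} → x ≢ 𝟘 → Reachable H x 𝟘 → ∃[ l ] l is-hyperedge-of H × Reachable H x l
  reach-𝟘 x≢𝟘 p = last p refl ε x≢𝟘
    where
    last : ∀ {x y z} → Reachable H y z → z ≡ 𝟘 → Reachable H x y → y ≢ 𝟘 →
           ∃[ l ] l is-hyperedge-of H × Reachable H x l
    last ε z≡𝟘 q y≢𝟘 = contradiction z≡𝟘 y≢𝟘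
    last {y = y} (_◅_ {j = z} m@(l , l∈ , _ , z≡) p) w≡𝟘 q y≢𝟘 with z ≟ᶜ 𝟘
    ... | no z≢𝟘   = last p w≡𝟘 (q ◅◅ (m ◅ ε)) z≢𝟘
    ... | yes refl = l , l∈ , subst (Reachable H _) (sym (⊕≡𝟘⇒≡ (sym z≡))) q

  -- The negated condition admits any `w` in the coset of `x₀`. It will be applied with `w₁` and
  -- `w₂` as `w` while `x₀` is a later state of a path.
  mixing : ∀ {x₀} → x₀ ≢ 𝟘 →
    ¬ (∀ {h} → h is-hyperedge-of H →
       ∃[ a ] a is-hyperedge-of H × ∀ {w s} → s is-hyperedge-of H ⊎ s ≡ w × Span H (w ⊕ x₀) → Uniform h a s) →
    ∀ {y} → y ≢ 𝟙 → Span H (x₀ ⊕ y) → Reachable H x₀ y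
  mixing {x₀} x₀≢𝟘 ¬graph {y} y≢𝟙 span = finish (good span)
    where
    P = Reachable H x₀
    open Obstruction connected nonempty {P} (reachable? x₀) reach-closed (reach-𝟘 x₀≢𝟘)

    free : ∀ {l x} → l is-hyperedge-of H → P x → l ⊕ x ≢ 𝟙 → P (l ⊕ x)
    free {l} {x} l∈ px z≢𝟙 with reachable? x₀ (l ⊕ x)
    ... | yes p = p
    ... | no nl = ⊥-elim (¬graph graph)
      where
      graph : ∀ {h} → h is-hyperedge-of H →
        ∃[ a ] a is-hyperedge-of H × ∀ {w s} → s is-hyperedge-of H ⊎ s ≡ w × Span H (w ⊕ x₀) → Uniform h a s
      graph h∈ = let a , a∈ , uni , z , pz , zh = barrier⇒uniform l∈ px nl z≢𝟙 h∈ in a , a∈ , λ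
        { (inj₁ s∈) → uni s∈
        ; {w = w} (inj₂ (refl , sp)) u v hu hv auv →
            let sp′ : Span H (w ⊕ z)
                sp′ = subst (Span H) (trans (⊕-assoc w x₀ (x₀ ⊕ z)) (cong (w ⊕_) (⊕-cancel x₀ z)))
                        (span-⊕ sp (reach-span pz))
                eq = span-agree (λ s∈ → uni s∈ u v hu hv auv) sp′
                at : ∀ {t} → lookup z t ≡ false → lookup (w ⊕ z) t ≡ lookup w t
                at {t} zt = trans (⊕-at w z t) (trans (cong (lookup w t xor_) zt) (𝔹.xor-identityʳ _))
            in trans (sym (at (zh u hu))) (trans eq (at (zh v hv))) }

    -- 𝟙 can be left but not entered, so walks through it have to be rerouted.
    Good : Configuration n → Set
    Good z = P z ⊎ (z ≡ 𝟙 × ∃[ l ] l is-hyperedge-of H × P (l ⊕ 𝟙))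

    good-step : ∀ {l z} → l is-hyperedge-of H → Good z → Good (l ⊕ z)
    good-step {l} {z} l∈ (inj₁ pz) with (l ⊕ z) ≟ᶜ 𝟙
    ... | no ≢𝟙  = inj₁ (free l∈ pz ≢𝟙)
    ... | yes eq = inj₂ (eq , l , l∈ , subst P (⊕-moveˡ eq) pz)
    good-step {l} l∈ (inj₂ (refl , l′ , l′∈ , p)) with (l ⊕ l′ ⊕ 𝟙) ≟ᶜ 𝟙
    ... | yes eq = inj₁ (subst P (⊕-moveˡ eq) p)
    -- Instead of entering 𝟙 by `l′` and leaving it by `l`, the two switches are made in the
    -- opposite order.
    ... | no ≢𝟙  = inj₁ (subst P back (free l′∈ (free l∈ p ≢𝟙) λ eq → not-full (trans (sym back) eq)))
      where
      back : l′ ⊕ l ⊕ l′ ⊕ 𝟙 ≡ l ⊕ 𝟙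
      back = trans (cong (l′ ⊕_) (⊕-swap l l′ 𝟙)) (⊕-cancel l′ (l ⊕ 𝟙))
      not-full : l ⊕ 𝟙 ≢ 𝟙
      not-full with nonempty l∈
      ... | v , lv = gap⇒≢𝟙 {v = v} (trans (⊕-at l 𝟙 v) (cong₂ _xor_ lv (𝟙-at v)))

    good : ∀ {z} → Span H z → Good (x₀ ⊕ z)
    good zero = inj₁ (subst P (sym (⊕-identityʳ x₀)) ε)
    good (add {l} {z} l∈ s) = subst Good (⊕-swap l x₀ z) (good-step l∈ (good s))

    finish : Good (x₀ ⊕ x₀ ⊕ y) → P y
    finish g with subst Good (⊕-cancel x₀ y) g
    ... | inj₁ p       = p
    ... | inj₂ (eq , _) = contradiction eq y≢𝟙

-- Hypergraphs with at most two twin classes per hyperedge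

module Twins {H : Hypergraph n} (connected : Connected H)
             (nonempty : ∀ {l} → l is-hyperedge-of H → ∃[ v ] lookup l v ≡ true) where

  record _≈_ (u v : Fin n) : Set where
    constructor twins
    field agree : ∀ {s} → s is-hyperedge-of H → lookup s u ≡ lookup s v
  open _≈_ public

  _≈?_ : ∀ u v → Dec (u ≈ v)
  u ≈? v = map′ (λ a → twins (All.lookup a)) (λ e → All.tabulate (agree e))
             (All.all? (λ s → lookup s u 𝔹.≟ lookup s v) H)

  ≈-refl : ∀ {u} → u ≈ u
  ≈-refl = twins λ _ → refl

  ≈-sym : ∀ {u v} → u ≈ v → v ≈ u
  ≈-sym e = twins λ s∈ → sym (agree e s∈)

  ≈-trans : ∀ {u v w} → u ≈ v → v ≈ w → u ≈ w
  ≈-trans e f = twins λ s∈ → trans (agree e s∈) (agree f s∈)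

  class : Fin n → Configuration n
  class u = tabulate λ v → does (u ≈? v)

  class-in : ∀ {u v} → u ≈ v → lookup (class u) v ≡ true
  class-in {u} {v} e = trans (Vec.lookup∘tabulate _ v) (dec-true (u ≈? v) e)

  class-out : ∀ {u v} → ¬ u ≈ v → lookup (class u) v ≡ false
  class-out {u} {v} ne = trans (Vec.lookup∘tabulate _ v) (dec-false (u ≈? v) ne)

  class-cong : ∀ {u v} → u ≈ v → class u ≡ class v
  class-cong {u} {v} e = ext λ w → by w (v ≈? w)
    where
    by : ∀ w → Dec (v ≈ w) → lookup (class u) w ≡ lookup (class v) w
    by w (yes f) = trans (class-in (≈-trans e f)) (sym (class-in f))
    by w (no ¬f) = trans (class-out λ g → ¬f (≈-trans (≈-sym e) g)) (sym (class-out ¬f))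

  in-class : ∀ {u v} → lookup (class u) v ≡ true → u ≈ v
  in-class {u} {v} on with u ≈? v
  ... | yes e = e
  ... | no ¬e = contradiction (trans (sym on) (class-out ¬e)) true≢false

  Saturated : Configuration n → Set
  Saturated x = ∀ {u v} → u ≈ v → lookup x u ≡ lookup x v

  saturated-⊕ : ∀ x y → Saturated x → Saturated y → Saturated (x ⊕ y)
  saturated-⊕ x y p q {u} {v} e = trans (⊕-at x y u) (trans (cong₂ _xor_ (p e) (q e)) (sym (⊕-at x y v)))

  saturated-class : ∀ u → Saturated (class u)
  saturated-class u {v} {w} e with u ≈? v
  ... | yes f = trans (class-in f) (sym (class-in (≈-trans f e)))
  ... | no ¬f = trans (class-out ¬f) (sym (class-out λ g → ¬f (≈-trans g (≈-sym e))))

  saturated-span : ∀ {z} → Span H z → Saturated z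
  saturated-span s e = span-agree (agree e) s

  Halved : Configuration n → Set
  Halved x = ∃[ a ] a is-hyperedge-of H ×
    (∀ u v → lookup x u ≡ true → lookup x v ≡ true → lookup a u ≡ lookup a v → u ≈ v)

  data Small : Configuration n → Set where
    none : Small 𝟘
    one  : ∀ u → Small (class u)
    two  : ∀ u v → ¬ u ≈ v → Small (class u ⊕ class v)

  small : ∀ {x} → Saturated x → Halved x → Small x
  small {x} sat (a , _ , halved) with x ≟ᶜ 𝟘
  ... | yes refl = none
  ... | no x≢𝟘 with ≢𝟘⇒ball x≢𝟘
  ...   | u , xu with Fin.any? (λ v → (lookup x v 𝔹.≟ true) ×-dec ¬? (u ≈? v))
  ...     | no single = subst Small (sym (ext λ w → by w (u ≈? w))) (one u)
    where
    by : ∀ w → Dec (u ≈ w) → lookup x w ≡ lookup (class u) w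
    by w (yes e) = trans (trans (sym (sat e)) xu) (sym (class-in e))
    by w (no ¬e) = trans (≢true⇒≡false λ xw → single (w , xw , ¬e)) (sym (class-out ¬e))
  ...     | yes (v , xv , u≉v) = subst Small (sym (ext λ w → by w (u ≈? w) (v ≈? w))) (two u v u≉v)
    where
    third : ∀ w → ¬ u ≈ w → ¬ v ≈ w → lookup x w ≢ true
    third w ¬e ¬f xw with lookup a u in au | lookup a v in av | lookup a w in aw
    ... | true  | true  | _     = u≉v (halved u v xu xv (trans au (sym av)))
    ... | false | false | _     = u≉v (halved u v xu xv (trans au (sym av)))
    ... | true  | false | true  = ¬e (halved u w xu xw (trans au (sym aw)))
    ... | true  | false | false = ¬f (halved v w xv xw (trans av (sym aw)))
    ... | false | true  | true  = ¬f (halved v w xv xw (trans av (sym aw)))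
    ... | false | true  | false = ¬e (halved u w xu xw (trans au (sym aw)))
    by : ∀ w → Dec (u ≈ w) → Dec (v ≈ w) → lookup x w ≡ lookup (class u ⊕ class v) w
    by w (yes e) (yes f) = contradiction (≈-trans e (≈-sym f)) u≉v
    by w (yes e) (no ¬f) = trans (trans (sym (sat e)) xu)
      (sym (trans (⊕-at (class u) (class v) w) (cong₂ _xor_ (class-in e) (class-out ¬f))))
    by w (no ¬e) (yes f) = trans (trans (sym (sat f)) xv)
      (sym (trans (⊕-at (class u) (class v) w) (cong₂ _xor_ (class-out ¬e) (class-in f))))
    by w (no ¬e) (no ¬f) = trans (≢true⇒≡false (third w ¬e ¬f))
      (sym (trans (⊕-at (class u) (class v) w) (cong₂ _xor_ (class-out ¬e) (class-out ¬f))))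

  tokens : List (Fin n) → Configuration n
  tokens []       = 𝟘
  tokens (u ∷ us) = class u ⊕ tokens us

  saturated-tokens : ∀ us → Saturated (tokens us)
  saturated-tokens [] {u} {v} _ = trans (𝟘-at u) (sym (𝟘-at v))
  saturated-tokens (u ∷ us)   = saturated-⊕ (class u) (tokens us) (saturated-class u) (saturated-tokens us)

  -- Since the later classes are distinct as well, vanishing of their sum at `u` means that the
  -- class of `u` does not occur among them.
  Distinct : List (Fin n) → Set
  Distinct []       = ⊤
  Distinct (u ∷ us) = lookup (tokens us) u ≡ false × Distinct us

  remove : ∀ us v → lookup (tokens us) v ≡ true →
           ∃[ us′ ] tokens us′ ≡ class v ⊕ tokens us × suc (length us′) ≡ length us × (Distinct us → Distinct us′)
  remove [] v on = contradiction (trans (sym on) (𝟘-at v)) true≢false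
  remove (u ∷ us) v on with u ≈? v
  ... | yes e = us , sym (trans (cong (λ c → c ⊕ class u ⊕ tokens us) (sym (class-cong e))) (⊕-cancel (class u) (tokens us)))
                   , refl , proj₂
  ... | no ¬e with remove us v on′
    where
    on′ : lookup (tokens us) v ≡ true
    on′ = trans (sym (trans (⊕-at (class u) (tokens us) v) (cong (_xor lookup (tokens us) v) (class-out ¬e)))) on
  ...   | us′ , eq , len , dist =
    u ∷ us′ , trans (cong (class u ⊕_) eq) (⊕-swap (class u) (class v) (tokens us)) , cong suc len ,
    λ (off , d) → trans (cong (λ z → lookup z u) eq)
      (trans (⊕-at (class v) (tokens us) u) (cong₂ _xor_ (class-out λ f → ¬e (≈-sym f)) off)) , dist d

  tokenise : ∀ {x} → Saturated x → ∃[ us ] Distinct us × x ≡ tokens us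
  tokenise {x} sat with cover (List.allFin n)
    where
    cover : ∀ vs → ∃[ us ] Distinct us × (∀ {v} → lookup (tokens us) v ≡ true → lookup x v ≡ true) ×
                           (∀ {v} → v Listed.∈ vs → lookup x v ≡ true → lookup (tokens us) v ≡ true)
    cover [] = [] , _ , (λ {v} on → contradiction (trans (sym on) (𝟘-at v)) true≢false) , λ ()
    cover (v ∷ vs) with cover vs
    ... | us , d , sub , sup with lookup x v in xv | lookup (tokens us) v in tv
    ...   | false | _    = us , d , sub , λ
      { (here refl) on → contradiction (trans (sym on) xv) true≢false ; (there w∈) on → sup w∈ on }
    ...   | true  | true = us , d , sub , λ { (here refl) _ → tv ; (there w∈) on → sup w∈ on }
    ...   | true  | false = v ∷ us , (tv , d) , sub′ , sup′
      where
      sub′ : ∀ {w} → lookup (tokens (v ∷ us)) w ≡ true → lookup x w ≡ true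
      sub′ {w} on with v ≈? w
      ... | yes e = trans (sym (sat e)) xv
      ... | no ¬e = sub (trans (sym (trans (⊕-at (class v) (tokens us) w)
                                      (cong (_xor lookup (tokens us) w) (class-out ¬e)))) on)
      sup′ : ∀ {w} → w Listed.∈ v ∷ vs → lookup x w ≡ true → lookup (tokens (v ∷ us)) w ≡ true
      sup′ {w} w∈ on with v ≈? w
      ... | yes e = trans (⊕-at (class v) (tokens us) w)
                      (cong₂ _xor_ (class-in e) (trans (sym (saturated-tokens us e)) tv))
      sup′ {w} (here refl) on | no ¬e = contradiction ≈-refl ¬e
      sup′ {w} (there w∈)  on | no ¬e =
        trans (⊕-at (class v) (tokens us) w) (cong₂ _xor_ (class-out ¬e) (sup w∈ on))
  ... | us , d , sub , sup = us , d , ext by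
    where
    by : ∀ v → lookup x v ≡ lookup (tokens us) v
    by v with lookup x v in xv | lookup (tokens us) v in tv
    ... | true  | true  = refl
    ... | false | false = refl
    ... | true  | false = trans (sym (sup (Listed.∈-allFin v) xv)) tv
    ... | false | true  = trans (sym xv) (sub tv)

  parity : List (Fin n) → Bool
  parity []       = false
  parity (u ∷ us) = not (parity us)

  parity-++ : ∀ us vs → parity (us List.++ vs) ≡ parity us xor parity vs
  parity-++ []       vs = refl
  parity-++ (u ∷ us) vs = trans (cong not (parity-++ us vs)) (𝔹.not-distribˡ-xor (parity us) (parity vs))

  tokens-++ : ∀ us vs → tokens (us List.++ vs) ≡ tokens us ⊕ tokens vs
  tokens-++ []       vs = sym (⊕-identityˡ (tokens vs))
  tokens-++ (u ∷ us) vs = trans (cong (class u ⊕_) (tokens-++ us vs)) (sym (⊕-assoc (class u) (tokens us) (tokens vs)))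

  parity-length : ∀ us vs → length us ≡ length vs → parity us ≡ parity vs
  parity-length []       []       _  = refl
  parity-length (u ∷ us) (v ∷ vs) eq = cong not (parity-length us vs (ℕ.suc-injective eq))

  -- The head of a list with sum 𝟘 must have a second occurrence up to twins, and removing both
  -- keeps the sum. Hence the parity of the number of tokens depends on the configuration only.
  parity-𝟘 : ∀ us → tokens us ≡ 𝟘 → parity us ≡ false
  parity-𝟘 us = go (length us) us ℕ.≤-refl
    where
    go : ∀ k us → length us ≤ k → tokens us ≡ 𝟘 → parity us ≡ false
    go k [] _ _ = refl
    go (suc k) (u ∷ us) (s≤s le) eq with remove us u (trans (cong (λ z → lookup z u) (sym (⊕≡𝟘⇒≡ eq))) (class-in ≈-refl))
    ... | us′ , eq′ , len , _ =
      cong not (trans (parity-length us (u ∷ us′) (sym len)) (cong not (go k us′ shorter (trans eq′ eq))))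
      where
      shorter : length us′ ≤ k
      shorter = ℕ.≤-trans (ℕ.n≤1+n _) (ℕ.≤-trans (ℕ.≤-reflexive len) le)

-- Token dynamics on the graph of twin classes

module Graphlike {H : Hypergraph n} (connected : Connected H)
         (nonempty : ∀ {l} → l is-hyperedge-of H → ∃[ v ] lookup l v ≡ true)
         (halved : ∀ {l} → l is-hyperedge-of H → Twins.Halved connected nonempty l) where

  open Twins connected nonempty

  edge-small : ∀ {l} → l is-hyperedge-of H → Small l
  edge-small {l} l∈ = small {l} (λ e → agree e l∈) (halved l∈)

  Loop : Fin n → Set
  Loop c = class c is-hyperedge-of H

  Looped : Set
  Looped = ∃[ c ] Loop c

  looped? : Dec Looped
  looped? = Fin.any? λ c → Any.any? (class c ≟ᶜ_) H

  Link : Fin n → Fin n → Set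
  Link u v = ¬ u ≈ v × (class u ⊕ class v) is-hyperedge-of H

  -- Two vertices of a hyperedge that are not twins already account for both of its classes.
  adjacent : ∀ {u v} → Adjacent H u v → u ≈ v ⊎ Link u v
  adjacent {u} {v} (l , l∈ , u∈l , v∈l) with u ≈? v
  ... | yes e = inj₁ e
  ... | no u≉v = inj₂ (u≉v , subst (Listed._∈ H) (by (edge-small l∈) (Vec.[]=⇒lookup u∈l) (Vec.[]=⇒lookup v∈l)) l∈)
    where
    by : ∀ {z} → Small z → lookup z u ≡ true → lookup z v ≡ true → z ≡ class u ⊕ class v
    by none zu _ = contradiction (trans (sym zu) (𝟘-at u)) true≢false
    by (one a) zu zv = contradiction (≈-trans (≈-sym (in-class zu)) (in-class zv)) u≉v
    by (two a b _) zu zv with a ≈? u | a ≈? v | b ≈? u | b ≈? v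
    ... | yes e | yes f | _ | _ = contradiction (≈-trans (≈-sym e) f) u≉v
    ... | _ | _ | yes e | yes f = contradiction (≈-trans (≈-sym e) f) u≉v
    ... | yes e | no _ | no _ | yes f = cong₂ _⊕_ (class-cong e) (class-cong f)
    ... | no _ | yes f | yes e | no _ = trans (⊕-comm (class a) (class b)) (cong₂ _⊕_ (class-cong e) (class-cong f))
    ... | no ¬e | _ | no ¬f | _ =
      contradiction (trans (sym zu) (trans (⊕-at (class a) (class b) u) (cong₂ _xor_ (class-out ¬e) (class-out ¬f)))) true≢false
    ... | _ | no ¬e | _ | no ¬f =
      contradiction (trans (sym zv) (trans (⊕-at (class a) (class b) v) (cong₂ _xor_ (class-out ¬e) (class-out ¬f)))) true≢false

  infixr 5 _≡▻_ _▻≡_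
  _≡▻_ : ∀ {x y z} → x ≡ y → Reachable H y z → Reachable H x z
  refl ≡▻ p = p

  _▻≡_ : ∀ {x y z} → Reachable H x y → y ≡ z → Reachable H x z
  p ▻≡ refl = p

  hop : ∀ {u v} R → Link u v → lookup R u ≡ false → Reachable H (class u ⊕ R) (class v ⊕ R)
  hop {u} {v} R (u≉v , l∈) Ru =
    (move {v = u} (class u ⊕ R) l∈ (trans (⊕-at (class u) (class v) u) (cong₂ _xor_ (class-in ≈-refl) (class-out λ e → u≉v (≈-sym e))))
       (trans (⊕-at (class u) R u) (cong₂ _xor_ (class-in ≈-refl) Ru)) ◅ ε)
    ▻≡ trans (cong (_⊕ class u ⊕ R) (⊕-comm (class u) (class v)))
         (trans (⊕-assoc (class v) (class u) (class u ⊕ R)) (cong (class v ⊕_) (⊕-cancel (class u) R)))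

  walk : ∀ {u w} → Star (Adjacent H) u w → Reachable H (class u) (class w)
  walk ε = ε
  walk {u} (a ◅ p) with adjacent a
  ... | inj₁ e = class-cong e ≡▻ walk p
  ... | inj₂ k = ((sym (⊕-identityʳ _) ≡▻ hop 𝟘 k (𝟘-at u)) ▻≡ ⊕-identityʳ _) ◅◅ walk p

  -- The moving token may have to take over the role of the resting one.
  walk₂ : ∀ {u t c} → Star (Adjacent H) u t → ¬ c ≈ u → ¬ c ≈ t →
          Reachable H (class u ⊕ class c) (class t ⊕ class c)
  walk₂ ε _ _ = ε
  walk₂ {u} {t} {c} (_◅_ {j = v} a p) c≉u c≉t with adjacent a
  ... | inj₁ e = cong (_⊕ class c) (class-cong e) ≡▻ walk₂ p (λ f → c≉u (≈-trans f (≈-sym e))) c≉t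
  ... | inj₂ k with c ≈? v
  ...   | no c≉v = hop (class c) k (class-out c≉u) ◅◅ walk₂ p c≉v c≉t
  ...   | yes c≈v with u ≈? t
  ...     | yes e = cong (_⊕ class c) (class-cong e) ≡▻ ε
  ...     | no u≉t =
    trans (⊕-comm (class u) (class c)) (cong (_⊕ class u) (class-cong c≈v)) ≡▻
    walk₂ p (λ e → c≉u (≈-trans c≈v (≈-sym e))) u≉t ◅◅
    (⊕-comm (class t) (class u) ≡▻ hop (class t) k (class-out λ e → u≉t (≈-sym e))) ▻≡
    trans (⊕-comm (class v) (class t)) (cong (class t ⊕_) (sym (class-cong c≈v)))

  -- The token at `u` walks towards `t` and cancels with the first token that it meets, the one at
  -- `t` at the latest. Counting the walker, two tokens disappear.
  annihilate : ∀ {u t} rest → Star (Adjacent H) u t → Distinct rest →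
               lookup (tokens rest) u ≡ false → lookup (tokens rest) t ≡ true →
               ∃[ us ] Reachable H (class u ⊕ tokens rest) (tokens us) × Distinct us × suc (length us) ≡ length rest
  annihilate rest ε d off on = contradiction (trans (sym on) off) true≢false
  annihilate {u} rest (_◅_ {j = v} a p) d off on with adjacent a
  ... | inj₁ e =
    let us , r , d′ , len = annihilate rest p d (trans (sym (saturated-tokens rest e)) off) on in
    us , (cong (_⊕ tokens rest) (class-cong e) ≡▻ r) , d′ , len
  ... | inj₂ k with lookup (tokens rest) v in tv
  ...   | false =
    let us , r , d′ , len = annihilate rest p d tv on in us , hop (tokens rest) k off ◅◅ r , d′ , len
  ...   | true =
    let us , eq , len , dist = remove rest v tv in
    us , hop (tokens rest) k off ▻≡ sym eq , dist d , len

  data Few : Configuration n → Set where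
    one : ∀ u → Few (class u)
    two : ∀ u v → ¬ u ≈ v → Few (class u ⊕ class v)

  reduce-tokens : ∀ k us → length us ≤ k → Distinct us → tokens us ≢ 𝟘 → ∃[ y ] Few y × Reachable H (tokens us) y
  reduce-tokens k [] _ _ ≢𝟘 = contradiction refl ≢𝟘
  reduce-tokens k (u ∷ []) _ _ _ = class u , one u , ⊕-identityʳ (class u) ≡▻ ε
  reduce-tokens k (u ∷ v ∷ []) _ (off , _) _ =
    class u ⊕ class v , two u v distinct , cong (class u ⊕_) (⊕-identityʳ (class v)) ≡▻ ε
    where
    distinct : ¬ u ≈ v
    distinct e = true≢false (trans (sym (class-in (≈-sym e))) (trans (cong (λ z → lookup z u) (sym (⊕-identityʳ (class v)))) off))
  reduce-tokens (suc k) (u ∷ rest@(v ∷ w ∷ us)) (s≤s le) (off , d) _ =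
    let us′ , r , d′ , len = annihilate rest (connected u v) d off on
        y , few , r′ = reduce-tokens k us′ (ℕ.≤-trans (ℕ.n≤1+n _) (ℕ.≤-trans (ℕ.≤-reflexive len) le)) d′
                         (nonzero us′ (ℕ.suc-injective len) d′)
    in y , few , r ◅◅ r′
    where
    on : lookup (tokens rest) v ≡ true
    on = trans (⊕-at (class v) (tokens (w ∷ us)) v) (cong₂ _xor_ (class-in ≈-refl) (proj₁ d))
    -- Out of three or more tokens at least one survives a cancellation, so the process does not die
    -- at 𝟘.
    nonzero : ∀ us′ {m} → length us′ ≡ suc m → Distinct us′ → tokens us′ ≢ 𝟘
    nonzero (a ∷ as) _ (off , _) =
      ball⇒≢𝟘 {v = a} (trans (⊕-at (class a) (tokens as) a) (cong₂ _xor_ (class-in ≈-refl) off))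

  use-loop : ∀ {c} R → Loop c → lookup R c ≡ false → Reachable H (class c ⊕ R) R
  use-loop {c} R l∈ Rc =
    (move {v = c} (class c ⊕ R) l∈ (class-in ≈-refl) (trans (⊕-at (class c) R c) (cong₂ _xor_ (class-in ≈-refl) Rc)) ◅ ε)
    ▻≡ ⊕-cancel (class c) R

  drop-one : ∀ {u v c} → ¬ u ≈ v → Loop c → ∃[ w ] Reachable H (class u ⊕ class v) (class w)
  drop-one {u} {v} {c} u≉v l∈ with v ≈? c
  ... | yes e = u , (trans (⊕-comm (class u) (class v)) (cong (_⊕ class u) (class-cong e)) ≡▻
                     use-loop (class u) l∈ (class-out λ f → u≉v (≈-trans f (≈-sym e))))
  ... | no ¬e = v , walk₂ (connected u c) (λ f → u≉v (≈-sym f)) ¬e ◅◅ use-loop (class v) l∈ (class-out ¬e)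

  drop-last : ∀ {u c} → Loop c → Reachable H (class u) 𝟘
  drop-last {u} {c} l∈ = walk (connected u c) ◅◅ (sym (⊕-identityʳ (class c)) ≡▻ use-loop 𝟘 l∈ (𝟘-at c))

  pair : ∀ {u v w t} → ¬ u ≈ v → ¬ w ≈ t → Reachable H (class u ⊕ class v) (class w ⊕ class t)
  pair {u} {v} {w} {t} u≉v w≉t with v ≈? w
  ... | no v≉w =
    walk₂ (connected u w) (λ e → u≉v (≈-sym e)) v≉w ◅◅
    (⊕-comm (class w) (class v) ≡▻ walk₂ (connected v t) (λ e → v≉w (≈-sym e)) w≉t) ▻≡ ⊕-comm (class t) (class w)
  -- The token at `v` already stands on the class of `w`, so the other one has to go to `t`.
  ... | yes e =
    walk₂ (connected u t) (λ f → u≉v (≈-sym f)) (λ f → w≉t (≈-trans (≈-sym e) f)) ▻≡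
    trans (⊕-comm (class t) (class v)) (cong (_⊕ class t) (class-cong e))

  -- Without loops every hyperedge is a sum of exactly two classes.
  span-parity : ¬ Looped → ∀ {z} → Span H z → ∃[ ws ] tokens ws ≡ z × parity ws ≡ false
  span-parity ¬loop zero = [] , refl , refl
  span-parity ¬loop (add {l} {z} l∈ s) with span-parity ¬loop s | edge-small l∈ | l∈ | nonempty l∈
  ... | ws , eq , par | none | _ | v , lv = contradiction (trans (sym lv) (𝟘-at v)) true≢false
  ... | ws , eq , par | one u | l∈′ | _ = contradiction (u , l∈′) ¬loop
  ... | ws , eq , par | two u v _ | _ | _ =
    u ∷ v ∷ ws , trans (cong (λ y → class u ⊕ class v ⊕ y) eq) (sym (⊕-assoc (class u) (class v) z)) ,
    trans (𝔹.not-involutive (parity ws)) par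

  span-even : ¬ Looped → ∀ us → Span H (tokens us) → parity us ≡ false
  span-even ¬loop us s with span-parity ¬loop s
  ... | ws , eq , par = begin
    parity us                 ≡⟨ 𝔹.xor-identityʳ (parity us) ⟨
    parity us xor false       ≡⟨ cong (parity us xor_) par ⟨
    parity us xor parity ws   ≡⟨ parity-++ us ws ⟨
    parity (us List.++ ws)    ≡⟨ parity-𝟘 (us List.++ ws) (trans (tokens-++ us ws) (trans (cong (tokens us ⊕_) eq) (⊕-self (tokens us)))) ⟩
    false                     ∎
    where open ≡-Reasoning

  -- The states that will turn out to be recurrent in their coset. If there is a loop, a pair can be
  -- cut down to one token, and the number of tokens never grows again.
  data Target : Configuration n → Set where
    none : Target 𝟘
    one  : ∀ u → Target (class u)
    two  : ∀ u v → ¬ u ≈ v → ¬ Looped → Target (class u ⊕ class v)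

  odd-span : ¬ Looped → ∀ us {z} → tokens us ≡ z → parity us ≡ true → ¬ Span H z
  odd-span ¬loop us refl odd s = true≢false (trans (sym odd) (span-even ¬loop us s))

  few-to-target : ∀ {x y} → Few x → Target y → Span H (x ⊕ y) → Reachable H x y
  few-to-target (one u) none s with looped?
  ... | yes (c , l∈) = drop-last l∈
  ... | no ¬loop = ⊥-elim (odd-span ¬loop (u ∷ []) refl refl s)
  few-to-target (one u) (one v) s = walk (connected u v)
  few-to-target (one u) (two v w _ ¬loop) s =
    ⊥-elim (odd-span ¬loop (u ∷ v ∷ w ∷ []) (cong (λ z → class u ⊕ class v ⊕ z) (⊕-identityʳ (class w))) refl s)
  few-to-target (two u v u≉v) none s =
    let us , r , _ , len = annihilate (v ∷ []) (connected u v) (𝟘-at v , tt)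
                             (trans (cong (λ z → lookup z u) (⊕-identityʳ (class v))) (class-out λ e → u≉v (≈-sym e)))
                             (trans (cong (λ z → lookup z v) (⊕-identityʳ (class v))) (class-in ≈-refl))
    in (cong (class u ⊕_) (sym (⊕-identityʳ (class v))) ≡▻ r) ▻≡ empty us (ℕ.suc-injective len)
    where
    empty : ∀ us → length us ≡ 0 → tokens us ≡ 𝟘
    empty [] _ = refl
  few-to-target (two u v u≉v) (one w) s with looped?
  ... | yes (c , l∈) = let a , r = drop-one u≉v l∈ in r ◅◅ walk (connected a w)
  ... | no ¬loop = ⊥-elim (odd-span ¬loop (u ∷ v ∷ w ∷ [])
                     (trans (cong (λ z → class u ⊕ class v ⊕ z) (⊕-identityʳ (class w))) (sym (⊕-assoc (class u) (class v) (class w)))) refl s)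
  few-to-target (two u v u≉v) (two w t w≉t _) s = pair u≉v w≉t

  to-few : ∀ {x} → Saturated x → x ≢ 𝟘 → ∃[ y ] Few y × Reachable H x y
  to-few {x} sat x≢𝟘 with tokenise {x} sat
  ... | us , d , refl = reduce-tokens (length us) us ℕ.≤-refl d x≢𝟘

  reach-target : ∀ {x y} → Saturated x → x ≢ 𝟘 → Target y → Span H (x ⊕ y) → Reachable H x y
  reach-target {x} {y} sat x≢𝟘 target s =
    let z , few , r = to-few {x} sat x≢𝟘
        zxxy : (z ⊕ x) ⊕ (x ⊕ y) ≡ z ⊕ y
        zxxy = trans (⊕-assoc z x (x ⊕ y)) (cong (z ⊕_) (⊕-cancel x y))
    in r ◅◅ few-to-target few target
         (subst (Span H) zxxy (span-⊕ (subst (Span H) (⊕-comm x z) (reach-span r)) s))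

  -- Twins may occur repeatedly in `us`. A move then just replaces or deletes an entry, whether or
  -- not tokens meet.
  Bounded : ℕ → Configuration n → Set
  Bounded k x = ∃[ us ] length us ≤ k × tokens us ≡ x

  bounded-reach : ∀ {k x y} → Bounded k x → Reachable H x y → Bounded k y
  bounded-reach b ε = b
  bounded-reach {k} (us , le , refl) ((l , l∈ , (t , t∈l , on) , refl) ◅ p) =
    bounded-reach (fire (edge-small l∈) (Vec.[]=⇒lookup t∈l)) p
    where
    fire : ∀ {l} → Small l → lookup l t ≡ true → Bounded k (l ⊕ tokens us)
    fire none lt = contradiction (trans (sym lt) (𝟘-at t)) true≢false
    fire (one u) lt =
      let us′ , eq , len , _ = remove us u (trans (saturated-tokens us (in-class lt)) on) in
      us′ , ℕ.≤-trans (ℕ.≤-trans (ℕ.n≤1+n _) (ℕ.≤-reflexive len)) le , eq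
    fire (two u v u≉v) lt with u ≈? t
    ... | yes e =
      let us′ , eq , len , _ = remove us u (trans (saturated-tokens us e) on) in
      v ∷ us′ , ℕ.≤-trans (ℕ.≤-reflexive len) le ,
      trans (cong (class v ⊕_) eq) (trans (⊕-swap (class v) (class u) (tokens us)) (sym (⊕-assoc (class u) (class v) (tokens us))))
    ... | no ¬e =
      let v≈t = in-class (trans (sym (trans (⊕-at (class u) (class v) t) (cong (_xor lookup (class v) t) (class-out ¬e)))) lt)
          us′ , eq , len , _ = remove us v (trans (saturated-tokens us v≈t) on)
      in u ∷ us′ , ℕ.≤-trans (ℕ.≤-reflexive len) le ,
         trans (cong (class u ⊕_) eq) (sym (⊕-assoc (class u) (class v) (tokens us)))

  one-target : ∀ {y} → Bounded 1 y → Target y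
  one-target ([] , _ , refl) = none
  one-target (u ∷ [] , _ , refl) = subst Target (sym (⊕-identityʳ (class u))) (one u)
  one-target (_ ∷ _ ∷ _ , s≤s () , _)

  two-target : ¬ Looped → ∀ {y} → Bounded 2 y → Target y
  two-target _ ([] , _ , refl) = none
  two-target _ (u ∷ [] , _ , refl) = subst Target (sym (⊕-identityʳ (class u))) (one u)
  two-target ¬loop (u ∷ v ∷ [] , _ , refl) with u ≈? v
  ... | yes e = subst Target (sym (trans (cong₂ _⊕_ (class-cong e) (⊕-identityʳ (class v))) (⊕-self (class v)))) none
  ... | no ¬e = subst Target (cong (class u ⊕_) (sym (⊕-identityʳ (class v)))) (two u v ¬e ¬loop)
  two-target _ (_ ∷ _ ∷ _ ∷ _ , s≤s (s≤s ()) , _)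

  -- A trap: everything reachable from `z` is a `Target`. A recurrent state has to be reachable from
  -- `z` as well, which shows that the criterion is necessary.
  fewest : ∀ {x} → Saturated x → x ≢ 𝟘 →
           ∃[ z ] z ≢ 𝟘 × Target z × Reachable H x z × (∀ {y} → Reachable H z y → Target y)
  fewest {x} sat x≢𝟘 =
    let z , few , r = to-few {x} sat x≢𝟘 in by few r looped?
    where
    class≢𝟘 : ∀ u → class u ≢ 𝟘
    class≢𝟘 u = ball⇒≢𝟘 {v = u} (class-in ≈-refl)
    stays-one : ∀ u {y} → Reachable H (class u) y → Target y
    stays-one u q = one-target (bounded-reach (u ∷ [] , s≤s z≤n , ⊕-identityʳ (class u)) q)
    by : ∀ {z} → Few z → Reachable H x z → Dec Looped →
         ∃[ z ] z ≢ 𝟘 × Target z × Reachable H x z × (∀ {y} → Reachable H z y → Target y)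
    by (one u) r _ = class u , class≢𝟘 u , one u , r , stays-one u
    by (two u v u≉v) r (no ¬loop) =
      class u ⊕ class v ,
      ball⇒≢𝟘 {v = u} (trans (⊕-at (class u) (class v) u) (cong₂ _xor_ (class-in ≈-refl) (class-out λ e → u≉v (≈-sym e)))) ,
      two u v u≉v ¬loop , r ,
      λ q → two-target ¬loop (bounded-reach (u ∷ v ∷ [] , s≤s (s≤s z≤n) , cong (class u ⊕_) (⊕-identityʳ (class v))) q)
    by (two u v u≉v) r (yes (c , l∈)) =
      let w , r′ = drop-one u≉v l∈ in class w , class≢𝟘 w , one w , r ◅◅ r′ , stays-one w

  -- If all vertices form one class, a nonempty hyperedge is that class; if they form two and there
  -- is no loop, each hyperedge consists of both. This keeps the trap away from 𝟙 unless `Full`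
  -- holds.
  target-full : ∀ {x} → Target x → x ≡ 𝟙 → ∀ {l} → l is-hyperedge-of H → l ≡ 𝟙
  target-full target eq l∈ = by target eq (edge-small l∈) l∈
    where
    by : ∀ {x l} → Target x → x ≡ 𝟙 → Small l → l is-hyperedge-of H → l ≡ 𝟙
    by target eq none l∈ = let v , lv = nonempty l∈ in contradiction (trans (sym lv) (𝟘-at v)) true≢false
    by none eq _ l∈ =
      let v , _ = nonempty l∈ in
      contradiction (trans (sym (𝟙-at v)) (trans (cong (λ z → lookup z v) (sym eq)) (𝟘-at v))) true≢false
    by (one u) eq (one v) l∈ = trans (class-cong (≈-sym (in-class (trans (cong (λ z → lookup z v) eq) (𝟙-at v))))) eq
    by (one u) eq (two v w v≉w) l∈ =
      contradiction (≈-trans (≈-sym (in-class (trans (cong (λ z → lookup z v) eq) (𝟙-at v))))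
                             (in-class (trans (cong (λ z → lookup z w) eq) (𝟙-at w)))) v≉w
    by (two u v _ ¬loop) eq (one w) l∈ = contradiction (w , l∈) ¬loop
    by (two u v _ _) eq (two a b a≉b) _ with u ≈? a | v ≈? a | u ≈? b | v ≈? b
    ... | no ¬e | no ¬f | _ | _ = contradiction (trans (sym (𝟙-at a)) (trans (cong (λ z → lookup z a) (sym eq))
            (trans (⊕-at (class u) (class v) a) (cong₂ _xor_ (class-out ¬e) (class-out ¬f))))) true≢false
    ... | _ | _ | no ¬e | no ¬f = contradiction (trans (sym (𝟙-at b)) (trans (cong (λ z → lookup z b) (sym eq))
            (trans (⊕-at (class u) (class v) b) (cong₂ _xor_ (class-out ¬e) (class-out ¬f))))) true≢false
    ... | yes e | _ | yes f | _ = contradiction (≈-trans (≈-sym e) f) a≉b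
    ... | _ | yes e | _ | yes f = contradiction (≈-trans (≈-sym e) f) a≉b
    ... | yes e | _ | _ | yes f = trans (cong₂ _⊕_ (class-cong (≈-sym e)) (class-cong (≈-sym f))) eq
    ... | _ | yes e | yes f | _ = trans (⊕-comm (class a) (class b)) (trans (cong₂ _⊕_ (class-cong (≈-sym f)) (class-cong (≈-sym e))) eq)

-- The criterion for recurrence, its sufficiency and its necessity

module Criterion {H : Hypergraph n} (connected : Connected H)
         (nonempty : ∀ {l} → l is-hyperedge-of H → ∃[ v ] lookup l v ≡ true)
         {w₁ : Configuration n} (w₁≢𝟘 : w₁ ≢ 𝟘) (w₂ : Configuration n) where

  open Twins connected nonempty

  rows : List (Configuration n)
  rows = w₁ ∷ w₂ ∷ H

  Full : Set
  Full = w₁ ≡ 𝟙 × (∀ {l} → l is-hyperedge-of H → l ≡ 𝟙)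

  Split : Configuration n → Set
  Split l = ∃[ a ] a is-hyperedge-of H × (∀ {s} → s Listed.∈ rows → Uniform l a s)

  -- With `a = l` one of the two parts is empty, so this says that every row is constant on `l`. For
  -- a hyperedge it detects a loop.
  Mono : Configuration n → Set
  Mono l = ∀ {s} → s Listed.∈ rows → Uniform l l s

  Graph : Set
  Graph = ∀ {l} → l is-hyperedge-of H → Split l

  NoMono : Set
  NoMono = ∀ {l} → l is-hyperedge-of H → ¬ Mono l

  split⇒halved : ∀ {l} → Split l → Halved l
  split⇒halved (a , a∈ , uni) = a , a∈ , λ u v lu lv auv → twins λ s∈ → uni (there (there s∈)) u v lu lv auv

  module _ (graph : Graph) where
    open Graphlike connected nonempty (λ {l} l∈ → split⇒halved {l} (graph l∈)) public

    -- By connectedness a vertex with a distinct twin lies in some hyperedge `l`, hence so does the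
    -- twin, and both are in the same part of `l`.
    rows-saturated : ∀ {s} → s Listed.∈ rows → Saturated s
    rows-saturated s∈ {u} {v} e with u Fin.≟ v
    ... | yes refl = refl
    ... | no u≢v with connected u v
    ...   | ε = refl
    ...   | (l , l∈ , u∈l , _) ◅ _ =
      let a , a∈ , uni = graph l∈
          lu = Vec.[]=⇒lookup u∈l
      in uni s∈ u v lu (trans (sym (agree e l∈)) lu) (agree e a∈)

    -- `Mono y ⊎ NoMono` expresses by comparing rows that two tokens occur only in the absence of
    -- loops.
    split⇒target : ∀ {y} → y Listed.∈ rows → Split y → Mono y ⊎ NoMono → Target y
    split⇒target {y} y∈ split mono = by (small {y} (rows-saturated y∈) (split⇒halved {y} split)) mono
      where
      by : ∀ {y} → Small y → Mono y ⊎ NoMono → Target y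
      by none _ = none
      by (one u) _ = one u
      by (two u v u≉v) m = two u v u≉v (unlooped m)
        where
        unlooped : Mono (class u ⊕ class v) ⊎ NoMono → ¬ Looped
        unlooped (inj₁ mono) _ = u≉v (twins λ s∈ → mono (there (there s∈)) u v
          (trans (⊕-at (class u) (class v) u) (cong₂ _xor_ (class-in ≈-refl) (class-out λ e → u≉v (≈-sym e))))
          (trans (⊕-at (class u) (class v) v) (cong₂ _xor_ (class-out u≉v) (class-in ≈-refl)))
          (trans (⊕-at (class u) (class v) u) (trans (cong₂ _xor_ (class-in ≈-refl) (class-out λ e → u≉v (≈-sym e)))
            (sym (trans (⊕-at (class u) (class v) v) (cong₂ _xor_ (class-out u≉v) (class-in ≈-refl)))))))
        unlooped (inj₂ noMono) (c , l∈) =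
          noMono l∈ λ s∈ u v lu lv _ → rows-saturated s∈ (≈-trans (≈-sym (in-class lu)) (in-class lv))

    -- For at most one token any hyperedge splits `y`, and `a` is taken; for two tokens on `u` and
    -- `v` it is a hyperedge that tells these apart.
    target⇒split : ∀ {a y} → a is-hyperedge-of H → Target y → Split y × (Mono y ⊎ NoMono)
    target⇒split {a} a∈ none =
      (a , a∈ , λ _ u v yu → contradiction (trans (sym yu) (𝟘-at u)) true≢false) ,
      inj₁ λ _ u v yu → contradiction (trans (sym yu) (𝟘-at u)) true≢false
    target⇒split {a} a∈ (one c) =
      (a , a∈ , λ s∈ u v yu yv _ → rows-saturated s∈ (≈-trans (≈-sym (in-class yu)) (in-class yv))) ,
      inj₁ λ s∈ u v yu yv _ → rows-saturated s∈ (≈-trans (≈-sym (in-class yu)) (in-class yv))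
    target⇒split _ (two u v u≉v ¬loop) = separated (All.all? (λ s → lookup s u 𝔹.≟ lookup s v) H) , inj₂ noMono
      where
      split-by : ∀ {b} → b is-hyperedge-of H → lookup b u ≢ lookup b v →
                 ∀ x y → lookup (class u ⊕ class v) x ≡ true → lookup (class u ⊕ class v) y ≡ true →
                 lookup b x ≡ lookup b y → x ≈ y
      split-by b∈ buv x y yx yy bxy with u ≈? x | v ≈? x | u ≈? y | v ≈? y
      ... | yes e | _ | yes f | _ = ≈-trans (≈-sym e) f
      ... | _ | yes e | _ | yes f = ≈-trans (≈-sym e) f
      ... | yes e | _ | _ | yes f = contradiction (trans (agree e b∈) (trans bxy (sym (agree f b∈)))) buv
      ... | _ | yes e | yes f | _ = contradiction (trans (agree f b∈) (trans (sym bxy) (sym (agree e b∈)))) buv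
      ... | no ¬e | no ¬f | _ | _ = contradiction (trans (sym yx)
              (trans (⊕-at (class u) (class v) x) (cong₂ _xor_ (class-out ¬e) (class-out ¬f)))) true≢false
      ... | _ | _ | no ¬e | no ¬f = contradiction (trans (sym yy)
              (trans (⊕-at (class u) (class v) y) (cong₂ _xor_ (class-out ¬e) (class-out ¬f)))) true≢false
      separated : Dec (All.All (λ s → lookup s u ≡ lookup s v) H) → Split (class u ⊕ class v)
      separated (yes all) = contradiction (twins (All.lookup all)) u≉v
      separated (no ¬all) =
        let b , b∈ , buv = Listed.find (All.¬All⇒Any¬ (λ s → lookup s u 𝔹.≟ lookup s v) H ¬all) in
        b , b∈ , λ s∈ x y yx yy bxy → rows-saturated s∈ (split-by b∈ buv x y yx yy bxy)
      noMono : NoMono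
      noMono l∈ mono = by (edge-small l∈) l∈ mono
        where
        by : ∀ {l} → Small l → l is-hyperedge-of H → ¬ Mono l
        by none l∈ _ = let t , lt = nonempty l∈ in contradiction (trans (sym lt) (𝟘-at t)) true≢false
        by (one c) l∈ _ = ¬loop (c , l∈)
        by (two a b a≉b) _ mono = a≉b (twins λ s∈ → mono (there (there s∈)) a b at-a at-b (trans at-a (sym at-b)))
          where
          at-a = trans (⊕-at (class a) (class b) a) (cong₂ _xor_ (class-in ≈-refl) (class-out λ e → a≉b (≈-sym e)))
          at-b = trans (⊕-at (class a) (class b) b) (cong₂ _xor_ (class-out a≉b) (class-in ≈-refl))

  path-reach : ∀ {π} → InfinitePath H w₁ π → ∀ i → Reachable H w₁ (π i)
  path-reach (refl , moves) zero    = ε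
  path-reach p@(_ , moves)  (suc i) = path-reach p i ◅◅ (moves i ◅ ε)

  path-≢𝟘 : ∀ {π} → InfinitePath H w₁ π → ∀ i → π i ≢ 𝟘
  path-≢𝟘 (_ , moves) i with moves i
  ... | _ , _ , (v , _ , on) , _ = ball⇒≢𝟘 {v = v} on

  -- Any first move turns 𝟙 into 𝟘, where a path cannot continue.
  full⇒recurrent : Full → Recurrent H w₁ w₂
  full⇒recurrent (w₁≡𝟙 , all) π p@(start , moves) i with moves 0
  ... | l , l∈ , _ , eq =
    contradiction (trans eq (trans (cong₂ _⊕_ (all l∈) (trans start w₁≡𝟙)) (⊕-self 𝟙))) (path-≢𝟘 p 1)

  module _ {π} (p : InfinitePath H w₁ π) (i : ℕ) where
    private
      back : Span H (w₁ ⊕ π i)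
      back = reach-span (path-reach p i)

    span-from : Span H (w₁ ⊕ w₂) → Span H (w₂ ⊕ π i)
    span-from s = subst (Span H) (trans (⊕-assoc w₂ w₁ (w₁ ⊕ π i)) (cong (w₂ ⊕_) (⊕-cancel w₁ (π i))))
                    (span-⊕ (subst (Span H) (⊕-comm w₁ w₂) s) back)

    reach-mixing : Span H (w₁ ⊕ w₂) → ¬ Graph → w₂ ≢ 𝟙 → Reachable H (π i) w₂
    reach-mixing s ¬graph w₂≢𝟙 =
      mixing connected nonempty (path-≢𝟘 p i)
        (λ g → ¬graph λ h∈ → let a , a∈ , uni = g h∈ in a , a∈ , λ
          { (here refl)         → uni (inj₂ (refl , back))
          ; (there (here refl)) → uni (inj₂ (refl , span-from s))
          ; (there (there s∈))  → uni {w = w₁} (inj₁ s∈) })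
        w₂≢𝟙 (subst (Span H) (⊕-comm w₂ (π i)) (span-from s))

    reach-graph : Span H (w₁ ⊕ w₂) → (graph : Graph) → Split w₂ → Mono w₂ ⊎ NoMono → Reachable H (π i) w₂
    reach-graph s graph split mono =
      reach-target graph sat (path-≢𝟘 p i) (split⇒target graph (there (here refl)) split mono)
        (subst (Span H) (⊕-comm w₂ (π i)) (span-from s))
      where
      sat : Saturated (π i)
      sat = subst Saturated (⊕-cancel w₁ (π i))
              (saturated-⊕ w₁ (w₁ ⊕ π i) (rows-saturated graph (here refl)) (saturated-span back))

  crossing : ∀ {x u v} → Star (Adjacent H) u v → lookup x u ≡ true → lookup x v ≡ false →
    ∃[ f ] ∃[ a ] ∃[ b ] f is-hyperedge-of H × (lookup f a ≡ true × lookup f b ≡ true) ×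
                         lookup x a ≡ true × lookup x b ≡ false
  crossing ε xu xv = contradiction (trans (sym xu) xv) true≢false
  crossing {x} {u} (_◅_ {j = t} (f , f∈ , u∈f , t∈f) p) xu xv with lookup x t in xt
  ... | true  = crossing {x} p xt xv
  ... | false = f , u , t , f∈ , (Vec.[]=⇒lookup u∈f , Vec.[]=⇒lookup t∈f) , xu , xt

  -- Recurrence only constrains states that lie on infinite paths. Switching `f` for ever extends
  -- any path to an infinite one if `f` contains a ball and an empty vertex, because these two take
  -- turns.
  oscillate : Subset n → Configuration n → ℕ → Configuration n
  oscillate f x zero    = x
  oscillate f x (suc i) = oscillate f (f ⊕ x) i

  oscillate-moves : ∀ {f a b} x → f is-hyperedge-of H → lookup f a ≡ true → lookup f b ≡ true →
                    lookup x a ≡ true → lookup x b ≡ false → ∀ i → Move H (oscillate f x i) (oscillate f x (suc i))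
  oscillate-moves {a = a} x f∈ fa fb xa xb zero = move {v = a} x f∈ fa xa
  oscillate-moves {f} {a} {b} x f∈ fa fb xa xb (suc i) =
    oscillate-moves {f} {b} {a} (f ⊕ x) f∈ fb fa
      (trans (⊕-at f x b) (cong₂ _xor_ fb xb)) (trans (⊕-at f x a) (cong₂ _xor_ fa xa)) i

  prepend : ∀ {w x π} → Reachable H w x → InfinitePath H x π →
            ∃[ ρ ] InfinitePath H w ρ × ∃[ i ] ρ i ≡ x
  prepend {π = π} ε p = π , p , 0 , proj₁ p
  prepend {w} (m ◅ r) p with prepend r p
  ... | ρ , (refl , moves) , i , eq =
    (λ { zero → w ; (suc j) → ρ j }) , (refl , λ { zero → m ; (suc j) → moves j }) , suc i , eq

  -- A switch empties the vertex that makes it legal.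
  fullʳ : ∀ {x z} → Reachable H x z → z ≡ 𝟙 → x ≡ 𝟙
  fullʳ ε eq = eq
  fullʳ {x} ((l , _ , (v , v∈l , on) , refl) ◅ r) eq =
    contradiction (fullʳ r eq)
      (gap⇒≢𝟙 {v = v} (trans (⊕-at l x v) (cong₂ _xor_ (Vec.[]=⇒lookup v∈l) on)))

  crossed : ∀ {x} → x ≢ 𝟘 → x ≢ 𝟙 → ∃[ f ] ∃[ a ] ∃[ b ] f is-hyperedge-of H ×
            (lookup f a ≡ true × lookup f b ≡ true) × lookup x a ≡ true × lookup x b ≡ false
  crossed {x} x≢𝟘 x≢𝟙 with ≢𝟘⇒ball x≢𝟘 | ≢𝟙⇒gap x≢𝟙
  ... | u , xu | v , xv = crossing {x} (connected u v) xu xv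

  module _ (recurrent : Recurrent H w₁ w₂) (¬full : ¬ Full) where

    through : ∀ {x} → Reachable H w₁ x → x ≢ 𝟘 → x ≢ 𝟙 → Reachable H x w₂
    through {x} r x≢𝟘 x≢𝟙 =
      let f , a , b , f∈ , (fa , fb) , xa , xb = crossed x≢𝟘 x≢𝟙
          ρ , p , i , eq = prepend r (refl , oscillate-moves {a = a} {b} x f∈ fa fb xa xb)
      in subst (λ z → Reachable H z w₂) eq (recurrent ρ p i)

    -- At 𝟙 there is no empty vertex to oscillate with. If `w₁` is 𝟙 but some hyperedge is not, one
    -- move along that hyperedge helps.
    lively : ∃[ x ] Reachable H w₁ x × x ≢ 𝟘 × x ≢ 𝟙
    lively with w₁ ≟ᶜ 𝟙
    ... | no w₁≢𝟙 = w₁ , ε , w₁≢𝟘 , w₁≢𝟙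
    ... | yes refl with All.all? (_≟ᶜ 𝟙) H
    ...   | yes all = ⊥-elim (¬full (refl , λ l∈ → All.lookup all l∈))
    ...   | no ¬all with Listed.find (All.¬All⇒Any¬ (_≟ᶜ 𝟙) H ¬all)
    ...     | l , l∈ , l≢𝟙 with nonempty l∈
    ...       | v , lv =
      l ⊕ 𝟙 , move {v = v} 𝟙 l∈ lv (𝟙-at v) ◅ ε , (λ eq → l≢𝟙 (⊕≡𝟘⇒≡ eq)) ,
      gap⇒≢𝟙 {v = v} (trans (⊕-at l 𝟙 v) (cong₂ _xor_ lv (𝟙-at v)))

    recurrent⇒span : Span H (w₁ ⊕ w₂)
    recurrent⇒span = let x , r , x≢𝟘 , x≢𝟙 = lively in reach-span (r ◅◅ through r x≢𝟘 x≢𝟙)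

    recurrent⇒≢𝟙 : w₂ ≢ 𝟙
    recurrent⇒≢𝟙 eq = let x , r , x≢𝟘 , x≢𝟙 = lively in x≢𝟙 (fullʳ (through r x≢𝟘 x≢𝟙) eq)

    recurrent⇒split : Graph → Split w₂ × (Mono w₂ ⊎ NoMono)
    recurrent⇒split graph =
      let x , _ , x≢𝟘 , x≢𝟙 = lively
          f , _ , _ , f∈ , _ = crossed x≢𝟘 x≢𝟙
          z , z≢𝟘 , target , r , ends = fewest graph {w₁} (rows-saturated graph (here refl)) w₁≢𝟘
          z≢𝟙 = λ eq → ¬full (fullʳ r eq , λ l∈ → target-full graph target eq l∈)
      in target⇒split graph f∈ (ends (through r z≢𝟘 z≢𝟙))

-- Stack programs and their Turing machines

Γ = Maybe Symbol

data Code (k : ℕ) : Set where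
  nop         : Code k
  push        : Fin k → Symbol → Code k
  transcribe  : Fin k → Fin k → Code k
  pop         : Fin k → Code k
  _⨾_         : Code k → Code k → Code k
  branch      : Fin k → (Γ → Bool) → Code k → Code k → Code k
  while       : Fin k → (Γ → Bool) → Code k → Code k

infixr 5 _⨾_

Stacks : ℕ → Set
Stacks = Vec (List Symbol)

pop-list : List Symbol → List Symbol
pop-list []       = []
pop-list (_ ∷ xs) = xs

top : ∀ {k} → Stacks k → Fin k → Γ
top σ r = List.head (lookup σ r)

-- The index is the exact number of machine steps. A transition writes before it moves, so a push
-- first moves the head to the cell on the left and then writes there. For `transcribe` the second
-- of these steps reads `r`, whence `r ≢ s`.
data Run {k} : Code k → Stacks k → ℕ → Stacks k → Set where
  nop : ∀ {σ} → Run nop σ 1 σ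
  push : ∀ {σ} r a → Run (push r a) σ 2 (σ [ r ]≔ (a ∷ lookup σ r))
  transcribe : ∀ {σ} r s {a} → r ≢ s → top σ r ≡ just a →
               Run (transcribe r s) σ 2 (σ [ s ]≔ (a ∷ lookup σ s))
  pop : ∀ {σ} r → Run (pop r) σ 1 (σ [ r ]≔ pop-list (lookup σ r))
  _⨾_ : ∀ {p q σ τ υ m n} → Run p σ m τ → Run q τ n υ → Run (p ⨾ q) σ (m + n) υ
  branch-true : ∀ {σ τ t r f p q} → f (top σ r) ≡ true → Run p σ t τ → Run (branch r f p q) σ (suc t) τ
  branch-false : ∀ {σ τ t r f p q} → f (top σ r) ≡ false → Run q σ t τ → Run (branch r f p q) σ (suc t) τ
  while-stop : ∀ {σ r f p} → f (top σ r) ≡ false → Run (while r f p) σ 1 σ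
  while-step : ∀ {σ τ υ m n r f p} → f (top σ r) ≡ true → Run p σ m τ → Run (while r f p) τ n υ →
               Run (while r f p) σ (suc (m + n)) υ

-- Program points, from which the states of the machine are made. The two Booleans are the two steps
-- of a push; `inj₁ tt` is the test of a branch or loop.
Pos : ∀ {k} → Code k → Set
Pos nop              = ⊤
Pos (push _ _)       = Bool
Pos (transcribe _ _) = Bool
Pos (pop _)          = ⊤
Pos (p ⨾ q)          = Pos p ⊎ Pos q
Pos (branch _ _ p q) = ⊤ ⊎ (Pos p ⊎ Pos q)
Pos (while _ _ p)    = ⊤ ⊎ Pos p

entry : ∀ {k} (c : Code k) → Pos c
entry nop              = tt
entry (push _ _)       = false
entry (transcribe _ _) = false
entry (pop _)          = tt
entry (p ⨾ q)          = inj₁ (entry p)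
entry (branch _ _ p q) = inj₁ tt
entry (while _ _ p)    = inj₁ tt

⊤-finite : Finite ⊤
⊤-finite = 1 , ↔-sym Fin.1↔⊤

Bool-finite : Finite Bool
Bool-finite = 2 , ↔-sym Fin.2↔Bool

⊎-finite : ∀ {A B} → Finite A → Finite B → Finite (A ⊎ B)
⊎-finite (m , f) (n , g) = m + n , ↔-sym (Fin.+↔⊎ {m} {n}) ↔-∘ (f ⊎-↔ g)

Pos-finite : ∀ {k} (c : Code k) → Finite (Pos c)
Pos-finite nop              = ⊤-finite
Pos-finite (push _ _)       = Bool-finite
Pos-finite (transcribe _ _) = Bool-finite
Pos-finite (pop _)          = ⊤-finite
Pos-finite (p ⨾ q)          = ⊎-finite (Pos-finite p) (Pos-finite q)
Pos-finite (branch _ _ p q) = ⊎-finite ⊤-finite (⊎-finite (Pos-finite p) (Pos-finite q))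
Pos-finite (while _ _ p)    = ⊎-finite ⊤-finite (Pos-finite p)

Γ-finite : Finite Γ
Γ-finite = 4 , mk↔ₛ′ to from to-from from-to
  where
  to : Γ → Fin 4
  to nothing            = 0F
  to (just sep)         = 1F
  to (just (bit false)) = 2F
  to (just (bit true))  = 3F
  from : Fin 4 → Γ
  from 0F = nothing
  from 1F = just sep
  from 2F = just (bit false)
  from 3F = just (bit true)
  to-from : ∀ i → to (from i) ≡ i
  to-from 0F = refl
  to-from 1F = refl
  to-from 2F = refl
  to-from 3F = refl
  from-to : ∀ a → from (to a) ≡ a
  from-to nothing            = refl
  from-to (just sep)         = refl
  from-to (just (bit false)) = refl
  from-to (just (bit true))  = refl

Actions : ℕ → Set
Actions = Vec (Γ × Direction)

idle : ∀ {k} → Vec Γ k → Actions k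
idle = Vec.map (_, stay)

-- `ι` embeds the points of `c` into the states of the surrounding program and `exit` is the state
-- that follows `c`; so subprograms keep their transitions in any context.
transition : ∀ {k} {S : Set} (c : Code k) → (Pos c → S) → S → Pos c → Vec Γ k → S × Actions k
transition nop              ι exit _     hs = exit , idle hs
transition (push r a)       ι exit false hs = ι true , idle hs [ r ]≔ (lookup hs r , left)
transition (push r a)       ι exit true  hs = exit , idle hs [ r ]≔ (just a , stay)
transition (transcribe r s) ι exit false hs = ι true , idle hs [ s ]≔ (lookup hs s , left)
transition (transcribe r s) ι exit true  hs = exit , idle hs [ s ]≔ (lookup hs r , stay)
transition (pop r)          ι exit _     hs = exit , idle hs [ r ]≔ (nothing , right)
transition (p ⨾ q)          ι exit (inj₁ i) hs = transition p (ι ∘ inj₁) (ι (inj₂ (entry q))) i hs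
transition (p ⨾ q)          ι exit (inj₂ i) hs = transition q (ι ∘ inj₂) exit i hs
transition (branch r f p q) ι exit (inj₁ _) hs =
  (if f (lookup hs r) then ι (inj₂ (inj₁ (entry p))) else ι (inj₂ (inj₂ (entry q)))) , idle hs
transition (branch r f p q) ι exit (inj₂ (inj₁ i)) hs = transition p (ι ∘ inj₂ ∘ inj₁) exit i hs
transition (branch r f p q) ι exit (inj₂ (inj₂ i)) hs = transition q (ι ∘ inj₂ ∘ inj₂) exit i hs
transition (while r f p)    ι exit (inj₁ _) hs =
  (if f (lookup hs r) then ι (inj₂ (entry p)) else exit) , idle hs
transition (while r f p)    ι exit (inj₂ i) hs = transition p (ι ∘ inj₂) (ι (inj₁ tt)) i hs

data Control {k} (c : Code k) : Set where
  at      : Pos c → Control c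
  finished : Control c
  halted  : Bool → Control c

Control-finite : ∀ {k} (c : Code k) → Finite (Control c)
Control-finite c = let n , f = ⊎-finite (Pos-finite c) (⊎-finite ⊤-finite Bool-finite) in n , f ↔-∘ mk↔ₛ′ to from to-from from-to
  where
  to : Control c → Pos c ⊎ (⊤ ⊎ Bool)
  to (at p)     = inj₁ p
  to finished   = inj₂ (inj₁ tt)
  to (halted b) = inj₂ (inj₂ b)
  from : Pos c ⊎ (⊤ ⊎ Bool) → Control c
  from (inj₁ p)         = at p
  from (inj₂ (inj₁ _))  = finished
  from (inj₂ (inj₂ b))  = halted b
  to-from : ∀ x → to (from x) ≡ x
  to-from (inj₁ p)        = refl
  to-from (inj₂ (inj₁ _)) = refl
  to-from (inj₂ (inj₂ b)) = refl
  from-to : ∀ x → from (to x) ≡ x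
  from-to (at p)     = refl
  from-to finished   = refl
  from-to (halted b) = refl

machine : ∀ {k} → Code (suc k) → Fin (suc k) → TuringMachine Symbol
machine {k} c out = record
  { Γ = Γ ; Γ-finite = Γ-finite ; blank = nothing ; input = just
  ; input-injective = λ { refl → refl } ; input-nonblank = λ _ ()
  ; State = Control c ; State-finite = Control-finite c ; start = at (entry c)
  ; verdict = λ { (halted b) → just b ; _ → nothing }
  ; extraTapes = k
  ; δ = λ { (at p)     hs → transition c at finished p hs
          ; finished   hs → halted (is-just (lookup hs out)) , idle hs
          ; (halted b) hs → halted b , idle hs } }

-- A tape holds a stack whose top is under the head; the cells to the left of
-- the head are irrelevant.

data _∼_ : List Γ → List Symbol → Set where
  []    : [] ∼ []
  blank : ∀ {g} → g ∼ [] → (nothing ∷ g) ∼ []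
  _∷_   : ∀ a {g xs} → g ∼ xs → (just a ∷ g) ∼ (a ∷ xs)

Holds : Tape Γ → List Symbol → Set
Holds t xs = (current t ∷ after t) ∼ xs

holds-top : ∀ t {xs} → Holds t xs → current t ≡ List.head xs
holds-top (tape _ _ _) (blank _) = refl
holds-top (tape _ _ _) (a ∷ _)   = refl

module _ {k} (c : Code (suc k)) (out : Fin (suc k)) where

  private
    M = machine c out
    Tapes = Vec (Tape Γ) (suc k)

  record Hold (ts : Tapes) (σ : Stacks (suc k)) : Set where
    constructor hold
    field get : ∀ i → Holds (lookup ts i) (lookup σ i)
  open Hold

  heads : Tapes → Vec Γ (suc k)
  heads = Vec.map current

  heads-top : ∀ {ts σ} → Hold ts σ → ∀ r → lookup (heads ts) r ≡ top σ r
  heads-top {ts} h r = trans (Vec.lookup-map r current ts) (holds-top (lookup ts r) (get h r))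

  acted : ∀ ts r x → lookup (zipWith (act M) (idle (heads ts) [ r ]≔ x) ts) r ≡ act M x (lookup ts r)
  acted ts r x = trans (Vec.lookup-zipWith (act M) r (idle (heads ts) [ r ]≔ x) ts)
                   (cong (λ y → act M y (lookup ts r)) (Vec.lookup∘update r (idle (heads ts)) x))

  idle-acted : ∀ ts i → lookup (zipWith (act M) (idle (heads ts)) ts) i ≡ lookup ts i
  idle-acted ts i = trans (Vec.lookup-zipWith (act M) i (idle (heads ts)) ts)
    (cong (λ y → act M y (lookup ts i)) {y = current (lookup ts i) , stay}
      (trans (Vec.lookup-map i (_, stay) (heads ts)) (cong (_, stay) (Vec.lookup-map i current ts))))

  unacted : ∀ ts r x {i} → i ≢ r → lookup (zipWith (act M) (idle (heads ts) [ r ]≔ x) ts) i ≡ lookup ts i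
  unacted ts r x {i} i≢r = trans (Vec.lookup-zipWith (act M) i (idle (heads ts) [ r ]≔ x) ts)
    (trans (cong (λ y → act M y (lookup ts i)) (Vec.lookup∘update′ i≢r (idle (heads ts)) x))
      (trans (sym (Vec.lookup-zipWith (act M) i (idle (heads ts)) ts)) (idle-acted ts i)))

  hold-idle : ∀ {ts σ} → Hold ts σ → Hold (zipWith (act M) (idle (heads ts)) ts) σ
  hold-idle {ts} h = hold λ i → subst (λ t → Holds t _) (sym (idle-acted ts i)) (get h i)

  hold-update : ∀ {ts σ} r x xs → Hold ts σ → Holds (act M x (lookup ts r)) xs →
                Hold (zipWith (act M) (idle (heads ts) [ r ]≔ x) ts) (σ [ r ]≔ xs)
  hold-update {ts} {σ} r x xs h new = hold by
    where
    by : ∀ i → Holds (lookup (zipWith (act M) (idle (heads ts) [ r ]≔ x) ts) i) (lookup (σ [ r ]≔ xs) i)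
    by i with i Fin.≟ r
    ... | yes refl = subst₂ Holds (sym (acted ts r x)) (sym (Vec.lookup∘update r σ xs)) new
    ... | no i≢r   = subst₂ Holds (sym (unacted ts r x i≢r)) (sym (Vec.lookup∘update′ i≢r σ xs)) (get h i)

  pop-holds : ∀ t {xs} → Holds t xs → Holds (act M (nothing , right) t) (pop-list xs)
  pop-holds (tape _ _ [])      (blank [])       = blank []
  pop-holds (tape _ _ (_ ∷ _)) (blank h)        = h
  pop-holds (tape _ _ [])      (a ∷ [])         = blank []
  pop-holds (tape _ _ (_ ∷ _)) (a ∷ h)          = h

  written : ∀ t {xs} a → Holds t xs → Holds (act M (just a , stay) (act M (current t , left) t)) (a ∷ xs)
  written (tape []      _ _) a h = a ∷ h
  written (tape (_ ∷ _) _ _) a h = a ∷ h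

  Hosted : ∀ (c′ : Code (suc k)) → (Pos c′ → Control c) → Control c → Set
  Hosted c′ ι exit = ∀ p ts → step M (ι p , ts) ≡
    (let s , as = transition c′ ι exit p (heads ts) in s , zipWith (act M) as ts)

  iterate-+ : ∀ {A : Set} (f : A → A) x m n → iterate f x (m + n) ≡ iterate f (iterate f x m) n
  iterate-+ f x zero    n = refl
  iterate-+ f x (suc m) n = iterate-+ f (f x) m n

  record Simulated (q : Control c) (ts : Tapes) (t : ℕ) (q′ : Control c) (τ : Stacks (suc k)) : Set where
    constructor simulated
    field
      {tapes} : Tapes
      steps   : iterate (step M) (q , ts) t ≡ (q′ , tapes)
      holds   : Hold tapes τ

  then : ∀ {q ts m q′ σ n q″ τ} → Simulated q ts m q′ σ →
         (∀ {ts′} → Hold ts′ σ → Simulated q′ ts′ n q″ τ) → Simulated q ts (m + n) q″ τ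
  then {q} {ts} {m} {n = n} (simulated eq h) next with next h
  ... | simulated eq′ h′ = simulated (trans (iterate-+ (step M) (q , ts) m n) (trans (cong (λ s → iterate (step M) s n) eq) eq′)) h′

  one-step : ∀ {q ts q′ ts′ σ} → step M (q , ts) ≡ (q′ , ts′) → Hold ts′ σ → Simulated q ts 1 q′ σ
  one-step = simulated

  choose : ∀ {ts σ r} (f : Γ → Bool) {b} {q₁ q₂ : Control c} → Hold ts σ → f (top σ r) ≡ b →
           (if f (lookup (heads ts) r) then q₁ else q₂) ≡ (if b then q₁ else q₂)
  choose {r = r} f {q₁ = q₁} {q₂} h eq = cong (λ x → if x then q₁ else q₂) (trans (cong f (heads-top h r)) eq)

  push-sim : ∀ {ts σ q q′ q″ a} s (x : Vec Γ (suc k) → Γ) → Hold ts σ →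
    (∀ ts → step M (q , ts) ≡ (q′ , zipWith (act M) (idle (heads ts) [ s ]≔ (lookup (heads ts) s , left)) ts)) →
    (∀ ts → step M (q′ , ts) ≡ (q″ , zipWith (act M) (idle (heads ts) [ s ]≔ (x (heads ts) , stay)) ts)) →
    x (heads (zipWith (act M) (idle (heads ts) [ s ]≔ (lookup (heads ts) s , left)) ts)) ≡ just a →
    Simulated q ts 2 q″ (σ [ s ]≔ (a ∷ lookup σ s))
  push-sim {ts} {σ} {a = a} s x h step₁ step₂ reads =
    simulated (trans (cong (step M) (step₁ ts)) (step₂ ts₁)) (hold holds)
    where
    ts₁ = zipWith (act M) (idle (heads ts) [ s ]≔ (lookup (heads ts) s , left)) ts
    holds : ∀ i → Holds (lookup (zipWith (act M) (idle (heads ts₁) [ s ]≔ (x (heads ts₁) , stay)) ts₁) i)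
                        (lookup (σ [ s ]≔ (a ∷ lookup σ s)) i)
    holds i with i Fin.≟ s
    ... | yes refl = subst₂ Holds
      (sym (trans (acted ts₁ s _) (cong₂ (λ y t → act M (y , stay) t) reads
        (trans (acted ts s _) (cong (λ y → act M (y , left) (lookup ts s)) (Vec.lookup-map s current ts))))))
      (sym (Vec.lookup∘update s σ _)) (written (lookup ts s) a (get h s))
    ... | no i≢s = subst₂ Holds (sym (trans (unacted ts₁ s _ i≢s) (unacted ts s _ i≢s)))
      (sym (Vec.lookup∘update′ i≢s σ _)) (get h i)

  simulate : ∀ {c′ σ t τ} → Run c′ σ t τ → ∀ {ι exit} → Hosted c′ ι exit → ∀ {ts} → Hold ts σ →
             Simulated (ι (entry c′)) ts t exit τ
  simulate nop host {ts} h = one-step (host tt ts) (hold-idle h)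
  simulate (push r a) host h = push-sim r (λ _ → just a) h (host false) (host true) refl
  simulate (transcribe {σ} r s r≢s eq) host {ts} h =
    push-sim s (λ hs → lookup hs r) h (host false) (host true)
      (trans (Vec.lookup-map r current (zipWith (act M) (idle (heads ts) [ s ]≔ (lookup (heads ts) s , left)) ts))
        (trans (cong current (unacted ts s _ r≢s)) (trans (holds-top (lookup ts r) (get h r)) eq)))
  simulate (pop r) host {ts} h = one-step (host tt ts) (hold-update r _ _ h (pop-holds (lookup ts r) (get h r)))
  simulate (p ⨾ q) host h =
    then (simulate p (λ i → host (inj₁ i)) h) (simulate q (λ i → host (inj₂ i)))
  simulate (branch-true {f = f} eq p) host {ts} h =
    then (one-step (trans (host (inj₁ tt) ts) (cong (_, _) (choose f h eq))) (hold-idle h))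
         (simulate p (λ i → host (inj₂ (inj₁ i))))
  simulate (branch-false {f = f} eq p) host {ts} h =
    then (one-step (trans (host (inj₁ tt) ts) (cong (_, _) (choose f h eq))) (hold-idle h))
         (simulate p (λ i → host (inj₂ (inj₂ i))))
  simulate (while-stop {f = f} eq) host {ts} h =
    one-step (trans (host (inj₁ tt) ts) (cong (_, _) (choose f h eq))) (hold-idle h)
  simulate (while-step {f = f} eq p w) host {ts} h =
    then (one-step (trans (host (inj₁ tt) ts) (cong (_, _) (choose f h eq))) (hold-idle h))
         -- The body exits into the test of the loop, so `host` serves for the remaining turns too.
         (λ h′ → then (simulate p (λ i → host (inj₂ i)) h′) (simulate w host))

  load-holds : ∀ as → Holds (load M as) as
  load-holds []       = blank []
  load-holds (a ∷ as) = a ∷ go as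
    where
    go : ∀ as → List.map just as ∼ as
    go []       = []
    go (a ∷ as) = a ∷ go as

  stays : ∀ b ts t → iterate (step M) (halted b , ts) t ≡ (halted b , ts)
  stays b ts zero    = refl
  stays b ts (suc t) = stays b ts t

  -- The additional step is the one from `finished` to `halted`, which reads the result.
  decides : ∀ as {t τ} T → Run c (as ∷ replicate k []) t τ → suc t ≤ T →
            verdictAfter M T as ≡ just (is-just (top τ out))
  decides as {t} {τ} T run le with simulate run {at} {finished} (λ p ts → refl) {proj₂ (initial M as)} (hold holds)
    where
    holds : ∀ i → Holds (lookup (load M as ∷ replicate k (tape [] nothing [])) i) (lookup (as ∷ replicate k []) i)
    holds zero    = load-holds as
    holds (suc i) = subst₂ Holds (sym (Vec.lookup-replicate i _)) (sym (Vec.lookup-replicate i _)) (blank [])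
  ... | simulated {ts} eq h = cong (λ s → TuringMachine.verdict M (proj₁ s)) (begin
    iterate (step M) (initial M as) T                             ≡⟨ cong (iterate (step M) (initial M as)) (ℕ.m+[n∸m]≡n le′) ⟨
    iterate (step M) (initial M as) (t + (T ∸ t))                 ≡⟨ iterate-+ (step M) (initial M as) t (T ∸ t) ⟩
    iterate (step M) (iterate (step M) (initial M as) t) (T ∸ t)  ≡⟨ cong₂ (iterate (step M)) eq (ℕ.+-∸-assoc 1 le) ⟩
    iterate (step M) (finished , ts) (suc (T ∸ suc t))            ≡⟨ stays _ _ (T ∸ suc t) ⟩
    (halted (is-just (lookup (heads ts) out)) , _)                ≡⟨ cong (λ x → halted (is-just x) , zipWith (act M) (idle (heads ts)) ts) (heads-top h out) ⟩
    (halted (is-just (top τ out)) , _)                            ∎)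
    where
    open ≡-Reasoning
    le′ = ℕ.≤-trans (ℕ.n≤1+n t) le

-- Copying between stacks

clearing : ∀ {k} → Fin k → Code k
clearing r = while r is-just (pop r)

moving : ∀ {k} → Fin k → Fin k → Code k
moving r s = while r is-just (transcribe r s ⨾ pop r)

doubling : ∀ {k} → Fin k → Fin k → Fin k → Code k
doubling t r s = while t is-just (transcribe t r ⨾ transcribe t s ⨾ pop t)

-- Moving a stack reverses it. The way over `t` reverses twice, and on the way back `r` and `s` are
-- filled together.
copying : ∀ {k} → Fin k → Fin k → Fin k → Code k
copying r s t = clearing r ⨾ moving s t ⨾ doubling t r s

stacks-ext : ∀ {k} {σ τ : Stacks k} → (∀ i → lookup σ i ≡ lookup τ i) → σ ≡ τ
stacks-ext {σ = σ} {τ} eq =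
  trans (sym (Vec.tabulate∘lookup σ)) (trans (Vec.tabulate-cong eq) (Vec.tabulate∘lookup τ))

module _ {k : ℕ} where

  clearing-run : ∀ xs {σ} (r : Fin k) → lookup σ r ≡ xs → ∃[ τ ] Run (clearing r) σ (1 + 2 * length xs) τ ×
                 lookup τ r ≡ [] × (∀ {i} → i ≢ r → lookup τ i ≡ lookup σ i)
  clearing-run [] {σ} r eq = σ , while-stop (cong (is-just ∘ List.head) eq) , eq , λ _ → refl
  clearing-run (a ∷ xs) {σ} r eq
    with clearing-run xs r (trans (Vec.lookup∘update r σ _) (cong pop-list eq))
  ... | τ , run , τr , same =
    τ , subst (λ t → Run (clearing r) σ t τ) (time (length xs)) (while-step (cong is-just (cong List.head eq)) (pop r) run) ,
    τr , λ i≢r → trans (same i≢r) (Vec.lookup∘update′ i≢r σ _)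
    where
    open +-*-Solver
    time : ∀ n → suc (1 + (1 + 2 * n)) ≡ 1 + 2 * suc n
    time = solve 1 (λ n → con 1 :+ (con 1 :+ (con 1 :+ con 2 :* n)) := con 1 :+ con 2 :* (con 1 :+ n)) refl

  moving-run : ∀ xs {σ} (r s : Fin k) → r ≢ s → lookup σ r ≡ xs → ∃[ τ ] Run (moving r s) σ (1 + 4 * length xs) τ ×
               lookup τ r ≡ [] × lookup τ s ≡ xs ʳ++ lookup σ s × (∀ {i} → i ≢ r → i ≢ s → lookup τ i ≡ lookup σ i)
  moving-run [] {σ} r s r≢s eq = σ , while-stop (cong (is-just ∘ List.head) eq) , eq , refl , λ _ _ → refl
  moving-run (a ∷ xs) {σ} r s r≢s eq
    with moving-run xs {σ₂} r s r≢s (trans (Vec.lookup∘update r σ₁ _) (cong pop-list (trans (Vec.lookup∘update′ r≢s σ _) eq)))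
    where
    σ₁ = σ [ s ]≔ (a ∷ lookup σ s)
    σ₂ = σ₁ [ r ]≔ pop-list (lookup σ₁ r)
  ... | τ , run , τr , τs , same =
    τ , subst (λ t → Run (moving r s) σ t τ) (time (length xs))
          (while-step (cong is-just (cong List.head eq)) (transcribe r s r≢s (cong List.head eq) ⨾ pop r) run) ,
    τr , trans τs (cong (xs ʳ++_) (trans (Vec.lookup∘update′ (r≢s ∘ sym) σ₁ _) (Vec.lookup∘update s σ _))) ,
    λ i≢r i≢s → trans (same i≢r i≢s) (trans (Vec.lookup∘update′ i≢r σ₁ _) (Vec.lookup∘update′ i≢s σ _))
    where
    σ₁ = σ [ s ]≔ (a ∷ lookup σ s)
    open +-*-Solver
    time : ∀ n → suc ((2 + 1) + (1 + 4 * n)) ≡ 1 + 4 * suc n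
    time = solve 1 (λ n → con 1 :+ (con 3 :+ (con 1 :+ con 4 :* n)) := con 1 :+ con 4 :* (con 1 :+ n)) refl

  Doubled : List Symbol → Stacks k → Fin k → Fin k → Fin k → Set
  Doubled xs σ t r s =
    ∃[ τ ] Run (doubling t r s) σ (1 + 6 * length xs) τ × lookup τ t ≡ [] ×
    lookup τ r ≡ xs ʳ++ lookup σ r × lookup τ s ≡ xs ʳ++ lookup σ s ×
    (∀ {i} → i ≢ t → i ≢ r → i ≢ s → lookup τ i ≡ lookup σ i)

  doubling-run : ∀ xs {σ} (t r s : Fin k) → t ≢ r → t ≢ s → r ≢ s → lookup σ t ≡ xs → Doubled xs σ t r s
  doubling-run [] {σ} t r s _ _ _ eq = σ , while-stop (cong (is-just ∘ List.head) eq) , eq , refl , refl , λ _ _ _ → refl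
  doubling-run (a ∷ xs) {σ} t r s t≢r t≢s r≢s eq = extend (doubling-run xs {σ₃} t r s t≢r t≢s r≢s
      (trans (Vec.lookup∘update t σ₂ _) (cong pop-list (trans (Vec.lookup∘update′ t≢s σ₁ _) eq₁))))
    where
    σ₁ = σ [ r ]≔ (a ∷ lookup σ r)
    σ₂ = σ₁ [ s ]≔ (a ∷ lookup σ₁ s)
    σ₃ = σ₂ [ t ]≔ pop-list (lookup σ₂ t)
    eq₁ : lookup σ₁ t ≡ a ∷ xs
    eq₁ = trans (Vec.lookup∘update′ t≢r σ _) eq
    open +-*-Solver
    time : ∀ n → suc ((2 + (2 + 1)) + (1 + 6 * n)) ≡ 1 + 6 * suc n
    time = solve 1 (λ n → con 1 :+ (con 5 :+ (con 1 :+ con 6 :* n)) := con 1 :+ con 6 :* (con 1 :+ n)) refl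
    extend : Doubled xs σ₃ t r s → Doubled (a ∷ xs) σ t r s
    extend (τ , run , τt , τr , τs , same) =
      τ , subst (λ n → Run (doubling t r s) σ n τ) (time (length xs))
            (while-step (cong is-just (cong List.head eq))
              (transcribe t r t≢r (cong List.head eq) ⨾ transcribe t s t≢s (cong List.head eq₁) ⨾ pop t) run) ,
      τt ,
      trans τr (cong (xs ʳ++_) (trans (Vec.lookup∘update′ (t≢r ∘ sym) σ₂ _)
        (trans (Vec.lookup∘update′ r≢s σ₁ _) (Vec.lookup∘update r σ _)))) ,
      trans τs (cong (xs ʳ++_) (trans (Vec.lookup∘update′ (t≢s ∘ sym) σ₂ _)
        (trans (Vec.lookup∘update s σ₁ _) (cong (a ∷_) (Vec.lookup∘update′ (r≢s ∘ sym) σ _))))) ,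
      λ i≢t i≢r i≢s → trans (same i≢t i≢r i≢s) (trans (Vec.lookup∘update′ i≢t σ₂ _)
        (trans (Vec.lookup∘update′ i≢s σ₁ _) (Vec.lookup∘update′ i≢r σ _)))

  copying-run : ∀ {σ} (r s t : Fin k) → t ≢ r → t ≢ s → r ≢ s → lookup σ t ≡ [] →
                ∃[ n ] Run (copying r s t) σ n (σ [ r ]≔ lookup σ s) ×
                       n ≡ 3 + (2 * length (lookup σ r) + 10 * length (lookup σ s))
  copying-run {σ} r s t t≢r t≢s r≢s σt =
    let τ₁ , run₁ , r₁ , same₁ = clearing-run (lookup σ r) r refl
        τ₂ , run₂ , s₂ , t₂ , same₂ = moving-run (lookup σ s) {τ₁} s t (t≢s ∘ sym) (same₁ (r≢s ∘ sym))
        xs = lookup σ s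
        τ₂t : lookup τ₂ t ≡ List.reverse xs
        τ₂t = trans t₂ (cong (xs ʳ++_) (trans (same₁ t≢r) σt))
        restored : List.reverse xs ʳ++ [] ≡ xs
        restored = trans (List.ʳ++-defn (List.reverse xs)) (trans (List.++-identityʳ _) (List.reverse-involutive xs))
        τ₃ , run₃ , t₃ , r₃ , s₃ , same₃ = doubling-run (List.reverse xs) {τ₂} t r s t≢r t≢s r≢s τ₂t
        r₃′ = trans r₃ (trans (cong (List.reverse xs ʳ++_) (trans (same₂ r≢s (t≢r ∘ sym)) r₁)) restored)
        s₃′ = trans s₃ (trans (cong (List.reverse xs ʳ++_) s₂) restored)
    in _ , subst (Run (copying r s t) σ _) (stacks-ext (by τ₃ r₃′ s₃′ t₃ λ i≢t i≢r i≢s →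
              trans (same₃ i≢t i≢r i≢s) (trans (same₂ i≢s i≢t) (same₁ i≢r)))) (run₁ ⨾ (run₂ ⨾ run₃)) ,
       trans (cong (λ m → (1 + 2 * length (lookup σ r)) + ((1 + 4 * length xs) + (1 + 6 * m))) (List.length-reverse xs))
             (time (length (lookup σ r)) (length xs))
    where
    open +-*-Solver
    time : ∀ a b → (1 + 2 * a) + ((1 + 4 * b) + (1 + 6 * b)) ≡ 3 + (2 * a + 10 * b)
    time = solve 2 (λ a b → (con 1 :+ con 2 :* a) :+ ((con 1 :+ con 4 :* b) :+ (con 1 :+ con 6 :* b)) :=
                            con 3 :+ (con 2 :* a :+ con 10 :* b)) refl
    by : ∀ τ → lookup τ r ≡ lookup σ s → lookup τ s ≡ lookup σ s → lookup τ t ≡ [] →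
         (∀ {i} → i ≢ t → i ≢ r → i ≢ s → lookup τ i ≡ lookup σ i) → ∀ i → lookup τ i ≡ lookup (σ [ r ]≔ lookup σ s) i
    by τ τr τs τt same i with i Fin.≟ r
    ... | yes refl = trans τr (sym (Vec.lookup∘update r σ _))
    ... | no i≢r = trans (rest (i Fin.≟ s) (i Fin.≟ t)) (sym (Vec.lookup∘update′ i≢r σ _))
      where
      rest : Dec (i ≡ s) → Dec (i ≡ t) → lookup τ i ≡ lookup σ i
      rest (yes refl) _ = τs
      rest (no _) (yes refl) = trans τt (sym σt)
      rest (no i≢s) (no i≢t) = same i≢t i≢r i≢s

-- Makes room at position 2 for the counter of an enclosing loop; the input and the auxiliary stack
-- keep their places.
insert : ∀ {k} → Fin (2 + k) → Fin (3 + k)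
insert 0F            = 0F
insert 1F            = 1F
insert (suc (suc i)) = suc (suc (suc i))

insert-injective : ∀ {k} (r s : Fin (2 + k)) → insert r ≡ insert s → r ≡ s
insert-injective 0F            0F            _  = refl
insert-injective 1F            1F            _  = refl
insert-injective (suc (suc i)) (suc (suc j)) eq = Fin.suc-injective eq
insert-injective 0F            1F            ()
insert-injective 0F            (suc (suc _)) ()
insert-injective 1F            0F            ()
insert-injective 1F            (suc (suc _)) ()
insert-injective (suc (suc _)) 0F            ()
insert-injective (suc (suc _)) 1F            ()

weaken : ∀ {k} → Code (2 + k) → Code (3 + k)
weaken nop              = nop
weaken (push r a)       = push (insert r) a
weaken (transcribe r s) = transcribe (insert r) (insert s)
weaken (pop r)          = pop (insert r)
weaken (p ⨾ q)          = weaken p ⨾ weaken q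
weaken (branch r f p q) = branch (insert r) f (weaken p) (weaken q)
weaken (while r f p)    = while (insert r) f (weaken p)

widen : ∀ {k} → List Symbol → Stacks (2 + k) → Stacks (3 + k)
widen x (i ∷ t ∷ σ) = i ∷ t ∷ x ∷ σ

widen-lookup : ∀ {k} x (σ : Stacks (2 + k)) r → lookup (widen x σ) (insert r) ≡ lookup σ r
widen-lookup x (i ∷ t ∷ σ) 0F            = refl
widen-lookup x (i ∷ t ∷ σ) 1F            = refl
widen-lookup x (i ∷ t ∷ σ) (suc (suc r)) = refl

widen-update : ∀ {k} x (σ : Stacks (2 + k)) r y → widen x σ [ insert r ]≔ y ≡ widen x (σ [ r ]≔ y)
widen-update x (i ∷ t ∷ σ) 0F            y = refl
widen-update x (i ∷ t ∷ σ) 1F            y = refl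
widen-update x (i ∷ t ∷ σ) (suc (suc r)) y = refl

widen-top : ∀ {k} x (σ : Stacks (2 + k)) r → top (widen x σ) (insert r) ≡ top σ r
widen-top x σ r = cong List.head (widen-lookup x σ r)

weaken-run : ∀ {k} x {c : Code (2 + k)} {σ t τ} → Run c σ t τ → Run (weaken c) (widen x σ) t (widen x τ)
weaken-run x nop = nop
weaken-run x (push {σ} r a) = subst (Run _ _ _)
  (trans (cong (λ y → widen x σ [ insert r ]≔ (a ∷ y)) (widen-lookup x σ r)) (widen-update x σ r _)) (push (insert r) a)
weaken-run x (transcribe {σ} r s {a} r≢s eq) = subst (Run _ _ _)
  (trans (cong (λ y → widen x σ [ insert s ]≔ (a ∷ y)) (widen-lookup x σ s)) (widen-update x σ s _))
  (transcribe (insert r) (insert s) (r≢s ∘ insert-injective r s) (trans (widen-top x σ r) eq))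
weaken-run x (pop {σ} r) = subst (Run _ _ _)
  (trans (cong (λ y → widen x σ [ insert r ]≔ pop-list y) (widen-lookup x σ r)) (widen-update x σ r _)) (pop (insert r))
weaken-run x (p ⨾ q) = weaken-run x p ⨾ weaken-run x q
weaken-run x (branch-true {σ} {r = r} {f} eq p) = branch-true (trans (cong f (widen-top x σ r)) eq) (weaken-run x p)
weaken-run x (branch-false {σ} {r = r} {f} eq p) = branch-false (trans (cong f (widen-top x σ r)) eq) (weaken-run x p)
weaken-run x (while-stop {σ} {r} {f} eq) = while-stop (trans (cong f (widen-top x σ r)) eq)
weaken-run x (while-step {σ} {r = r} {f} eq p w) =
  while-step (trans (cong f (widen-top x σ r)) eq) (weaken-run x p) (weaken-run x w)

-- Every loop is executed once per input symbol and every command lengthens the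
-- longest stack by at most one symbol, so running times are polynomial. The
-- second index is the nesting depth of loops.

data Cmd (k : ℕ) : ℕ → Set where
  skip   : ∀ {d} → Cmd k d
  put    : ∀ {d} → Fin k → Symbol → Cmd k d
  drop   : ∀ {d} → Fin k → Cmd k d
  clear  : ∀ {d} → Fin k → Cmd k d
  copy   : ∀ {d} → Fin k → Fin k → Cmd k d
  input  : ∀ {d} → Fin k → Cmd k d
  _▹_    : ∀ {d} → Cmd k d → Cmd k d → Cmd k d
  test   : ∀ {d} → Fin k → (Γ → Bool) → Cmd k d → Cmd k d → Cmd k d
  repeat : ∀ {d} → Cmd k d → Cmd k (suc d)

infixr 5 _▹_

exec : ∀ {k d} → List Symbol → Cmd k d → Stacks k → Stacks k
exec inp skip           σ = σ
exec inp (put r a)      σ = σ [ r ]≔ (a ∷ lookup σ r)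
exec inp (drop r)       σ = σ [ r ]≔ pop-list (lookup σ r)
exec inp (clear r)      σ = σ [ r ]≔ []
exec inp (copy r s)     σ = σ [ r ]≔ lookup σ s
exec inp (input r)      σ = σ [ r ]≔ inp
exec inp (p ▹ q)        σ = exec inp q (exec inp p σ)
exec inp (test r f p q) σ = if f (top σ r) then exec inp p σ else exec inp q σ
exec inp (repeat p)     σ = iterate (exec inp p) σ (length inp)

reg : ∀ {k} d → Fin k → Fin (2 + (d + k))
reg d r = suc (suc (d ↑ʳ r))

-- Stack 0 holds the input, stack 1 is needed for copying, and the next d
-- stacks hold the loop counters.
compile : ∀ {k d} → Cmd k d → Code (2 + (d + k))
compile skip                   = nop
compile {d = d} (put r a)      = push (reg d r) a
compile {d = d} (drop r)       = pop (reg d r)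
compile {d = d} (clear r)      = clearing (reg d r)
compile {d = d} (copy r s) with r Fin.≟ s
... | yes _ = nop
... | no _  = copying (reg d r) (reg d s) 1F
compile {d = d} (input r)      = copying (reg d r) 0F 1F
compile (p ▹ q)                = compile p ⨾ compile q
compile {d = d} (test r f p q) = branch (reg d r) f (compile p) (compile q)
compile (repeat p)             = copying 2F 0F 1F ⨾ while 2F is-just (pop 2F ⨾ weaken (compile p))

pad : ∀ {k} d → List Symbol → Stacks k → Stacks (2 + (d + k))
pad d inp σ = inp ∷ [] ∷ (replicate d [] Vec.++ σ)

-- One number for two purposes: it bounds the growth of the longest stack and, in units of `κ`, the
-- running time.
ops : ∀ {k d} → Cmd k d → ℕ → ℕ
ops (p ▹ q)        N = ops p N + ops q N
ops (test _ _ p q) N = 1 + (ops p N + ops q N)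
ops (repeat p)     N = 1 + N * (1 + ops p N)
ops _              N = 1

pad-lookup : ∀ {k} d inp (σ : Stacks k) r → lookup (pad d inp σ) (reg d r) ≡ lookup σ r
pad-lookup d inp σ r = Vec.lookup-++ʳ (replicate d []) σ r

pad-update : ∀ {k} d inp (σ : Stacks k) r y → pad d inp σ [ reg d r ]≔ y ≡ pad d inp (σ [ r ]≔ y)
pad-update d inp σ r y = cong (λ τ → inp ∷ [] ∷ τ) (Vec.[]≔-++-↑ʳ (replicate d []) σ r)

Fits : ∀ {k} → ℕ → Stacks k → Set
Fits M σ = ∀ r → length (lookup σ r) ≤ M

fits-update : ∀ {k M m} (σ : Stacks k) r xs → Fits M σ → length xs ≤ M + m → Fits (M + m) (σ [ r ]≔ xs)
fits-update {M = M} {m} σ r xs small le i with i Fin.≟ r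
... | yes refl = ℕ.≤-trans (ℕ.≤-reflexive (cong length (Vec.lookup∘update r σ xs))) le
... | no i≢r = ℕ.≤-trans (ℕ.≤-reflexive (cong length (Vec.lookup∘update′ i≢r σ xs)))
                 (ℕ.≤-trans (small i) (ℕ.m≤m+n M m))

pop-length : ∀ xs → length (pop-list xs) ≤ length xs
pop-length []       = z≤n
pop-length (_ ∷ xs) = ℕ.n≤1+n _

module _ {k : ℕ} (inp : List Symbol) where

  private
    N = length inp

  growth : ∀ {d} (c : Cmd k d) {σ M} → Fits M σ → N ≤ M → Fits (M + ops c N) (exec inp c σ)
  growth skip {M = M} small le r = ℕ.≤-trans (small r) (ℕ.m≤m+n M 1)
  growth (put r a) {σ} {M} small le =
    fits-update σ r (a ∷ lookup σ r) small (ℕ.≤-trans (s≤s (small r)) (ℕ.≤-reflexive (ℕ.+-comm 1 M)))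
  growth (drop r) {σ} {M} small le =
    fits-update σ r (pop-list (lookup σ r)) small (ℕ.≤-trans (pop-length (lookup σ r)) (ℕ.≤-trans (small r) (ℕ.m≤m+n M 1)))
  growth (clear r) {σ} small le = fits-update σ r [] small z≤n
  growth (copy r s) {σ} {M} small le = fits-update σ r (lookup σ s) small (ℕ.≤-trans (small s) (ℕ.m≤m+n M 1))
  growth (input r) {σ} {M} small le = fits-update σ r inp small (ℕ.≤-trans le (ℕ.m≤m+n M 1))
  growth (p ▹ q) {σ} {M} small le i =
    ℕ.≤-trans (growth q (growth p small le) (ℕ.≤-trans le (ℕ.m≤m+n M (ops p N))) i)
              (ℕ.≤-reflexive (ℕ.+-assoc M (ops p N) (ops q N)))
  growth (test r f p q) {σ} {M} small le i with f (top σ r)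
  ... | true = ℕ.≤-trans (growth p small le i)
                 (ℕ.+-monoʳ-≤ M (ℕ.≤-trans (ℕ.m≤m+n (ops p N) (ops q N)) (ℕ.n≤1+n _)))
  ... | false = ℕ.≤-trans (growth q small le i)
                 (ℕ.+-monoʳ-≤ M (ℕ.≤-trans (ℕ.m≤n+m (ops q N) (ops p N)) (ℕ.n≤1+n _)))
  growth (repeat p) {σ} {M} small le i =
    ℕ.≤-trans (loop N small le i) (ℕ.+-monoʳ-≤ M (ℕ.≤-trans (ℕ.*-monoʳ-≤ N (ℕ.n≤1+n _)) (ℕ.n≤1+n _)))
    where
    loop : ∀ n {σ M} → Fits M σ → N ≤ M → Fits (M + n * ops p N) (iterate (exec inp p) σ n)
    loop zero {M = M} small le r = ℕ.≤-trans (small r) (ℕ.m≤m+n M 0)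
    loop (suc n) {M = M} small le r =
      ℕ.≤-trans (loop n (growth p small le) (ℕ.≤-trans le (ℕ.m≤m+n M _)) r)
                (ℕ.≤-reflexive (ℕ.+-assoc M (ops p N) (n * ops p N)))

  module _ (B : ℕ) where

    -- The dearest basic command is a copy, with at most `3 + 12 * B` steps on stacks of length at
    -- most `B`. The factor 16 leaves a few steps to spare for loops.
    κ : ℕ
    κ = 16 * suc B

    1≤κ : 1 ≤ κ
    1≤κ = s≤s z≤n

    2≤κ : 2 ≤ κ
    2≤κ = ℕ.≤-trans {j = 16} (s≤s (s≤s z≤n)) (ℕ.m≤m*n 16 (suc B))

    unit : ∀ {n} → n ≤ κ → n ≤ 1 * κ
    unit le = ℕ.≤-trans le (ℕ.≤-reflexive (sym (ℕ.*-identityˡ κ)))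

    copying-time : ∀ {n a b} → n ≡ 3 + (2 * a + 10 * b) → a ≤ B → b ≤ B → n + 4 ≤ κ
    copying-time {a = a} {b} refl a≤ b≤ = ℕ.≤-trans (ℕ.+-monoˡ-≤ 4 (ℕ.+-monoʳ-≤ 3
        (ℕ.+-mono-≤ (ℕ.*-monoʳ-≤ 2 a≤) (ℕ.*-monoʳ-≤ 10 b≤))))
        (ℕ.≤-trans (ℕ.m≤m+n _ (9 + 4 * B)) (ℕ.≤-reflexive (eq B)))
      where
      open +-*-Solver
      eq : ∀ B → (3 + (2 * B + 10 * B) + 4) + (9 + 4 * B) ≡ 16 * suc B
      eq = solve 1 (λ B → ((con 3 :+ (con 2 :* B :+ con 10 :* B)) :+ con 4) :+ (con 9 :+ con 4 :* B) :=
                          con 16 :* (con 1 :+ B)) refl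

    Runs : ∀ {d} → Cmd k d → Stacks k → Set
    Runs {d} c σ = ∃[ t ] Run (compile c) (pad d inp σ) t (pad d inp (exec inp c σ)) × t ≤ ops c N * κ

    reg-injective : ∀ d {r s : Fin k} → r ≢ s → reg d r ≢ reg d s
    reg-injective d ne eq = ne (Fin.↑ʳ-injective d _ _ (Fin.suc-injective (Fin.suc-injective eq)))

    runs : ∀ {d} (c : Cmd k d) {σ M} → Fits M σ → N ≤ M → M + ops c N ≤ B → Runs c σ
    runs skip small le bound = 1 , nop , unit 1≤κ
    runs {d} (put r a) {σ} small le bound =
      2 , subst (Run _ _ _) (trans (pad-update d inp σ r _) (cong (λ y → pad d inp (σ [ r ]≔ (a ∷ y))) (pad-lookup d inp σ r)))
            (push (reg d r) a) , unit 2≤κ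
    runs {d} (drop r) {σ} small le bound =
      1 , subst (Run _ _ _) (trans (pad-update d inp σ r _) (cong (λ y → pad d inp (σ [ r ]≔ pop-list y)) (pad-lookup d inp σ r)))
            (pop (reg d r)) , unit 1≤κ
    runs {d} (clear r) {σ} {M} small le bound =
      let τ , run , τr , same = clearing-run (lookup σ r) (reg d r) (pad-lookup d inp σ r)
          small-time = ℕ.≤-trans (s≤s (ℕ.*-monoʳ-≤ 2 (ℕ.≤-trans (small r) (ℕ.≤-trans (ℕ.m≤m+n M 1) bound))))
                         (ℕ.≤-trans (ℕ.m≤m+n _ (15 + 14 * B)) (ℕ.≤-reflexive (eq B)))
      in _ , subst (Run _ _ _) (trans (stacks-ext (by τ τr same)) (pad-update d inp σ r [])) run , unit small-time
      where
      open +-*-Solver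
      eq : ∀ B → (1 + 2 * B) + (15 + 14 * B) ≡ 16 * suc B
      eq = solve 1 (λ B → (con 1 :+ con 2 :* B) :+ (con 15 :+ con 14 :* B) := con 16 :* (con 1 :+ B)) refl
      by : ∀ τ → lookup τ (reg d r) ≡ [] → (∀ {i} → i ≢ reg d r → lookup τ i ≡ lookup (pad d inp σ) i) →
           ∀ i → lookup τ i ≡ lookup (pad d inp σ [ reg d r ]≔ []) i
      by τ τr same i with i Fin.≟ reg d r
      ... | yes refl = trans τr (sym (Vec.lookup∘update (reg d r) (pad d inp σ) []))
      ... | no i≢r   = trans (same i≢r) (sym (Vec.lookup∘update′ i≢r (pad d inp σ) []))
    runs {d} (copy r s) {σ} {M} small le bound with r Fin.≟ s
    ... | yes refl = 1 , subst (Run _ _ _) (cong (pad d inp) (sym (Vec.[]≔-lookup σ r))) nop , unit 1≤κ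
    ... | no r≢s =
      let n , run , time = copying-run {σ = pad d inp σ} (reg d r) (reg d s) 1F (λ ()) (λ ()) (reg-injective d r≢s) refl
          le′ = ℕ.≤-trans (ℕ.m≤m+n M 1) bound
      in n , subst (Run _ _ _) (trans (pad-update d inp σ r _) (cong (λ y → pad d inp (σ [ r ]≔ y)) (pad-lookup d inp σ s))) run ,
         unit (ℕ.≤-trans (ℕ.m≤m+n n 4) (copying-time time
           (ℕ.≤-trans (ℕ.≤-reflexive (cong length (pad-lookup d inp σ r))) (ℕ.≤-trans (small r) le′))
           (ℕ.≤-trans (ℕ.≤-reflexive (cong length (pad-lookup d inp σ s))) (ℕ.≤-trans (small s) le′))))
    runs {d} (input r) {σ} {M} small le bound =
      let n , run , time = copying-run {σ = pad d inp σ} (reg d r) 0F 1F (λ ()) (λ ()) (λ ()) refl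
          le′ = ℕ.≤-trans (ℕ.m≤m+n M 1) bound
      in n , subst (Run _ _ _) (pad-update d inp σ r inp) run ,
         unit (ℕ.≤-trans (ℕ.m≤m+n n 4) (copying-time time
           (ℕ.≤-trans (ℕ.≤-reflexive (cong length (pad-lookup d inp σ r))) (ℕ.≤-trans (small r) le′)) (ℕ.≤-trans le le′)))
    runs (p ▹ q) {σ} {M} small le bound =
      let bound′ = ℕ.≤-trans (ℕ.≤-reflexive (ℕ.+-assoc M (ops p N) (ops q N))) bound
          m , run , m≤ = runs p small le (ℕ.≤-trans (ℕ.m≤m+n _ (ops q N)) bound′)
          n , run′ , n≤ = runs q (growth p small le) (ℕ.≤-trans le (ℕ.m≤m+n M (ops p N))) bound′
      in m + n , run ⨾ run′ , ℕ.≤-trans (ℕ.+-mono-≤ m≤ n≤) (ℕ.≤-reflexive (sym (ℕ.*-distribʳ-+ κ (ops p N) (ops q N))))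
    runs {d} (test r f p q) {σ} {M} small le bound with f (top σ r) in eq
    ... | true =
      let m , run , m≤ = runs p small le (ℕ.≤-trans (ℕ.+-monoʳ-≤ M (ℕ.≤-trans (ℕ.m≤m+n _ (ops q N)) (ℕ.n≤1+n _))) bound)
      in suc m , branch-true (trans (cong (f ∘ List.head) (pad-lookup d inp σ r)) eq) run ,
         ℕ.+-mono-≤ 1≤κ (ℕ.≤-trans m≤ (ℕ.*-monoˡ-≤ κ (ℕ.m≤m+n (ops p N) (ops q N))))
    ... | false =
      let m , run , m≤ = runs q small le (ℕ.≤-trans (ℕ.+-monoʳ-≤ M (ℕ.≤-trans (ℕ.m≤n+m _ (ops p N)) (ℕ.n≤1+n _))) bound)
      in suc m , branch-false (trans (cong (f ∘ List.head) (pad-lookup d inp σ r)) eq) run ,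
         ℕ.+-mono-≤ 1≤κ (ℕ.≤-trans m≤ (ℕ.*-monoˡ-≤ κ (ℕ.m≤n+m (ops q N) (ops p N))))
    runs {suc d} (repeat p) {σ} {M} small le bound =
      let n , run , time = copying-run {σ = pad (suc d) inp σ} 2F 0F 1F (λ ()) (λ ()) (λ ()) refl
          m , run′ , m≤ = loop inp small le (ℕ.≤-trans (ℕ.+-monoʳ-≤ M (ℕ.n≤1+n _)) bound)
      in n + m , run ⨾ run′ ,
         -- The final test of the loop is charged to the copy that sets up its counter.
         ℕ.≤-trans (ℕ.+-monoʳ-≤ n m≤) (ℕ.≤-trans (ℕ.≤-reflexive (sym (ℕ.+-assoc n 1 _)))
           (ℕ.+-mono-≤ (ℕ.≤-trans (ℕ.+-monoʳ-≤ n (s≤s z≤n)) (copying-time time z≤n (ℕ.≤-trans le (ℕ.≤-trans (ℕ.m≤m+n M _) bound))))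
                       ℕ.≤-refl))
      where
      body = pop 2F ⨾ weaken (compile p)
      loop : ∀ xs {σ M} → Fits M σ → N ≤ M → M + length xs * (1 + ops p N) ≤ B →
             ∃[ t ] Run (while 2F is-just body) (widen xs (pad d inp σ)) t
                        (widen [] (pad d inp (iterate (exec inp p) σ (length xs)))) ×
                    t ≤ 1 + (length xs * (1 + ops p N)) * κ
      loop [] small le bound = 1 , while-stop refl , s≤s z≤n
      loop (x ∷ xs) {σ} {M} small le bound =
        let bound′ = ℕ.≤-trans (ℕ.≤-trans (ℕ.≤-reflexive (ℕ.+-assoc M (ops p N) _))
                       (ℕ.+-monoʳ-≤ M (ℕ.n≤1+n _))) bound
            m , run , m≤ = runs p small le (ℕ.≤-trans (ℕ.m≤m+n _ _) bound′)
            n , run′ , n≤ = loop xs (growth p small le) (ℕ.≤-trans le (ℕ.m≤m+n M _)) bound′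
        in suc ((1 + m) + n) , while-step refl (pop 2F ⨾ weaken-run xs run) run′ , (begin
          suc ((1 + m) + n)                                        ≤⟨ s≤s (ℕ.+-mono-≤ (s≤s m≤) n≤) ⟩
          suc ((1 + O * κ) + (1 + L * (1 + O) * κ))                ≡⟨ rearrange (O * κ) (L * (1 + O) * κ) ⟩
          1 + ((2 + O * κ) + L * (1 + O) * κ)                      ≤⟨ s≤s (ℕ.+-monoˡ-≤ _ (ℕ.+-monoˡ-≤ (O * κ) {2} {κ} 2≤κ)) ⟩
          1 + ((κ + O * κ) + L * (1 + O) * κ)                      ≡⟨ cong suc (ℕ.*-distribʳ-+ κ (1 + O) (L * (1 + O))) ⟨
          1 + (suc L * (1 + O)) * κ                                ∎)
        where
        open ℕ.≤-Reasoning
        O = ops p N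
        L = length xs
        rearrange : ∀ a b → suc ((1 + a) + (1 + b)) ≡ 1 + ((2 + a) + b)
        rearrange = solve 2 (λ a b → con 1 :+ ((con 1 :+ a) :+ (con 1 :+ b)) := con 1 :+ ((con 2 :+ a) :+ b)) refl
          where open +-*-Solver

-- Polynomial bounds

-- The base `suc N` is positive, so powers grow with the exponent, as the bound for sums requires.
Polynomial : (ℕ → ℕ) → Set
Polynomial f = ∃[ c ] ∃[ e ] ∀ N → f N ≤ c * suc N ^ e

poly-const : ∀ a → Polynomial (λ _ → a)
poly-const a = a , 0 , λ N → ℕ.≤-reflexive (sym (ℕ.*-identityʳ a))

poly-id : Polynomial (λ N → N)
poly-id = 1 , 1 , λ N → ℕ.≤-trans (ℕ.n≤1+n N) (ℕ.≤-reflexive (sym (trans (ℕ.*-identityˡ _) (ℕ.*-identityʳ (suc N)))))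

poly-+ : ∀ {f g} → Polynomial f → Polynomial g → Polynomial (λ N → f N + g N)
poly-+ (c , e , p) (c′ , e′ , q) = c + c′ , e + e′ , λ N →
  ℕ.≤-trans (ℕ.+-mono-≤ (ℕ.≤-trans (p N) (ℕ.*-monoʳ-≤ c (ℕ.^-monoʳ-≤ (suc N) (ℕ.m≤m+n e e′))))
                        (ℕ.≤-trans (q N) (ℕ.*-monoʳ-≤ c′ (ℕ.^-monoʳ-≤ (suc N) (ℕ.m≤n+m e′ e)))))
            (ℕ.≤-reflexive (sym (ℕ.*-distribʳ-+ (suc N ^ (e + e′)) c c′)))

poly-* : ∀ {f g} → Polynomial f → Polynomial g → Polynomial (λ N → f N * g N)
poly-* (c , e , p) (c′ , e′ , q) = c * c′ , e + e′ , λ N →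
  ℕ.≤-trans (ℕ.*-mono-≤ (p N) (q N)) (ℕ.≤-reflexive (trans (ℕ.[m*n]*[o*p]≡[m*o]*[n*p] c (suc N ^ e) c′ (suc N ^ e′))
    (cong (c * c′ *_) (sym (ℕ.^-distribˡ-+-* (suc N) e e′)))))

poly-ops : ∀ {k d} (c : Cmd k d) → Polynomial (ops c)
poly-ops skip           = poly-const 1
poly-ops (put _ _)      = poly-const 1
poly-ops (drop _)       = poly-const 1
poly-ops (clear _)      = poly-const 1
poly-ops (copy _ _)     = poly-const 1
poly-ops (input _)      = poly-const 1
poly-ops (p ▹ q)        = poly-+ (poly-ops p) (poly-ops q)
poly-ops (test _ _ p q) = poly-+ (poly-const 1) (poly-+ (poly-ops p) (poly-ops q))
poly-ops (repeat p)     = poly-+ (poly-const 1) (poly-* poly-id (poly-+ (poly-const 1) (poly-ops p)))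

^-distribʳ-* : ∀ e m n → (m * n) ^ e ≡ m ^ e * n ^ e
^-distribʳ-* zero    m n = refl
^-distribʳ-* (suc e) m n =
  trans (cong (m * n *_) (^-distribʳ-* e m n)) (ℕ.[m*n]*[o*p]≡[m*o]*[n*p] m n (m ^ e) (n ^ e))

-- For positive `N` one has `suc N ≤ 2 * N`, which gives the factor `2 ^ e`; the value at 0 goes
-- into the constant term.
poly-bound : ∀ {f} → Polynomial f → ∃[ c ] ∃[ e ] ∀ N → f N ≤ c * N ^ e + c
poly-bound {f} (c , e , p) = c * 2 ^ e , e , λ N → ℕ.≤-trans (p N) (by N)
  where
  by : ∀ N → c * suc N ^ e ≤ c * 2 ^ e * N ^ e + c * 2 ^ e
  by zero = ℕ.≤-trans (ℕ.*-monoʳ-≤ c (ℕ.^-monoˡ-≤ e (s≤s z≤n))) (ℕ.m≤n+m (c * 2 ^ e) _)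
  by N@(suc n) = ℕ.≤-trans (ℕ.*-monoʳ-≤ c (ℕ.^-monoˡ-≤ e (ℕ.≤-trans (ℕ.+-monoˡ-≤ N (s≤s z≤n)) (ℕ.≤-reflexive (cong (N +_) (sym (ℕ.+-identityʳ N)))))))
    (ℕ.≤-trans (ℕ.≤-reflexive (trans (cong (c *_) (^-distribʳ-* e 2 N)) (sym (ℕ.*-assoc c (2 ^ e) (N ^ e)))))
               (ℕ.m≤m+n _ (c * 2 ^ e)))

replicate-++ : ∀ {A : Set} (x : A) d k → replicate d x Vec.++ replicate k x ≡ replicate (d + k) x
replicate-++ x zero    k = refl
replicate-++ x (suc d) k = cong (x ∷_) (replicate-++ x d k)

decides-in-polynomial-time : ∀ {k d} (c : Cmd k d) (out : Fin k) →
  Σ[ M ∈ TuringMachine Symbol ] ∃[ a ] ∃[ e ] ∀ inp →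
    verdictAfter M (a * length inp ^ e + a) inp ≡ just (is-just (top (exec inp c (replicate k [])) out))
decides-in-polynomial-time {k} {d} c out =
  machine (compile c) (reg d out) , proj₁ bound , proj₁ (proj₂ bound) , λ inp →
    let N = length inp
        B = N + ops c N
        t , run , t≤ = runs inp B c {replicate k []} {N} (λ r → subst (λ xs → length xs ≤ N) (sym (Vec.lookup-replicate r [])) z≤n)
                         ℕ.≤-refl ℕ.≤-refl
        start = cong (λ τ → inp ∷ [] ∷ τ) (replicate-++ [] d k)
    in trans (decides (compile c) (reg d out) inp _ (subst (λ σ → Run (compile c) σ t (pad d inp (exec inp c (replicate k [])))) start run)
                (ℕ.≤-trans (s≤s t≤) (proj₂ (proj₂ bound) N)))
             (cong (just ∘ is-just ∘ List.head) (pad-lookup d inp (exec inp c (replicate k [])) out))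
  where
  bound = poly-bound {λ N → 1 + ops c N * (16 * (1 + (N + ops c N)))}
    (poly-+ (poly-const 1) (poly-* (poly-ops c) (poly-* (poly-const 16) (poly-+ (poly-const 1) (poly-+ poly-id (poly-ops c))))))

-- Commands on a block of later stacks

lift : ∀ {k d} → Cmd k d → Cmd (suc k) d
lift skip           = skip
lift (put r a)      = put (suc r) a
lift (drop r)       = drop (suc r)
lift (clear r)      = clear (suc r)
lift (copy r s)     = copy (suc r) (suc s)
lift (input r)      = input (suc r)
lift (p ▹ q)        = lift p ▹ lift q
lift (test r f p q) = test (suc r) f (lift p) (lift q)
lift (repeat p)     = repeat (lift p)

under : ∀ {k d} m → Cmd k d → Cmd (m + k) d
under zero    c = c
under (suc m) c = lift (under m c)

module _ {inp : List Symbol} where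

  exec-lift : ∀ {k d} (c : Cmd k d) x σ → exec inp (lift c) (x ∷ σ) ≡ x ∷ exec inp c σ
  exec-lift skip           x σ = refl
  exec-lift (put r a)      x σ = refl
  exec-lift (drop r)       x σ = refl
  exec-lift (clear r)      x σ = refl
  exec-lift (copy r s)     x σ = refl
  exec-lift (input r)      x σ = refl
  exec-lift (p ▹ q)        x σ = trans (cong (exec inp (lift q)) (exec-lift p x σ)) (exec-lift q x _)
  exec-lift (test r f p q) x σ with f (top σ r)
  ... | true  = exec-lift p x σ
  ... | false = exec-lift q x σ
  exec-lift (repeat p)     x σ = loop (length inp) σ
    where
    loop : ∀ n σ → iterate (exec inp (lift p)) (x ∷ σ) n ≡ x ∷ iterate (exec inp p) σ n
    loop zero    σ = refl
    loop (suc n) σ = trans (cong (λ τ → iterate (exec inp (lift p)) τ n) (exec-lift p x σ)) (loop n (exec inp p σ))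

  exec-under : ∀ {k d m} (τ : Stacks m) (c : Cmd k d) σ → exec inp (under m c) (τ Vec.++ σ) ≡ τ Vec.++ exec inp c σ
  exec-under []      c σ = refl
  exec-under (x ∷ τ) c σ = trans (exec-lift (under _ c) x (τ Vec.++ σ)) (cong (x ∷_) (exec-under τ c σ))

-- A loop makes `length inp` turns in any case; so bodies are written to do nothing once their work
-- is done.
iterate-fixed : ∀ {A : Set} {f : A → A} {x} → f x ≡ x → ∀ n → iterate f x n ≡ x
iterate-fixed eq zero    = refl
iterate-fixed {f = f} eq (suc n) = trans (cong (λ y → iterate f y n) eq) (iterate-fixed eq n)

-- Rows on stacks

isOne isZero : Γ → Bool
isOne (just (bit b)) = b
isOne _              = false
isZero (just (bit b)) = not b
isZero _              = false

flag : Bool → List Symbol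
flag true  = sep ∷ []
flag false = []

raise : ∀ {k d} → Fin k → Cmd k d
raise r = clear r ▹ put r sep

bits : ∀ {n} → Vec Bool n → List Symbol
bits x = List.map bit (toList x)

rows : ∀ {n} → List (Vec Bool n) → List Symbol
rows = concatMap encodeRow

pour : ∀ {k d} → Fin k → Fin k → Cmd k (suc d)
pour r s = repeat (test r isOne (drop r ▹ put s (bit true)) (test r isZero (drop r ▹ put s (bit false)) skip))

-- `pour` reverses the bits and stops at the separator. Going over stack 2, the first row arrives on
-- stack 1 in its original order.
uncons : ∀ {k d} → Cmd (3 + k) (suc d)
uncons = clear 1F ▹ pour 0F 2F ▹ drop 0F ▹ pour 2F 1F

rowLoop : ∀ {k d} → Cmd (3 + k) (suc d) → Cmd (3 + k) (suc (suc d))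
rowLoop body = repeat (test 0F is-just (uncons ▹ body ▹ clear 1F) skip)

scanFor : ∀ {k d} → (Γ → Bool) → Cmd (2 + k) (suc d)
scanFor t = repeat (test 0F t (raise 1F) skip ▹ drop 0F)

data NoBit : List Symbol → Set where
  []  : NoBit []
  sep : ∀ {xs} → NoBit (sep ∷ xs)

reverse-bits : ∀ bs ys → List.map bit bs ʳ++ ys ≡ List.map bit (reverse bs) ++ ys
reverse-bits bs ys = trans (List.ʳ++-defn (List.map bit bs)) (cong (_++ ys) (sym (List.reverse-map bit bs)))

double-reverse-bits : ∀ bs ys → List.map bit (reverse bs) ʳ++ ys ≡ List.map bit bs ++ ys
double-reverse-bits bs ys = trans (reverse-bits (reverse bs) ys) (cong (λ cs → List.map bit cs ++ ys) (List.reverse-involutive bs))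

module _ {inp : List Symbol} where

  pour-exec : ∀ {k} {r s : Fin k} → r ≢ s → ∀ bs rest σ → length bs ≤ length inp →
              lookup σ r ≡ List.map bit bs ++ rest → NoBit rest →
              exec inp (pour {d = 0} r s) σ ≡ (σ [ r ]≔ rest) [ s ]≔ (List.map bit bs ʳ++ lookup σ s)
  pour-exec {k} {r} {s} r≢s bs rest σ len eq noBit = loop (length inp) bs σ len eq
    where
    body : Cmd k 0
    body = test r isOne (drop r ▹ put s (bit true)) (test r isZero (drop r ▹ put s (bit false)) skip)

    stop : ∀ σ xs → lookup σ r ≡ xs → NoBit xs → exec inp body σ ≡ σ
    stop σ xs eq _ with lookup σ r
    stop σ .[]        refl []  | .[]        = refl
    stop σ .(sep ∷ _) refl sep | .(sep ∷ _) = refl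

    go : ∀ σ b xs → lookup σ r ≡ bit b ∷ xs → exec inp body σ ≡ (σ [ r ]≔ xs) [ s ]≔ (bit b ∷ lookup σ s)
    go σ true xs eq with lookup σ r
    go σ true xs refl | .(bit true ∷ xs) = cong (λ y → (σ [ r ]≔ xs) [ s ]≔ (bit true ∷ y)) (Vec.lookup∘update′ (r≢s ∘ sym) σ xs)
    go σ false xs eq with lookup σ r
    go σ false xs refl | .(bit false ∷ xs) = cong (λ y → (σ [ r ]≔ xs) [ s ]≔ (bit false ∷ y)) (Vec.lookup∘update′ (r≢s ∘ sym) σ xs)

    loop : ∀ m bs σ → length bs ≤ m → lookup σ r ≡ List.map bit bs ++ rest →
           iterate (exec inp body) σ m ≡ (σ [ r ]≔ rest) [ s ]≔ (List.map bit bs ʳ++ lookup σ s)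
    loop m [] σ _ eq = trans (iterate-fixed (stop σ rest eq noBit) m)
      (sym (trans (cong (λ τ → τ [ s ]≔ lookup σ s) (trans (cong (σ [ r ]≔_) (sym eq)) (Vec.[]≔-lookup σ r))) (Vec.[]≔-lookup σ s)))
    loop (suc m) (b ∷ bs) σ (s≤s le) eq =
      trans (cong (λ τ → iterate (exec inp body) τ m) (go σ b _ eq))
        (trans (loop m bs σ′ le (trans (Vec.lookup∘update′ r≢s (σ [ r ]≔ _) _) (Vec.lookup∘update r σ _)))
          (trans (cong (λ y → (σ′ [ r ]≔ rest) [ s ]≔ (List.map bit bs ʳ++ y)) (Vec.lookup∘update s (σ [ r ]≔ _) _))
            (stacks-ext same)))
      where
      σ′ = (σ [ r ]≔ (List.map bit bs ++ rest)) [ s ]≔ (bit b ∷ lookup σ s)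
      Y = List.map bit bs ʳ++ (bit b ∷ lookup σ s)
      same : ∀ i → lookup ((σ′ [ r ]≔ rest) [ s ]≔ Y) i ≡ lookup ((σ [ r ]≔ rest) [ s ]≔ Y) i
      same i with i Fin.≟ s
      ... | yes refl = trans (Vec.lookup∘update s (σ′ [ r ]≔ rest) Y) (sym (Vec.lookup∘update s (σ [ r ]≔ rest) Y))
      ... | no i≢s = trans (Vec.lookup∘update′ i≢s (σ′ [ r ]≔ rest) Y)
                       (trans (by (i Fin.≟ r)) (sym (Vec.lookup∘update′ i≢s (σ [ r ]≔ rest) Y)))
        where
        by : Dec (i ≡ r) → lookup (σ′ [ r ]≔ rest) i ≡ lookup (σ [ r ]≔ rest) i
        by (yes refl) = trans (Vec.lookup∘update r σ′ rest) (sym (Vec.lookup∘update r σ rest))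
        by (no i≢r) = trans (Vec.lookup∘update′ i≢r σ′ rest)
          (trans (Vec.lookup∘update′ i≢s (σ [ r ]≔ _) _)
            (trans (Vec.lookup∘update′ i≢r σ _) (sym (Vec.lookup∘update′ i≢r σ rest))))

  scanFor-exec : ∀ {k} t xs f (τ : Stacks k) → t nothing ≡ false → length xs ≤ length inp →
                 exec inp (scanFor {d = 0} t) (xs ∷ flag f ∷ τ) ≡ [] ∷ flag (f ∨ any (t ∘ just) xs) ∷ τ
  scanFor-exec {k} t xs f τ none len = loop (length inp) xs f len
    where
    body : Cmd (2 + k) 0
    body = test 0F t (raise 1F) skip ▹ drop 0F
    loop : ∀ m xs f → length xs ≤ m → iterate (exec inp body) (xs ∷ flag f ∷ τ) m ≡ [] ∷ flag (f ∨ any (t ∘ just) xs) ∷ τ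
    loop m [] f _ = trans (iterate-fixed fixed m) (cong (λ b → [] ∷ flag b ∷ τ) (sym (𝔹.∨-identityʳ f)))
      where
      fixed : exec inp body ([] ∷ flag f ∷ τ) ≡ [] ∷ flag f ∷ τ
      fixed rewrite none = refl
    loop (suc m) (x ∷ xs) f (s≤s le) with t (just x)
    ... | true  = trans (loop m xs true le) (cong (λ b → [] ∷ flag b ∷ τ) (sym (𝔹.∨-zeroʳ f)))
    ... | false = loop m xs f le

  module _ {n : ℕ} (n≤N : n ≤ length inp) where

    private
      bits-length : (x : Vec Bool n) → length (toList x) ≤ length inp
      bits-length x = ℕ.≤-trans (ℕ.≤-reflexive (Vec.length-toList x)) n≤N

      reversed-length : (x : Vec Bool n) → length (reverse (toList x)) ≤ length inp
      reversed-length x = ℕ.≤-trans (ℕ.≤-reflexive (List.length-reverse (toList x))) (bits-length x)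

    pour-bits : ∀ {k} {r s : Fin k} → r ≢ s → ∀ (x : Vec Bool n) σ → lookup σ r ≡ bits x ʳ++ [] →
                exec inp (pour {d = 0} r s) σ ≡ (σ [ r ]≔ []) [ s ]≔ (bits x ++ lookup σ s)
    pour-bits {r = r} {s} r≢s x σ eq =
      trans (pour-exec r≢s (reverse (toList x)) [] σ (reversed-length x) (trans eq (reverse-bits (toList x) [])) [])
            (cong ((σ [ r ]≔ []) [ s ]≔_) (double-reverse-bits (toList x) (lookup σ s)))

    uncons-exec : ∀ {k} (x : Vec Bool n) xs y (τ : Stacks k) →
                  exec inp (uncons {d = 0}) ((encodeRow x ++ xs) ∷ y ∷ [] ∷ τ) ≡ xs ∷ bits x ∷ [] ∷ τ
    uncons-exec x xs y τ =
      trans (cong (λ σ → exec inp (pour {d = 0} 2F 1F) (exec inp (drop {d = 1} 0F) σ))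
              (pour-exec {r = 0F} {2F} (λ ()) (toList x) (sep ∷ xs) _ (bits-length x) (List.++-assoc (bits x) (sep ∷ []) xs) sep))
        (trans (pour-bits {r = 2F} {1F} (λ ()) x _ refl)
               (cong (λ y → xs ∷ y ∷ [] ∷ τ) (List.++-identityʳ (bits x))))

    rows-nonempty : ∀ (x : Vec Bool n) xs → is-just (List.head (rows (x ∷ xs))) ≡ true
    rows-nonempty x xs with toList x
    ... | []    = refl
    ... | _ ∷ _ = refl

    -- Turns a loop over rows into a fold: `stacks` lays out the accumulator on the stacks after the
    -- three that the loop needs itself.
    rowLoop-exec : ∀ {k d} {A : Set} (body : Cmd (3 + k) (suc d)) (stacks : A → Stacks k) (f : A → Vec Bool n → A) →
                   (∀ x X a → exec inp body (X ∷ bits x ∷ [] ∷ stacks a) ≡ X ∷ bits x ∷ [] ∷ stacks (f a x)) →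
                   ∀ xs a → length xs ≤ length inp →
                   exec inp (rowLoop body) (rows xs ∷ [] ∷ [] ∷ stacks a) ≡ [] ∷ [] ∷ [] ∷ stacks (foldl f a xs)
    rowLoop-exec {k} {d} body stacks f spec xs a len = loop (length inp) xs a len
      where
      turn : Cmd (3 + k) (suc d)
      turn = test 0F is-just (uncons ▹ body ▹ clear 1F) skip
      once : ∀ x xs a → exec inp turn (rows (x ∷ xs) ∷ [] ∷ [] ∷ stacks a) ≡ rows xs ∷ [] ∷ [] ∷ stacks (f a x)
      once x xs a = trans (cong (λ b → if b then exec inp (uncons ▹ body ▹ clear 1F) σ else σ) (rows-nonempty x xs))
        (trans (cong (λ τ → exec inp (body ▹ clear {d = suc d} 1F) τ) (uncons-exec x (rows xs) [] (stacks a)))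
               (cong (exec inp (clear {d = suc d} 1F)) (spec x (rows xs) a)))
        where
        σ = rows (x ∷ xs) ∷ [] ∷ [] ∷ stacks a
      loop : ∀ m xs a → length xs ≤ m →
             iterate (exec inp turn) (rows xs ∷ [] ∷ [] ∷ stacks a) m ≡ [] ∷ [] ∷ [] ∷ stacks (foldl f a xs)
      loop m [] a _ = iterate-fixed refl m
      loop (suc m) (x ∷ xs) a (s≤s le) = trans (cong (λ σ → iterate (exec inp turn) σ m) (once x xs a)) (loop m xs (f a x) le)

foldl-or : ∀ {A : Set} (p : A → Bool) b xs → foldl (λ b x → b ∨ p x) b xs ≡ b ∨ any p xs
foldl-or p b []       = sym (𝔹.∨-identityʳ b)
foldl-or p b (x ∷ xs) = trans (foldl-or p (b ∨ p x) xs) (𝔹.∨-assoc b (p x) (any p xs))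

-- S ∷ L ∷ A ∷ two copies ∷ four flags ∷ F: raise F if the row S is not
-- constant on L ∩ A or on L ∖ A.

markBody : ∀ {k d} → Cmd (9 + k) d
markBody =
  test 3F isOne
    (test 4F isOne (test 0F isOne (raise 5F) (raise 6F)) (test 0F isOne (raise 7F) (raise 8F)))
    skip
  ▹ drop 0F ▹ drop 3F ▹ drop 4F

both-flags : ∀ {k d} → Fin k → Fin k → Fin k → Cmd k d
both-flags r s t = test r is-just (test s is-just (raise t) skip) skip

opaque
  check : ∀ {k d} → Cmd (10 + k) (suc d)
  check =
    copy 3F 1F ▹ copy 4F 2F ▹ repeat markBody ▹ both-flags 5F 6F 9F ▹ both-flags 7F 8F 9F
    ▹ clear 5F ▹ clear 6F ▹ clear 7F ▹ clear 8F

opaque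
  -- Stacks 0 to 2 belong to the loop over all rows, the other ten to `check`, whose S receives the
  -- current row. F tells whether some row violates uniformity for L and A.
  testAll : ∀ {k d} → Cmd (13 + k) (suc (suc d))
  testAll = input 0F ▹ rowLoop (copy 3F 1F ▹ under 3 check)

opaque
  monoTest : ∀ {k d} → Cmd (13 + k) (suc (suc d))
  monoTest = copy 5F 4F ▹ testAll ▹ clear 5F

hyperedges : ∀ {k d} → Cmd (3 + k) (suc d)
hyperedges = input 0F ▹ uncons ▹ uncons ▹ clear 1F

opaque
  -- A loop over the hyperedges around `testAll`, whose frame begins at stack 4; so its A is stack 9
  -- and its F is stack 16. The result on stack 3 is raised if F stays down for some hyperedge.
  splitTest : ∀ {k d} → Cmd (17 + k) (suc (suc (suc d)))
  splitTest = hyperedges ▹ rowLoop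
    (copy 9F 1F ▹ under 4 testAll ▹ test (10 ↑ʳ 6F) is-just skip (raise 3F) ▹ clear 9F ▹ clear (10 ↑ʳ 6F))

opaque
  -- Stack 3: some hyperedge fails `splitTest`. Stack 4: some hyperedge lies in a single class. The
  -- current hyperedge is put on stack 13, the L of both tests; their results appear on stacks 8 and
  -- 21.
  survey : ∀ {k d} → Cmd (22 + k) (suc (suc (suc (suc d))))
  survey = hyperedges ▹ rowLoop
    (copy (10 ↑ʳ 3F) 1F
    ▹ under 5 splitTest ▹ test 8F is-just skip (raise 3F) ▹ clear 8F
    ▹ under 9 monoTest ▹ test (20 ↑ʳ 1F) is-just skip (raise 4F) ▹ clear (20 ↑ʳ 1F)
    ▹ clear (10 ↑ʳ 3F))

-- Gaussian elimination. S ∷ P ∷ two copies ∷ D ∷ X ∷ Z: add P to S if S has a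
-- one at the position of the first one of P; the result goes to Z, reversed.

leadBody : ∀ {k d} → Cmd (6 + k) d
leadBody =
  test 3F isOne (test 4F is-just skip (raise 4F ▹ test 2F isOne (raise 5F) skip)) skip
  ▹ drop 2F ▹ drop 3F

keepBit : ∀ {k d} → Cmd (7 + k) d
keepBit = test 2F isOne (put 6F (bit true)) (put 6F (bit false))

addBody : ∀ {k d} → Cmd (7 + k) d
addBody =
  test 2F is-just
    (test 5F is-just (test 3F isOne (test 2F isOne (put 6F (bit false)) (put 6F (bit true))) keepBit) keepBit)
    skip
  ▹ drop 2F ▹ drop 3F

opaque
  reduce : ∀ {k d} → Cmd (7 + k) (suc d)
  reduce =
    copy 2F 0F ▹ copy 3F 1F ▹ repeat leadBody
    ▹ copy 2F 0F ▹ copy 3F 1F ▹ repeat addBody ▹ clear 4F ▹ clear 5F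

opaque
  -- The new row is pushed from its end onto the output, so the separator comes first; pouring from
  -- Z undoes the reversal.
  reduceAll : ∀ {k d} → Cmd (11 + k) (suc (suc d))
  reduceAll = rowLoop (copy 4F 1F ▹ under 4 reduce ▹ put 3F sep ▹ pour (10 ↑ʳ 0F) 3F ▹ clear 4F)

opaque
  -- Reduces first the vector on stack 3 and then the rows on stack 0. The frames of `reduce`, from
  -- stack 8, and of `reduceAll`, from stack 4, both have the pivot on stack 9.
  pivotBody : ∀ {k d} → Cmd (15 + k) (suc (suc d))
  pivotBody =
    copy 9F 1F ▹ copy 8F 3F ▹ under 8 reduce ▹ clear 3F ▹ pour (10 ↑ʳ 4F) 3F ▹ clear 8F
    ▹ copy 4F 0F ▹ under 4 reduceAll ▹ copy 0F 7F ▹ clear 7F ▹ clear 9F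

opaque
  eliminate : ∀ {k d} → Cmd (15 + k) (suc (suc (suc d)))
  eliminate = repeat (test 0F is-just (uncons ▹ pivotBody ▹ clear 1F) skip)

meets : ∀ {n} → (Bool → Bool → Bool → Bool) → (l a s : Vec Bool n) → Bool
meets p []       []       []       = false
meets p (x ∷ l) (y ∷ a) (z ∷ s) = p x y z ∨ meets p l a s

-- The subscripts are the values of `a` and `s` at a vertex of `l`.
at₁₁ at₁₀ at₀₁ at₀₀ : Bool → Bool → Bool → Bool
at₁₁ x y z = x ∧ (y ∧ z)
at₁₀ x y z = x ∧ (y ∧ not z)
at₀₁ x y z = x ∧ (not y ∧ z)
at₀₀ x y z = x ∧ (not y ∧ not z)

bad : ∀ {n} → (l a s : Vec Bool n) → Bool
bad l a s = (meets at₁₁ l a s ∧ meets at₁₀ l a s) ∨ (meets at₀₁ l a s ∧ meets at₀₀ l a s)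

-- The entry of `s` at the first one of `p`. For `p = 𝟘` it is `false`, so that a zero pivot changes
-- nothing.
lead : ∀ {n} → (p s : Vec Bool n) → Bool
lead []          []      = false
lead (true  ∷ p) (z ∷ s) = z
lead (false ∷ p) (z ∷ s) = lead p s

nonzero : ∀ {n} → Vec Bool n → Bool
nonzero []      = false
nonzero (b ∷ p) = b ∨ nonzero p

addIf : ∀ {n} → Bool → (p s : Vec Bool n) → Vec Bool n
addIf x = zipWith (λ b c → (x ∧ b) xor c)

reduced : ∀ {n} → (p s : Vec Bool n) → Vec Bool n
reduced p s = addIf (lead p s) p s

reducedAll : ∀ {n} → Vec Bool n → List (Vec Bool n) → List (Vec Bool n)
reducedAll p = foldl (λ out s → reduced p s ∷ out) []

-- Each round uses up one row, so `length ps` rounds suffice; what is left of `v` is 𝟘 exactly if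
-- `v` is in the span.
eliminated : ∀ {n} → ℕ → List (Vec Bool n) → Vec Bool n → Vec Bool n
eliminated (suc k) (p ∷ ps) v = eliminated k (reducedAll p ps) (reduced p v)
eliminated _       _        v = v

-- Execution of the uniformity tests

module Specification {n : ℕ} (w₁ w₂ : Vec Bool n) (H : List (Vec Bool n))
                     (inp : List Symbol) (inp≡ : inp ≡ rows (w₁ ∷ w₂ ∷ H)) where

  private
    N = length inp

  all : List (Vec Bool n)
  all = w₁ ∷ w₂ ∷ H

  run : ∀ {k d} → Cmd k d → Stacks k → Stacks k
  run = exec inp

  rows-length : ∀ (xs : List (Vec Bool n)) → length xs ≤ length (rows xs)
  rows-length []       = z≤n
  rows-length (x ∷ xs) = ℕ.≤-trans (s≤s (rows-length xs)) (ℕ.≤-trans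
    (ℕ.+-monoˡ-≤ (length (rows xs)) (ℕ.≤-trans (ℕ.m≤n+m 1 (length (bits x))) (ℕ.≤-reflexive (sym (List.length-++ (bits x))))))
    (ℕ.≤-reflexive (sym (List.length-++ (encodeRow x)))))

  n≤N : n ≤ N
  n≤N = ℕ.≤-trans (ℕ.≤-reflexive (sym (trans (List.length-map bit (toList w₁)) (Vec.length-toList w₁))))
    (ℕ.≤-trans (ℕ.≤-trans (ℕ.m≤m+n (length (bits w₁)) 1) (ℕ.≤-reflexive (sym (List.length-++ (bits w₁)))))
      (ℕ.≤-trans (ℕ.m≤m+n (length (encodeRow w₁)) _) (ℕ.≤-reflexive (sym (trans (cong length inp≡) (List.length-++ (encodeRow w₁)))))))

  all≤N : length all ≤ N
  all≤N = ℕ.≤-trans (rows-length all) (ℕ.≤-reflexive (cong length (sym inp≡)))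

  H≤N : length H ≤ N
  H≤N = ℕ.≤-trans (ℕ.≤-trans (ℕ.n≤1+n _) (ℕ.n≤1+n _)) all≤N

  flag-∨-true : ∀ b → flag true ≡ flag (b ∨ true)
  flag-∨-true b = cong flag (sym (𝔹.∨-zeroʳ b))

  flag-∨-false : ∀ b → flag b ≡ flag (b ∨ false)
  flag-∨-false b = cong flag (sym (𝔹.∨-identityʳ b))

  module _ {k : ℕ} (τ : Stacks k) where

    marks-exec : ∀ {m} (l a s : Vec Bool m) {L A q₁ q₂ q₃ q₄} j → m ≤ j →
      iterate (run (markBody {d = 0})) (bits s ∷ L ∷ A ∷ bits l ∷ bits a ∷ flag q₁ ∷ flag q₂ ∷ flag q₃ ∷ flag q₄ ∷ τ) j ≡
      [] ∷ L ∷ A ∷ [] ∷ [] ∷ flag (q₁ ∨ meets at₁₁ l a s) ∷ flag (q₂ ∨ meets at₁₀ l a s) ∷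
      flag (q₃ ∨ meets at₀₁ l a s) ∷ flag (q₄ ∨ meets at₀₀ l a s) ∷ τ
    marks-exec [] [] [] {q₁ = q₁} {q₂} {q₃} {q₄} j _
      rewrite 𝔹.∨-identityʳ q₁ | 𝔹.∨-identityʳ q₂ | 𝔹.∨-identityʳ q₃ | 𝔹.∨-identityʳ q₄ = iterate-fixed refl j
    marks-exec (x ∷ l) (y ∷ a) (z ∷ s) {L} {A} {q₁} {q₂} {q₃} {q₄} (suc j) (s≤s le)
      rewrite sym (𝔹.∨-assoc q₁ (at₁₁ x y z) (meets at₁₁ l a s)) | sym (𝔹.∨-assoc q₂ (at₁₀ x y z) (meets at₁₀ l a s))
            | sym (𝔹.∨-assoc q₃ (at₀₁ x y z) (meets at₀₁ l a s)) | sym (𝔹.∨-assoc q₄ (at₀₀ x y z) (meets at₀₀ l a s)) =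
      trans (cong (λ σ → iterate (run (markBody {d = 0})) σ j) (once x y z)) (marks-exec l a s j le)
      where
      once : ∀ x y z → run (markBody {d = 0}) (bits (z ∷ s) ∷ L ∷ A ∷ bits (x ∷ l) ∷ bits (y ∷ a) ∷ flag q₁ ∷ flag q₂ ∷ flag q₃ ∷ flag q₄ ∷ τ) ≡
        bits s ∷ L ∷ A ∷ bits l ∷ bits a ∷ flag (q₁ ∨ at₁₁ x y z) ∷ flag (q₂ ∨ at₁₀ x y z) ∷ flag (q₃ ∨ at₀₁ x y z) ∷ flag (q₄ ∨ at₀₀ x y z) ∷ τ
      once true  true  true  rewrite 𝔹.∨-zeroʳ q₁ | 𝔹.∨-identityʳ q₂ | 𝔹.∨-identityʳ q₃ | 𝔹.∨-identityʳ q₄ = refl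
      once true  true  false rewrite 𝔹.∨-identityʳ q₁ | 𝔹.∨-zeroʳ q₂ | 𝔹.∨-identityʳ q₃ | 𝔹.∨-identityʳ q₄ = refl
      once true  false true  rewrite 𝔹.∨-identityʳ q₁ | 𝔹.∨-identityʳ q₂ | 𝔹.∨-zeroʳ q₃ | 𝔹.∨-identityʳ q₄ = refl
      once true  false false rewrite 𝔹.∨-identityʳ q₁ | 𝔹.∨-identityʳ q₂ | 𝔹.∨-identityʳ q₃ | 𝔹.∨-zeroʳ q₄ = refl
      once false _     _     rewrite 𝔹.∨-identityʳ q₁ | 𝔹.∨-identityʳ q₂ | 𝔹.∨-identityʳ q₃ | 𝔹.∨-identityʳ q₄ = refl

    flags₁ : ∀ {x₀ x₁ x₂ x₃ x₄ x₇ x₈} p q f →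
      run (both-flags {d = 0} 5F 6F 9F) (x₀ ∷ x₁ ∷ x₂ ∷ x₃ ∷ x₄ ∷ flag p ∷ flag q ∷ x₇ ∷ x₈ ∷ flag f ∷ τ) ≡
      x₀ ∷ x₁ ∷ x₂ ∷ x₃ ∷ x₄ ∷ flag p ∷ flag q ∷ x₇ ∷ x₈ ∷ flag (f ∨ (p ∧ q)) ∷ τ
    flags₁ true  true  f rewrite 𝔹.∨-zeroʳ f = refl
    flags₁ true  false f rewrite 𝔹.∨-identityʳ f = refl
    flags₁ false q     f rewrite 𝔹.∨-identityʳ f = refl

    flags₂ : ∀ {x₀ x₁ x₂ x₃ x₄ x₅ x₆} p q f →
      run (both-flags {d = 0} 7F 8F 9F) (x₀ ∷ x₁ ∷ x₂ ∷ x₃ ∷ x₄ ∷ x₅ ∷ x₆ ∷ flag p ∷ flag q ∷ flag f ∷ τ) ≡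
      x₀ ∷ x₁ ∷ x₂ ∷ x₃ ∷ x₄ ∷ x₅ ∷ x₆ ∷ flag p ∷ flag q ∷ flag (f ∨ (p ∧ q)) ∷ τ
    flags₂ true  true  f rewrite 𝔹.∨-zeroʳ f = refl
    flags₂ true  false f rewrite 𝔹.∨-identityʳ f = refl
    flags₂ false q     f rewrite 𝔹.∨-identityʳ f = refl

  module _ {k : ℕ} (τ : Stacks k) (l a : Vec Bool n) where

    checkFrame : List Symbol → Bool → Stacks (10 + k)
    checkFrame s f = s ∷ bits l ∷ bits a ∷ [] ∷ [] ∷ [] ∷ [] ∷ [] ∷ [] ∷ flag f ∷ τ

    opaque
      unfolding check

      check-exec : ∀ {d} s f → run (check {d = d}) (checkFrame (bits s) f) ≡ checkFrame [] (f ∨ bad l a s)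
      check-exec {d} s f =
        trans (cong (run after-marks) (marks-exec (flag f ∷ τ) l a s {q₁ = false} {false} {false} {false} N n≤N))
          (trans (cong (run after-first) (flags₁ τ m₁₁ m₁₀ f))
            (trans (cong (run after-second) (flags₂ τ m₀₁ m₀₀ (f ∨ (m₁₁ ∧ m₁₀))))
              (cong (λ b → checkFrame [] b) (𝔹.∨-assoc f (m₁₁ ∧ m₁₀) (m₀₁ ∧ m₀₀)))))
        where
        m₁₁ : Bool
        m₁₁ = meets at₁₁ l a s
        m₁₀ : Bool
        m₁₀ = meets at₁₀ l a s
        m₀₁ : Bool
        m₀₁ = meets at₀₁ l a s
        m₀₀ : Bool
        m₀₀ = meets at₀₀ l a s
        after-second after-first after-marks : Cmd (10 + k) (suc d)
        after-second = clear 5F ▹ clear 6F ▹ clear 7F ▹ clear 8F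
        after-first = both-flags 7F 8F 9F ▹ after-second
        after-marks = both-flags 5F 6F 9F ▹ after-first

    testFrame : Bool → Stacks (13 + k)
    testFrame f = [] ∷ [] ∷ [] ∷ checkFrame [] f

    opaque
      unfolding testAll

      testAll-exec : ∀ {d} f → run (testAll {d = d}) (testFrame f) ≡ testFrame (f ∨ any (bad l a) all)
      testAll-exec {d} f = trans
        (cong (λ X → run (rowLoop each) (X ∷ [] ∷ [] ∷ checkFrame [] f)) inp≡)
        (trans (rowLoop-exec {inp} n≤N each (checkFrame []) (λ b s → b ∨ bad l a s)
          (λ s X b → trans (exec-under {inp} (X ∷ bits s ∷ [] ∷ []) (check {d = d}) (checkFrame (bits s) b))
                           (cong (λ σ → X ∷ bits s ∷ [] ∷ σ) (check-exec s b)))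
          all f all≤N)
        (cong testFrame (foldl-or (bad l a) f all)))
        where
        each : Cmd (13 + k) (suc d)
        each = copy 3F 1F ▹ under 3 check

    monoFrame : Bool → Stacks (13 + k)
    monoFrame f = [] ∷ [] ∷ [] ∷ [] ∷ bits l ∷ [] ∷ [] ∷ [] ∷ [] ∷ [] ∷ [] ∷ [] ∷ flag f ∷ τ

  opaque
    unfolding monoTest

    monoTest-exec : ∀ {k d} (τ : Stacks k) l f →
      run (monoTest {d = d}) (monoFrame τ l l f) ≡ monoFrame τ l l (f ∨ any (bad l l) all)
    monoTest-exec {k} {d} τ l f = cong (run {13 + k} {d} (clear 5F)) (testAll-exec τ l l {d} f)

  hyperedges-exec : ∀ {k} x y (τ : Stacks k) → run (hyperedges {d = 0}) (x ∷ y ∷ [] ∷ τ) ≡ rows H ∷ [] ∷ [] ∷ τ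
  hyperedges-exec x y τ =
    trans (cong (λ X → run (uncons {d = 0} ▹ uncons ▹ clear 1F) (X ∷ y ∷ [] ∷ τ)) inp≡)
      (trans (cong (run (uncons {d = 0} ▹ clear 1F)) (uncons-exec {inp} n≤N w₁ (rows (w₂ ∷ H)) y τ))
             (cong (run {d = 0} (clear 1F)) (uncons-exec {inp} n≤N w₂ (rows H) (bits w₁) τ)))

  split : Vec Bool n → Bool
  split l = any (λ a → not (any (bad l a) all)) H

  mono : Vec Bool n → Bool
  mono l = not (any (bad l l) all)

  module _ {k : ℕ} (τ : Stacks k) where

    splitFrame : Vec Bool n → Bool → Stacks (17 + k)
    splitFrame l e = [] ∷ [] ∷ [] ∷ flag e ∷ monoFrame τ l l false

    opaque
      unfolding splitTest

      splitTest-exec : ∀ {d} l e → run (splitTest {d = d}) (splitFrame l e) ≡ splitFrame l (e ∨ split l)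
      splitTest-exec {d} l e = trans
        (cong (run (rowLoop each)) (hyperedges-exec [] [] (flag e ∷ monoFrame τ l l false)))
        (trans (rowLoop-exec {inp} n≤N each (λ e → flag e ∷ monoFrame τ l l false)
                 (λ e a → e ∨ not (any (bad l a) all)) once H e H≤N)
               (cong (splitFrame l) (foldl-or (λ a → not (any (bad l a) all)) e H)))
        where
        rest each : Cmd (17 + k) (suc (suc d))
        rest = test (10 ↑ʳ 6F) is-just skip (raise 3F) ▹ clear 9F ▹ clear (10 ↑ʳ 6F)
        each = copy 9F 1F ▹ under 4 testAll ▹ rest
        finish : ∀ X Y e a b → run rest (X ∷ Y ∷ [] ∷ flag e ∷ testFrame τ l a b) ≡
                 X ∷ Y ∷ [] ∷ flag (e ∨ not b) ∷ monoFrame τ l l false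
        finish X Y e a true  = cong (λ f → X ∷ Y ∷ [] ∷ f ∷ monoFrame τ l l false) (flag-∨-false e)
        finish X Y e a false = cong (λ f → X ∷ Y ∷ [] ∷ f ∷ monoFrame τ l l false) (flag-∨-true e)
        once : ∀ a X e → run each (X ∷ bits a ∷ [] ∷ flag e ∷ monoFrame τ l l false) ≡
               X ∷ bits a ∷ [] ∷ flag (e ∨ not (any (bad l a) all)) ∷ monoFrame τ l l false
        once a X e =
          trans (cong (run rest) (trans (exec-under {inp} (X ∷ bits a ∷ [] ∷ flag e ∷ []) (testAll {d = d}) (testFrame τ l a false))
                                        (cong (λ σ → X ∷ bits a ∷ [] ∷ flag e ∷ σ) (testAll-exec τ l a {d} false))))
                (finish X (bits a) e a (any (bad l a) all))

    surveyFrame : Bool × Bool → Stacks (19 + k)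
    surveyFrame (g , m) =
      flag g ∷ flag m ∷ [] ∷ [] ∷ [] ∷ [] ∷ [] ∷ [] ∷ [] ∷ [] ∷ [] ∷ [] ∷ [] ∷ [] ∷ [] ∷ [] ∷ [] ∷ [] ∷ [] ∷ τ

    opaque
      unfolding survey

      survey-exec : ∀ g m → run (survey {d = 0}) ([] ∷ [] ∷ [] ∷ surveyFrame (g , m)) ≡
                    [] ∷ [] ∷ [] ∷ surveyFrame (g ∨ any (not ∘ split) H , m ∨ any mono H)
      survey-exec g m = trans
        (cong (run (rowLoop each)) (hyperedges-exec [] [] (surveyFrame (g , m))))
        (trans (rowLoop-exec {inp} n≤N each surveyFrame turn once H (g , m) H≤N)
               (cong (λ a → [] ∷ [] ∷ [] ∷ surveyFrame a) (fold g m H)))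
        where
        turn : Bool × Bool → Vec Bool n → Bool × Bool
        turn (g , m) l = g ∨ not (split l) , m ∨ mono l
        fold : ∀ g m xs → foldl turn (g , m) xs ≡ (g ∨ any (not ∘ split) xs , m ∨ any mono xs)
        fold g m [] = cong₂ _,_ (sym (𝔹.∨-identityʳ g)) (sym (𝔹.∨-identityʳ m))
        fold g m (x ∷ xs) = trans (fold (g ∨ not (split x)) (m ∨ mono x) xs)
          (cong₂ _,_ (𝔹.∨-assoc g (not (split x)) _) (𝔹.∨-assoc m (mono x) _))
        rest₂ part₂ rest₁ each : Cmd (22 + k) 3
        rest₂ = test (20 ↑ʳ 1F) is-just skip (raise 4F) ▹ clear (20 ↑ʳ 1F) ▹ clear (10 ↑ʳ 3F)
        part₂ = under 9 monoTest ▹ rest₂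
        rest₁ = test 8F is-just skip (raise 3F) ▹ clear 8F ▹ part₂
        each = copy (10 ↑ʳ 3F) 1F ▹ under 5 splitTest ▹
               test 8F is-just skip (raise 3F) ▹ clear 8F ▹
               under 9 monoTest ▹ test (20 ↑ʳ 1F) is-just skip (raise 4F) ▹ clear (20 ↑ʳ 1F) ▹ clear (10 ↑ʳ 3F)
        split-done : ∀ X Y g m l b → run rest₁ (X ∷ Y ∷ [] ∷ flag g ∷ flag m ∷ splitFrame l b) ≡
                     run part₂ (X ∷ Y ∷ [] ∷ flag (g ∨ not b) ∷ flag m ∷ splitFrame l false)
        split-done X Y g m l true  = cong (λ f → run part₂ (X ∷ Y ∷ [] ∷ f ∷ flag m ∷ splitFrame l false)) (flag-∨-false g)
        split-done X Y g m l false = cong (λ f → run part₂ (X ∷ Y ∷ [] ∷ f ∷ flag m ∷ splitFrame l false)) (flag-∨-true g)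
        mono-done : ∀ X Y g m l b →
          run rest₂ (X ∷ Y ∷ [] ∷ flag g ∷ flag m ∷ [] ∷ [] ∷ [] ∷ [] ∷ monoFrame τ l l b) ≡
          X ∷ Y ∷ [] ∷ surveyFrame (g , m ∨ not b)
        mono-done X Y g m l true  = cong (λ f → X ∷ Y ∷ [] ∷ flag g ∷ f ∷ _) (flag-∨-false m)
        mono-done X Y g m l false = cong (λ f → X ∷ Y ∷ [] ∷ flag g ∷ f ∷ _) (flag-∨-true m)
        once : ∀ l X a → run each (X ∷ bits l ∷ [] ∷ surveyFrame a) ≡ X ∷ bits l ∷ [] ∷ surveyFrame (turn a l)
        once l X (g , m) =
          trans (cong (run rest₁) (trans (exec-under {inp} (X ∷ bits l ∷ [] ∷ flag g ∷ flag m ∷ []) (splitTest {d = 0}) (splitFrame l false))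
                                         (cong (λ σ → X ∷ bits l ∷ [] ∷ flag g ∷ flag m ∷ σ) (splitTest-exec l false))))
            (trans (split-done X (bits l) g m l (split l))
              (trans (cong (run rest₂) (trans
                        (exec-under {inp} (X ∷ bits l ∷ [] ∷ flag g′ ∷ flag m ∷ [] ∷ [] ∷ [] ∷ [] ∷ []) (monoTest {d = 1}) (monoFrame τ l l false))
                        (cong (λ σ → X ∷ bits l ∷ [] ∷ flag g′ ∷ flag m ∷ [] ∷ [] ∷ [] ∷ [] ∷ σ) (monoTest-exec {d = 1} τ l false))))
                (mono-done X (bits l) g′ m l (any (bad l l) all))))
          where
          g′ : Bool
          g′ = g ∨ not (split l)

-- The deciding program

opaque
  secondRow : ∀ {k d} → Cmd (3 + k) (suc d)
  secondRow = input 0F ▹ uncons ▹ uncons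

  scan : ∀ {k d} → (Γ → Bool) → Cmd (2 + k) (suc d)
  scan = scanFor

  addRow : ∀ {k d} → Cmd (7 + k) (suc d)
  addRow = repeat addBody

  nextRow : ∀ {k d} → Cmd (3 + k) (suc d)
  nextRow = uncons

opaque
  examine : ∀ {k} → Cmd (21 + k) 4
  examine =
    input 6F ▹ under 6 nextRow
    ▹ copy (10 ↑ʳ 7F) 7F ▹ copy 4F 7F ▹ under 4 (scan isZero)
    ▹ under 6 nextRow
    -- Flag 5 still holds the result for `w₁`, so this scan adds the one for the hyperedges to it.
    ▹ copy 4F 6F ▹ under 4 (scan isZero) ▹ copy 1F 5F ▹ clear 5F
    ▹ copy (10 ↑ʳ 6F) 7F ▹ copy 4F 7F ▹ under 4 (scan isZero) ▹ copy 2F 5F ▹ clear 5F ▹ clear 7F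

opaque
  -- With X raised by hand, `addRow` computes `w₁ ⊕ w₂`, as `examine` has left the two rows on the
  -- copy stacks 16 and 17. Elimination then tests this vector.
  solve : ∀ {k} → Cmd (21 + k) 4
  solve =
    raise (10 ↑ʳ 9F) ▹ under 14 addRow ▹ clear (10 ↑ʳ 9F) ▹ pour (20 ↑ʳ 0F) 9F
    ▹ under 6 eliminate ▹ copy 4F 9F ▹ under 4 (scan isOne) ▹ copy 3F 5F ▹ clear 5F

opaque
  explore : ∀ {k} → Cmd (22 + k) 4
  explore = survey ▹ secondRow ▹ copy (10 ↑ʳ 3F) 1F ▹ under 5 splitTest ▹ under 9 monoTest

-- The results are the flags 1, 2, 3 of examine and solve, followed by the
-- flags G, M, E, F of explore.
opaque
  answer : Cmd 43 4
  answer =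
    test 1F is-just
      (test 3F is-just skip
        (test (21 ↑ʳ 3F) is-just
          (test 2F is-just (raise 0F) skip)
          (test (21 ↑ʳ 8F) is-just
            (test (40 ↑ʳ 2F) is-just (test (21 ↑ʳ 4F) is-just skip (raise 0F)) (raise 0F))
            skip)))
      (raise 0F)

decide : Cmd 43 4
decide = examine ▹ solve ▹ under 21 explore ▹ answer

reducedAll-length : ∀ {n} (p : Vec Bool n) ps → length (reducedAll p ps) ≡ length ps
reducedAll-length p ps = trans (go [] ps) (ℕ.+-identityʳ (length ps))
  where
  go : ∀ out ps → length (foldl (λ out s → reduced p s ∷ out) out ps) ≡ length ps + length out
  go out []       = refl
  go out (s ∷ ps) = trans (go (reduced p s ∷ out) ps) (ℕ.+-suc (length ps) (length out))

-- Execution of the elimination and of the deciding program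

module Results {n : ℕ} (w₁ w₂ : Vec Bool n) (H : List (Vec Bool n))
               (inp : List Symbol) (inp≡ : inp ≡ rows (w₁ ∷ w₂ ∷ H)) where

  open Specification w₁ w₂ H inp inp≡

  private
    N = length inp

  lead-done : ∀ {k m} (p s : Vec Bool m) {S P} x (τ : Stacks k) j → m ≤ j →
    iterate (run (leadBody {d = 0})) (S ∷ P ∷ bits s ∷ bits p ∷ flag true ∷ flag x ∷ τ) j ≡
    S ∷ P ∷ [] ∷ [] ∷ flag true ∷ flag x ∷ τ
  lead-done []          []      x τ j _ = iterate-fixed refl j
  lead-done (true  ∷ p) (_ ∷ s) x τ (suc j) (s≤s le) = lead-done p s x τ j le
  lead-done (false ∷ p) (_ ∷ s) x τ (suc j) (s≤s le) = lead-done p s x τ j le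

  lead-exec : ∀ {k m} (p s : Vec Bool m) {S P} (τ : Stacks k) j → m ≤ j →
    iterate (run (leadBody {d = 0})) (S ∷ P ∷ bits s ∷ bits p ∷ [] ∷ [] ∷ τ) j ≡
    S ∷ P ∷ [] ∷ [] ∷ flag (nonzero p) ∷ flag (lead p s) ∷ τ
  lead-exec []          []          τ j _ = iterate-fixed refl j
  lead-exec (true  ∷ p) (true  ∷ s) τ (suc j) (s≤s le) = lead-done p s true  τ j le
  lead-exec (true  ∷ p) (false ∷ s) τ (suc j) (s≤s le) = lead-done p s false τ j le
  lead-exec (false ∷ p) (_ ∷ s)     τ (suc j) (s≤s le) = lead-exec p s τ j le

  add-loop : ∀ {k m} (p s : Vec Bool m) {S P D} x Z (τ : Stacks k) j → m ≤ j →
    iterate (run (addBody {d = 0})) (S ∷ P ∷ bits s ∷ bits p ∷ D ∷ flag x ∷ Z ∷ τ) j ≡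
    S ∷ P ∷ [] ∷ [] ∷ D ∷ flag x ∷ (bits (addIf x p s) ʳ++ Z) ∷ τ
  add-loop []          []          x     Z τ j _ = iterate-fixed refl j
  add-loop (true  ∷ p) (true  ∷ s) true  Z τ (suc j) (s≤s le) = add-loop p s true  (bit false ∷ Z) τ j le
  add-loop (true  ∷ p) (false ∷ s) true  Z τ (suc j) (s≤s le) = add-loop p s true  (bit true  ∷ Z) τ j le
  add-loop (false ∷ p) (true  ∷ s) true  Z τ (suc j) (s≤s le) = add-loop p s true  (bit true  ∷ Z) τ j le
  add-loop (false ∷ p) (false ∷ s) true  Z τ (suc j) (s≤s le) = add-loop p s true  (bit false ∷ Z) τ j le
  add-loop (_     ∷ p) (true  ∷ s) false Z τ (suc j) (s≤s le) = add-loop p s false (bit true  ∷ Z) τ j le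
  add-loop (_     ∷ p) (false ∷ s) false Z τ (suc j) (s≤s le) = add-loop p s false (bit false ∷ Z) τ j le

  opaque
    unfolding addRow

    addRow-exec : ∀ {k d} (p s : Vec Bool n) {S P D} x (τ : Stacks k) →
      run (addRow {d = d}) (S ∷ P ∷ bits s ∷ bits p ∷ D ∷ flag x ∷ [] ∷ τ) ≡
      S ∷ P ∷ [] ∷ [] ∷ D ∷ flag x ∷ (bits (addIf x p s) ʳ++ []) ∷ τ
    addRow-exec p s x τ = add-loop p s x [] τ N n≤N

  opaque
    unfolding secondRow

    secondRow-exec : ∀ {k d} (τ : Stacks k) → run (secondRow {d = d}) ([] ∷ [] ∷ [] ∷ τ) ≡ rows H ∷ bits w₂ ∷ [] ∷ τ
    secondRow-exec τ =
      trans (cong (λ X → run (uncons {d = 0} ▹ uncons) (X ∷ [] ∷ [] ∷ τ)) inp≡)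
        (trans (cong (run (uncons {d = 0})) (uncons-exec {inp} n≤N w₁ (rows (w₂ ∷ H)) [] τ)) (uncons-exec {inp} n≤N w₂ (rows H) (bits w₁) τ))

  opaque
    unfolding nextRow

    nextRow-exec : ∀ {k d} (x : Vec Bool n) xs y (τ : Stacks k) →
                   run (nextRow {d = d}) ((encodeRow x ++ xs) ∷ y ∷ [] ∷ τ) ≡ xs ∷ bits x ∷ [] ∷ τ
    nextRow-exec = uncons-exec {inp} n≤N

  opaque
    unfolding scan

    scan-exec : ∀ {k d} t xs f (τ : Stacks k) → t nothing ≡ false → length xs ≤ N →
                run (scan {d = d} t) (xs ∷ flag f ∷ τ) ≡ [] ∷ flag (f ∨ any (t ∘ just) xs) ∷ τ
    scan-exec = scanFor-exec {inp}

  opaque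
    unfolding reduce

    reduce-exec : ∀ {k d} (p s : Vec Bool n) (τ : Stacks k) →
      run (reduce {d = d}) (bits s ∷ bits p ∷ [] ∷ [] ∷ [] ∷ [] ∷ [] ∷ τ) ≡
      bits s ∷ bits p ∷ [] ∷ [] ∷ [] ∷ [] ∷ (bits (reduced p s) ʳ++ []) ∷ τ
    reduce-exec {k} {d} p s τ =
      trans (cong (run rest) (lead-exec p s ([] ∷ τ) N n≤N))
            (cong (run cleanup) (add-loop p s (lead p s) [] τ N n≤N))
      where
      cleanup rest : Cmd (7 + k) (suc d)
      cleanup = clear 4F ▹ clear 5F
      rest = copy 2F 0F ▹ copy 3F 1F ▹ repeat addBody ▹ cleanup

  opaque
    unfolding reduceAll

    reduceAll-exec : ∀ {k d} (p : Vec Bool n) ps (τ : Stacks k) → length ps ≤ N →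
      run (reduceAll {d = d}) (rows ps ∷ [] ∷ [] ∷ [] ∷ [] ∷ bits p ∷ [] ∷ [] ∷ [] ∷ [] ∷ [] ∷ τ) ≡
      [] ∷ [] ∷ [] ∷ rows (reducedAll p ps) ∷ [] ∷ bits p ∷ [] ∷ [] ∷ [] ∷ [] ∷ [] ∷ τ
    reduceAll-exec {k} {d} p ps τ le = rowLoop-exec {inp} n≤N each frame (λ out s → reduced p s ∷ out) once ps [] le
      where
      frame : List (Vec Bool n) → Stacks (8 + k)
      frame out = rows out ∷ [] ∷ bits p ∷ [] ∷ [] ∷ [] ∷ [] ∷ [] ∷ τ
      rest each : Cmd (11 + k) (suc d)
      rest = put 3F sep ▹ pour (10 ↑ʳ 0F) 3F ▹ clear 4F
      each = copy 4F 1F ▹ under 4 reduce ▹ rest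
      once : ∀ s X out → run each (X ∷ bits s ∷ [] ∷ frame out) ≡ X ∷ bits s ∷ [] ∷ frame (reduced p s ∷ out)
      once s X out =
        trans (cong (run rest) (trans (exec-under {inp} (X ∷ bits s ∷ [] ∷ rows out ∷ []) (reduce {d = d}) _)
                                      (cong (λ σ → X ∷ bits s ∷ [] ∷ rows out ∷ σ) (reduce-exec {d = d} p s τ))))
          (trans (cong (run {d = 1} (clear 4F)) (pour-bits {inp} n≤N {r = 10 ↑ʳ 0F} {3F} (λ ()) (reduced p s) _ refl))
                 (cong (λ O → X ∷ bits s ∷ [] ∷ O ∷ [] ∷ bits p ∷ [] ∷ [] ∷ [] ∷ [] ∷ [] ∷ τ)
                   (sym (List.++-assoc (bits (reduced p s)) (sep ∷ []) (rows out)))))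

  module _ {k : ℕ} (τ : Stacks k) where

    pivotFrame : List Symbol → List Symbol → Vec Bool n → Stacks (15 + k)
    pivotFrame B Y v =
      B ∷ Y ∷ [] ∷ bits v ∷ [] ∷ [] ∷ [] ∷ [] ∷ [] ∷ [] ∷ [] ∷ [] ∷ [] ∷ [] ∷ [] ∷ τ

    opaque
      unfolding pivotBody

      pivot-exec : ∀ {d} p ps v → length ps ≤ N →
        run (pivotBody {d = d}) (pivotFrame (rows ps) (bits p) v) ≡ pivotFrame (rows (reducedAll p ps)) (bits p) (reduced p v)
      pivot-exec {d} p ps v le =
        trans (cong (run rest₁) (trans
                (exec-under {inp} (B ∷ bits p ∷ [] ∷ bits v ∷ [] ∷ [] ∷ [] ∷ [] ∷ []) (reduce {d = suc d}) _)
                (cong (λ σ → B ∷ bits p ∷ [] ∷ bits v ∷ [] ∷ [] ∷ [] ∷ [] ∷ σ) (reduce-exec {d = suc d} p v τ))))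
          (trans (cong (run rest₂) (trans
                   (pour-bits {inp} n≤N {r = 10 ↑ʳ 4F} {3F} (λ ()) (reduced p v)
                     (B ∷ bits p ∷ [] ∷ [] ∷ [] ∷ [] ∷ [] ∷ [] ∷ bits v ∷ bits p ∷ [] ∷ [] ∷ [] ∷ [] ∷ (bits (reduced p v) ʳ++ []) ∷ τ) refl)
                   (cong (λ V → B ∷ bits p ∷ [] ∷ V ∷ [] ∷ [] ∷ [] ∷ [] ∷ bits v ∷ bits p ∷ [] ∷ [] ∷ [] ∷ [] ∷ [] ∷ τ)
                     (List.++-identityʳ (bits (reduced p v))))))
            (cong (run rest₃) (trans
              (exec-under {inp} (B ∷ bits p ∷ [] ∷ bits (reduced p v) ∷ []) (reduceAll {d = d}) _)
              (cong (λ σ → B ∷ bits p ∷ [] ∷ bits (reduced p v) ∷ σ) (reduceAll-exec {d = d} p ps τ le)))))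
        where
        B : List Symbol
        B = rows ps
        rest₃ rest₂ rest₁ : Cmd (15 + k) (suc (suc d))
        rest₃ = copy 0F 7F ▹ clear 7F ▹ clear 9F
        rest₂ = clear 8F ▹ copy 4F 0F ▹ under 4 reduceAll ▹ rest₃
        rest₁ = clear 3F ▹ pour (10 ↑ʳ 4F) 3F ▹ rest₂

    opaque
      unfolding eliminate

      eliminate-exec : ∀ {d} v → run (eliminate {d = d}) (pivotFrame (rows H) [] v) ≡ pivotFrame [] [] (eliminated N H v)
      eliminate-exec {d} v = loop N H v H≤N H≤N
        where
        turn : Cmd (15 + k) (suc (suc d))
        turn = test 0F is-just (uncons ▹ pivotBody ▹ clear 1F) skip
        once : ∀ p ps v → length ps ≤ N →
               run turn (pivotFrame (rows (p ∷ ps)) [] v) ≡ pivotFrame (rows (reducedAll p ps)) [] (reduced p v)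
        once p ps v le =
          trans (cong (λ b → if b then run (uncons {d = suc d} ▹ pivotBody ▹ clear 1F) (pivotFrame (rows (p ∷ ps)) [] v)
                                  else pivotFrame (rows (p ∷ ps)) [] v) (rows-nonempty {inp} n≤N p ps))
            (trans (cong (run (pivotBody {d = d} ▹ clear 1F)) (uncons-exec {inp} n≤N p (rows ps) [] _))
                   (cong (run {d = 2} (clear 1F)) (pivot-exec {d} p ps v le)))
        loop : ∀ j ps v → length ps ≤ j → length ps ≤ N →
               iterate (run turn) (pivotFrame (rows ps) [] v) j ≡ pivotFrame [] [] (eliminated j ps v)
        loop zero    []       v _        _   = refl
        loop (suc j) []       v _        _   = iterate-fixed refl j
        loop (suc j) (p ∷ ps) v (s≤s le) le′ =
          trans (cong (λ σ → iterate (run turn) σ j) (once p ps v (ℕ.≤-trans (ℕ.n≤1+n _) le′)))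
            (loop j (reducedAll p ps) (reduced p v) (ℕ.≤-trans (ℕ.≤-reflexive (reducedAll-length p ps)) le)
              (ℕ.≤-trans (ℕ.≤-reflexive (reducedAll-length p ps)) (ℕ.≤-trans (ℕ.n≤1+n _) le′)))

  within : ∀ {k m d} (τ : Stacks m) {c : Cmd k d} {σ σ′} → run c σ ≡ σ′ → run (under m c) (τ Vec.++ σ) ≡ τ Vec.++ σ′
  within τ {c} {σ} eq = trans (exec-under {inp} τ c σ) (cong (τ Vec.++_) eq)

  zeroIn : List Symbol → Bool
  zeroIn = any (isZero ∘ just)

  gap₁ gap₂ outside mixes looped split₂ crowded : Bool
  gap₁ = zeroIn (bits w₁) ∨ zeroIn (rows H)
  gap₂ = zeroIn (bits w₂)
  outside = any (isOne ∘ just) (bits (eliminated N H (addIf true w₁ w₂)))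
  mixes = any (not ∘ split) H
  looped = any mono H
  split₂ = split w₂
  crowded = any (bad w₂ w₂) all

  bits≤N : ∀ (x : Vec Bool n) → length (bits x) ≤ N
  bits≤N x = ℕ.≤-trans (ℕ.≤-reflexive (trans (List.length-map bit (toList x)) (Vec.length-toList x))) n≤N

  rows≤N : length (rows H) ≤ N
  rows≤N = ℕ.≤-trans (ℕ.m≤n+m (length (rows H)) (length (encodeRow w₂)))
    (ℕ.≤-trans (ℕ.≤-reflexive (sym (List.length-++ (encodeRow w₂))))
      (ℕ.≤-trans (ℕ.m≤n+m (length (rows (w₂ ∷ H))) (length (encodeRow w₁)))
        (ℕ.≤-reflexive (sym (trans (cong length inp≡) (List.length-++ (encodeRow w₁)))))))

  module _ {k : ℕ} (τ : Stacks k) where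

    -- Results on stacks 0 to 3, scanning on 4 and 5, elimination from 6 on with its vector on 9;
    -- the frame of `addRow` begins at 14.
    topFrame : (o₁ o₂ nz : Bool) → (B V S P : List Symbol) → Stacks (21 + k)
    topFrame o₁ o₂ nz B V S P =
      [] ∷ flag o₁ ∷ flag o₂ ∷ flag nz ∷ [] ∷ [] ∷ B ∷ [] ∷ [] ∷ V ∷ [] ∷ [] ∷ [] ∷ [] ∷
      [] ∷ [] ∷ S ∷ P ∷ [] ∷ [] ∷ [] ∷ τ

    opaque
      unfolding examine

      examine-exec : run examine (topFrame false false false [] [] [] []) ≡
                     topFrame gap₁ gap₂ false (rows H) [] (bits w₂) (bits w₁)
      examine-exec =
        trans (cong (λ X → run rest₀ ([] ∷ [] ∷ [] ∷ [] ∷ [] ∷ [] ∷ X ∷ [] ∷ [] ∷ _)) inp≡)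
        (trans (cong (run rest₁) (within ([] ∷ [] ∷ [] ∷ [] ∷ [] ∷ [] ∷ []) {nextRow {d = 3}} (nextRow-exec w₁ (rows (w₂ ∷ H)) [] _)))
        (trans (cong (run rest₂) (within ([] ∷ [] ∷ [] ∷ [] ∷ []) {scan {d = 3} isZero} (scan-exec isZero (bits w₁) false _ refl (bits≤N w₁))))
        (trans (cong (run rest₃) (within ([] ∷ [] ∷ [] ∷ [] ∷ [] ∷ flag (zeroIn (bits w₁)) ∷ []) {nextRow {d = 3}} (nextRow-exec w₂ (rows H) (bits w₁) _)))
        (trans (cong (run rest₄) (within ([] ∷ [] ∷ [] ∷ [] ∷ []) {scan {d = 3} isZero} (scan-exec isZero (rows H) (zeroIn (bits w₁)) _ refl rows≤N)))
          (cong (run rest₅) (within ([] ∷ flag gap₁ ∷ [] ∷ [] ∷ []) {scan {d = 3} isZero} (scan-exec isZero (bits w₂) false _ refl (bits≤N w₂))))))))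
        where
        rest₅ rest₄ rest₃ rest₂ rest₁ rest₀ : Cmd (21 + k) 4
        rest₅ = copy 2F 5F ▹ clear 5F ▹ clear 7F
        rest₄ = copy 1F 5F ▹ clear 5F ▹ copy (10 ↑ʳ 6F) 7F ▹ copy 4F 7F ▹ under 4 (scan isZero) ▹ rest₅
        rest₃ = copy 4F 6F ▹ under 4 (scan isZero) ▹ rest₄
        rest₂ = under 6 nextRow ▹ rest₃
        rest₁ = copy (10 ↑ʳ 7F) 7F ▹ copy 4F 7F ▹ under 4 (scan isZero) ▹ rest₂
        rest₀ = under 6 nextRow ▹ rest₁

    opaque
      unfolding solve

      solve-exec : ∀ o₁ o₂ → run solve (topFrame o₁ o₂ false (rows H) [] (bits w₂) (bits w₁)) ≡
                   topFrame o₁ o₂ outside [] (bits (eliminated N H (addIf true w₁ w₂))) [] []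
      solve-exec o₁ o₂ =
        trans (cong (run rest₁) (within ([] ∷ flag o₁ ∷ flag o₂ ∷ [] ∷ [] ∷ [] ∷ rows H ∷ [] ∷ [] ∷ [] ∷ [] ∷ [] ∷ [] ∷ [] ∷ [])
          {addRow {d = 3}} (addRow-exec w₁ w₂ true τ)))
        (trans (cong (run rest₂) (trans (pour-bits {inp} n≤N {r = 20 ↑ʳ 0F} {9F} (λ ()) v _ refl)
          (cong (λ V → [] ∷ flag o₁ ∷ flag o₂ ∷ [] ∷ [] ∷ [] ∷ pivot V) (List.++-identityʳ (bits v)))))
        (trans (cong (run rest₃) (within ([] ∷ flag o₁ ∷ flag o₂ ∷ [] ∷ [] ∷ [] ∷ []) {eliminate {d = 1}} (eliminate-exec τ v)))
          (cong (run rest₄) (within ([] ∷ flag o₁ ∷ flag o₂ ∷ [] ∷ []) {scan {d = 3} isOne}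
            (scan-exec isOne (bits (eliminated N H v)) false _ refl (bits≤N (eliminated N H v)))))))
        where
        v : Vec Bool n
        v = addIf true w₁ w₂
        pivot : List Symbol → Stacks (15 + k)
        pivot V = rows H ∷ [] ∷ [] ∷ V ∷ [] ∷ [] ∷ [] ∷ [] ∷ [] ∷ [] ∷ [] ∷ [] ∷ [] ∷ [] ∷ [] ∷ τ
        rest₄ rest₃ rest₂ rest₁ : Cmd (21 + k) 4
        rest₄ = copy 3F 5F ▹ clear 5F
        rest₃ = copy 4F 9F ▹ under 4 (scan isOne) ▹ rest₄
        rest₂ = under 6 eliminate ▹ rest₃
        rest₁ = clear (10 ↑ʳ 9F) ▹ pour (20 ↑ʳ 0F) 9F ▹ rest₂

  exploredFrame : Stacks 22
  exploredFrame = rows H ∷ bits w₂ ∷ [] ∷ flag mixes ∷ flag looped ∷ [] ∷ [] ∷ [] ∷ flag split₂ ∷ monoFrame [] w₂ w₂ crowded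

  opaque
    unfolding explore

    explore-exec : run explore (replicate 22 []) ≡ exploredFrame
    explore-exec =
      trans (cong (run rest₁) (survey-exec [] false false))
      (trans (cong (run rest₂) (secondRow-exec (surveyFrame [] (mixes , looped))))
      (trans (cong (run rest₃) (within (rows H ∷ bits w₂ ∷ [] ∷ flag mixes ∷ flag looped ∷ []) {splitTest {d = 1}} (splitTest-exec [] w₂ false)))
        (within (rows H ∷ bits w₂ ∷ [] ∷ flag mixes ∷ flag looped ∷ [] ∷ [] ∷ [] ∷ flag split₂ ∷ []) {monoTest {d = 2}} (monoTest-exec [] w₂ false))))
      where
      rest₃ rest₂ rest₁ : Cmd 22 4
      rest₃ = under 9 monoTest
      rest₂ = copy (10 ↑ʳ 3F) 1F ▹ under 5 splitTest ▹ rest₃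
      rest₁ = secondRow ▹ rest₂

  -- The criterion as a case tree. `o₁`: some infinite path exists. `nz`: `w₂` is outside the coset.
  -- `g`: mixing, where only 𝟙 is excluded (`o₂`). Otherwise `e` allows at most two classes, and a
  -- loop (`m`) forbids two (`f`).
  accept : (o₁ o₂ nz g m e f : Bool) → Bool
  accept o₁ o₂ nz g m e f =
    if o₁ then (if nz then false else if g then o₂ else if e then (if f then not m else true) else false) else true

  opaque
    unfolding answer

    answer-exec : ∀ o₁ o₂ nz {B V S P x y z} g m {a b c} e {τ : Stacks 12} f →
      top (run answer (topFrame (x ∷ y ∷ z ∷ flag g ∷ flag m ∷ a ∷ b ∷ c ∷ flag e ∷ (τ Vec.++ flag f ∷ [])) o₁ o₂ nz B V S P)) 0F
      ≡ (if accept o₁ o₂ nz g m e f then just sep else nothing)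
    answer-exec false _     _     _     _     _     _     = refl
    answer-exec true  _     true  _     _     _     _     = refl
    answer-exec true  true  false true  _     _     _     = refl
    answer-exec true  false false true  _     _     _     = refl
    answer-exec true  _     false false _     false _     = refl
    answer-exec true  _     false false true  true  {_ ∷ _ ∷ _ ∷ _ ∷ _ ∷ _ ∷ _ ∷ _ ∷ _ ∷ _ ∷ _ ∷ _ ∷ []} true  = refl
    answer-exec true  _     false false false true  {_ ∷ _ ∷ _ ∷ _ ∷ _ ∷ _ ∷ _ ∷ _ ∷ _ ∷ _ ∷ _ ∷ _ ∷ []} true  = refl
    answer-exec true  _     false false _     true  {_ ∷ _ ∷ _ ∷ _ ∷ _ ∷ _ ∷ _ ∷ _ ∷ _ ∷ _ ∷ _ ∷ _ ∷ []} false = refl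

  accepted : Bool
  accepted = accept gap₁ gap₂ outside mixes looped split₂ crowded

  decide-exec : is-just (top (run decide (replicate 43 [])) 0F) ≡ accepted
  decide-exec = trans (cong (λ σ → is-just (top σ 0F)) states)
    (trans (cong is-just (answer-exec gap₁ gap₂ outside mixes looped split₂
              {[] ∷ [] ∷ [] ∷ [] ∷ bits w₂ ∷ [] ∷ [] ∷ [] ∷ [] ∷ [] ∷ [] ∷ [] ∷ []} crowded)) (by accepted))
    where
    V = bits (eliminated N H (addIf true w₁ w₂))
    states : run decide (replicate 43 []) ≡ run answer (topFrame exploredFrame gap₁ gap₂ outside [] V [] [])
    states =
      trans (cong (run (solve ▹ under 21 explore ▹ answer)) (examine-exec (replicate 22 [])))
      (trans (cong (run (under 21 explore ▹ answer)) (solve-exec (replicate 22 []) gap₁ gap₂))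
        (cong (run answer) (within (topFrame [] gap₁ gap₂ outside [] V [] []) {explore} explore-exec)))
    by : ∀ b → is-just (if b then just sep else nothing) ≡ b
    by true  = refl
    by false = refl

-- The meaning of the Boolean tests

any-true : ∀ {A : Set} (p : A → Bool) xs → any p xs ≡ true → ∃[ x ] x Listed.∈ xs × p x ≡ true
any-true p (x ∷ xs) eq with p x in px
... | true  = x , here refl , px
... | false = let y , y∈ , py = any-true p xs eq in y , there y∈ , py

any-false : ∀ {A : Set} (p : A → Bool) xs → any p xs ≡ false → ∀ {x} → x Listed.∈ xs → p x ≡ false
any-false p (x ∷ xs) eq y∈ with p x in px
any-false p (x ∷ xs) eq (here refl) | false = px
any-false p (x ∷ xs) eq (there y∈)  | false = any-false p xs eq y∈

meets-sound : ∀ p (l a s : Vec Bool n) → meets p l a s ≡ true → ∃[ v ] p (lookup l v) (lookup a v) (lookup s v) ≡ true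
meets-sound p []      []      []      ()
meets-sound p (x ∷ l) (y ∷ a) (z ∷ s) eq with p x y z in here
... | true  = zero , here
... | false = let v , pv = meets-sound p l a s eq in suc v , pv

meets-complete : ∀ p (l a s : Vec Bool n) v → p (lookup l v) (lookup a v) (lookup s v) ≡ true → meets p l a s ≡ true
meets-complete p (x ∷ l) (y ∷ a) (z ∷ s) zero    eq rewrite eq = refl
meets-complete p (x ∷ l) (y ∷ a) (z ∷ s) (suc v) eq =
  trans (cong (p x y z ∨_) (meets-complete p l a s v eq)) (𝔹.∨-zeroʳ (p x y z))

good⇒uniform : ∀ (l a s : Vec Bool n) → bad l a s ≡ false → Uniform l a s
good⇒uniform l a s good u v lu lv auv with lookup a u in au | lookup s u in su | lookup s v in sv
... | _     | true  | true  = refl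
... | _     | false | false = refl
... | true  | true  | false = contradiction (trans (sym (cong₂ _∨_ (cong₂ _∧_
        (meets-complete at₁₁ l a s u (cong₂ _∧_ lu (cong₂ _∧_ au su)))
        (meets-complete at₁₀ l a s v (cong₂ _∧_ lv (cong₂ (λ b c → b ∧ not c) (sym auv) sv)))) refl)) good) true≢false
... | true  | false | true  = contradiction (trans (sym (cong₂ _∨_ (cong₂ _∧_
        (meets-complete at₁₁ l a s v (cong₂ _∧_ lv (cong₂ _∧_ (sym auv) sv)))
        (meets-complete at₁₀ l a s u (cong₂ _∧_ lu (cong₂ (λ b c → b ∧ not c) au su)))) refl)) good) true≢false
... | false | true  | false = contradiction (trans (sym (trans (cong ((meets at₁₁ l a s ∧ meets at₁₀ l a s) ∨_) (cong₂ _∧_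
        (meets-complete at₀₁ l a s u (cong₂ _∧_ lu (cong₂ (λ b c → not b ∧ c) au su)))
        (meets-complete at₀₀ l a s v (cong₂ _∧_ lv (cong₂ (λ b c → not b ∧ not c) (sym auv) sv))))) (𝔹.∨-zeroʳ _))) good) true≢false
... | false | false | true  = contradiction (trans (sym (trans (cong ((meets at₁₁ l a s ∧ meets at₁₀ l a s) ∨_) (cong₂ _∧_
        (meets-complete at₀₁ l a s v (cong₂ _∧_ lv (cong₂ (λ b c → not b ∧ c) (sym auv) sv)))
        (meets-complete at₀₀ l a s u (cong₂ _∧_ lu (cong₂ (λ b c → not b ∧ not c) au su))))) (𝔹.∨-zeroʳ _))) good) true≢false

¬both-values-inside : ∀ (l a s : Vec Bool n) → Uniform l a s → meets at₁₁ l a s ≡ true → meets at₁₀ l a s ≡ true → ⊥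
¬both-values-inside l a s uni m m′ with meets-sound at₁₁ l a s m | meets-sound at₁₀ l a s m′
... | u , eq | v , eq′ with lookup l u in lu | lookup a u in au | lookup s u in su
                          | lookup l v in lv | lookup a v in av | lookup s v in sv
...   | true | true | true | true | true | false =
  true≢false (trans (sym su) (trans (uni u v lu lv (trans au (sym av))) sv))

¬both-values-outside : ∀ (l a s : Vec Bool n) → Uniform l a s → meets at₀₁ l a s ≡ true → meets at₀₀ l a s ≡ true → ⊥
¬both-values-outside l a s uni m m′ with meets-sound at₀₁ l a s m | meets-sound at₀₀ l a s m′
... | u , eq | v , eq′ with lookup l u in lu | lookup a u in au | lookup s u in su
                          | lookup l v in lv | lookup a v in av | lookup s v in sv
...   | true | false | true | true | false | false =
  true≢false (trans (sym su) (trans (uni u v lu lv (trans au (sym av))) sv))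

bad⇒¬uniform : ∀ (l a s : Vec Bool n) → bad l a s ≡ true → ¬ Uniform l a s
bad⇒¬uniform l a s isBad uni
  with meets at₁₁ l a s in m₁₁ | meets at₁₀ l a s in m₁₀ | meets at₀₁ l a s in m₀₁ | meets at₀₀ l a s in m₀₀
... | true  | true  | _    | _    = ¬both-values-inside l a s uni m₁₁ m₁₀
... | true  | false | true | true = ¬both-values-outside l a s uni m₀₁ m₀₀
... | false | _     | true | true = ¬both-values-outside l a s uni m₀₁ m₀₀

-- Gaussian elimination preserves membership in the span

addIf-false : ∀ (p s : Vec Bool n) → addIf false p s ≡ s
addIf-false []      []      = refl
addIf-false (_ ∷ p) (c ∷ s) = cong (c ∷_) (addIf-false p s)

xor-linear : ∀ x y b c d → ((x xor y) ∧ b) xor (c xor d) ≡ ((x ∧ b) xor c) xor ((y ∧ b) xor d)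
xor-linear false false b     c     d = refl
xor-linear false true  b     c     d =
  trans (sym (𝔹.xor-assoc b c d)) (trans (cong (_xor d) (𝔹.xor-comm b c)) (𝔹.xor-assoc c b d))
xor-linear true  false b     c     d = sym (𝔹.xor-assoc b c d)
xor-linear true  true  false c     d = refl
xor-linear true  true  true  true  d = refl
xor-linear true  true  true  false d = sym (𝔹.not-involutive d)

addIf-linear : ∀ x y (p s t : Vec Bool n) → addIf (x xor y) p (s ⊕ t) ≡ addIf x p s ⊕ addIf y p t
addIf-linear x y []      []      []      = refl
addIf-linear x y (b ∷ p) (c ∷ s) (d ∷ t) = cong₂ _∷_ (xor-linear x y b c d) (addIf-linear x y p s t)

lead-linear : ∀ (p s t : Vec Bool n) → lead p (s ⊕ t) ≡ lead p s xor lead p t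
lead-linear []          []      []      = refl
lead-linear (true  ∷ p) (_ ∷ _) (_ ∷ _) = refl
lead-linear (false ∷ p) (_ ∷ s) (_ ∷ t) = lead-linear p s t

reduced-linear : ∀ (p s t : Vec Bool n) → reduced p (s ⊕ t) ≡ reduced p s ⊕ reduced p t
reduced-linear p s t =
  trans (cong (λ x → addIf x p (s ⊕ t)) (lead-linear p s t)) (addIf-linear (lead p s) (lead p t) p s t)

reduced-self : ∀ (p : Vec Bool n) → reduced p p ≡ 𝟘
reduced-self []          = refl
reduced-self (true  ∷ p) = cong (false ∷_) (⊕-self p)
reduced-self (false ∷ p) with lead p p | reduced-self p
... | true  | eq = cong (false ∷_) eq
... | false | eq = cong (false ∷_) eq

reduced-𝟘 : ∀ (p : Vec Bool n) → reduced p 𝟘 ≡ 𝟘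
reduced-𝟘 p = trans (cong (reduced p) (sym (⊕-self p))) (trans (reduced-linear p p p) (⊕-self (reduced p p)))

∈-reducedAll⁺ : ∀ (p : Vec Bool n) {ps s} → s Listed.∈ ps → reduced p s Listed.∈ reducedAll p ps
∈-reducedAll⁺ p {ps} = go ps
  where
  keep : ∀ {x} ps {out} → x Listed.∈ out → x Listed.∈ foldl (λ out s → reduced p s ∷ out) out ps
  keep []       x∈ = x∈
  keep (s ∷ ps) x∈ = keep ps (there x∈)
  go : ∀ ps {out s} → s Listed.∈ ps → reduced p s Listed.∈ foldl (λ out s → reduced p s ∷ out) out ps
  go (s ∷ ps) (here refl) = keep ps (here refl)
  go (s ∷ ps) (there s∈)  = go ps s∈

∈-reducedAll⁻ : ∀ (p : Vec Bool n) {ps x} → x Listed.∈ reducedAll p ps → ∃[ s ] s Listed.∈ ps × x ≡ reduced p s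
∈-reducedAll⁻ p {ps} x∈ with go ps x∈
  where
  go : ∀ ps {out x} → x Listed.∈ foldl (λ out s → reduced p s ∷ out) out ps →
       x Listed.∈ out ⊎ ∃[ s ] s Listed.∈ ps × x ≡ reduced p s
  go []       x∈ = inj₁ x∈
  go (s ∷ ps) x∈ with go ps x∈
  ... | inj₁ (here refl)    = inj₂ (s , here refl , refl)
  ... | inj₁ (there x∈)     = inj₁ x∈
  ... | inj₂ (t , t∈ , eq)  = inj₂ (t , there t∈ , eq)
... | inj₂ found = found

-- `reduced p` is linear and sends `p` to 𝟘. No echelon form enters the argument.
span-reduce : ∀ (p : Vec Bool n) {ps v} → Span (p ∷ ps) v → Span (reducedAll p ps) (reduced p v)
span-reduce p zero = subst (Span _) (sym (reduced-𝟘 p)) zero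
span-reduce p (add {l} {z} (here refl) s) =
  subst (Span _) (sym (trans (reduced-linear p p z) (trans (cong (_⊕ reduced p z) (reduced-self p)) (⊕-identityˡ _)))) (span-reduce p s)
span-reduce p (add {l} {z} (there l∈) s) =
  subst (Span _) (sym (reduced-linear p l z)) (add (∈-reducedAll⁺ p l∈) (span-reduce p s))

-- `reduced p v` is either `v` or `p ⊕ v`.
span-reduced⇔ : ∀ (p : Vec Bool n) {ps} v → (Span (p ∷ ps) v → Span (p ∷ ps) (reduced p v)) ×
                                          (Span (p ∷ ps) (reduced p v) → Span (p ∷ ps) v)
span-reduced⇔ p {ps} v with lead p v
... | true  = add (here refl) , λ s → subst (Span (p ∷ ps)) (⊕-cancel p v) (add (here refl) s)
... | false = subst (Span (p ∷ ps)) (sym (addIf-false p v)) , subst (Span (p ∷ ps)) (addIf-false p v)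

span-unreduce : ∀ (p : Vec Bool n) {ps v} → Span (reducedAll p ps) (reduced p v) → Span (p ∷ ps) v
span-unreduce p {ps} {v} s = proj₂ (span-reduced⇔ p v) (all s)
  where
  all : ∀ {z} → Span (reducedAll p ps) z → Span (p ∷ ps) z
  all zero = zero
  all (add {z = z} l∈ s) with ∈-reducedAll⁻ p l∈
  ... | t , t∈ , refl = span-⊕ (proj₁ (span-reduced⇔ p t) (span-edge (there t∈))) (all s)

eliminated-sound : ∀ k ps (v : Vec Bool n) → length ps ≤ k → eliminated k ps v ≡ 𝟘 → Span ps v
eliminated-sound zero    []       v _        refl = zero
eliminated-sound (suc k) []       v _        refl = zero
eliminated-sound (suc k) (p ∷ ps) v (s≤s le) eq   =
  span-unreduce p (eliminated-sound k (reducedAll p ps) (reduced p v) (ℕ.≤-trans (ℕ.≤-reflexive (reducedAll-length p ps)) le) eq)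

eliminated-complete : ∀ k ps (v : Vec Bool n) → length ps ≤ k → Span ps v → eliminated k ps v ≡ 𝟘
eliminated-complete zero    []       v _        zero = refl
eliminated-complete (suc k) []       v _        zero = refl
eliminated-complete (suc k) (p ∷ ps) v (s≤s le) s    =
  eliminated-complete k (reducedAll p ps) (reduced p v) (ℕ.≤-trans (ℕ.≤-reflexive (reducedAll-length p ps)) le) (span-reduce p s)

bits-any : ∀ (f : Γ → Bool) (x : Vec Bool n) → any (f ∘ just) (bits x) ≡ true → ∃[ v ] f (just (bit (lookup x v))) ≡ true
bits-any f (b ∷ x) eq with f (just (bit b)) in fb
... | true  = zero , fb
... | false = let v , fv = bits-any f x eq in suc v , fv

bits-none : ∀ (f : Γ → Bool) (x : Vec Bool n) → any (f ∘ just) (bits x) ≡ false → ∀ v → f (just (bit (lookup x v))) ≡ false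
bits-none f (b ∷ x) eq v with f (just (bit b)) in fb
bits-none f (b ∷ x) eq zero    | false = fb
bits-none f (b ∷ x) eq (suc v) | false = bits-none f x eq v

full-row : (x : Vec Bool n) → any (isZero ∘ just) (bits x) ≡ false → x ≡ 𝟙
full-row x eq = ext λ v → trans (𝔹.not-injective (bits-none isZero x eq v)) (sym (𝟙-at v))

gap-row : (x : Vec Bool n) → any (isZero ∘ just) (bits x) ≡ true → x ≢ 𝟙
gap-row x eq = let v , xv = bits-any isZero x eq in gap⇒≢𝟙 {v = v} (𝔹.not-injective xv)

any-++ : ∀ {A : Set} (p : A → Bool) xs ys → any p (xs ++ ys) ≡ any p xs ∨ any p ys
any-++ p []       ys = refl
any-++ p (x ∷ xs) ys = trans (cong (p x ∨_) (any-++ p xs ys)) (sym (𝔹.∨-assoc (p x) (any p xs) (any p ys)))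

row-zeros : (x : Vec Bool n) → any (isZero ∘ just) (encodeRow x) ≡ any (isZero ∘ just) (bits x)
row-zeros x = trans (any-++ (isZero ∘ just) (bits x) (sep ∷ [])) (𝔹.∨-identityʳ _)

full-rows : (xs : List (Vec Bool n)) → any (isZero ∘ just) (rows xs) ≡ false → ∀ {x} → x Listed.∈ xs → x ≡ 𝟙
full-rows (x ∷ xs) eq with trans (sym (any-++ (isZero ∘ just) (encodeRow x) (rows xs))) eq
... | eq′ = λ { (here refl) → full-row x (trans (sym (row-zeros x)) (𝔹.∨-conicalˡ _ _ eq′))
              ; (there x∈)  → full-rows xs (𝔹.∨-conicalʳ _ _ eq′) x∈ }

gap-rows : (xs : List (Vec Bool n)) → any (isZero ∘ just) (rows xs) ≡ true → ∃[ x ] x Listed.∈ xs × x ≢ 𝟙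
gap-rows (x ∷ xs) eq with any (isZero ∘ just) (bits x) in xz | trans (sym (any-++ (isZero ∘ just) (encodeRow x) (rows xs))) eq
... | true  | _   = x , here refl , gap-row x xz
... | false | eq′ =
  let y , y∈ , gap = gap-rows xs (trans (sym (cong (_∨ any (isZero ∘ just) (rows xs)) (trans (row-zeros x) xz))) eq′) in y , there y∈ , gap

-- Correctness of the decision

module Decision {H : Hypergraph n} (connected : Connected H)
                (nonempty : ∀ {l} → l is-hyperedge-of H → ∃[ v ] lookup l v ≡ true)
                {w₁ : Configuration n} (w₁≢𝟘 : w₁ ≢ 𝟘) (w₂ : Configuration n) where

  open Criterion connected nonempty w₁≢𝟘 w₂ renaming (rows to allRows)
  open Specification w₁ w₂ H (encode H w₁ w₂) refl using (all; split; mono; H≤N)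
  open Results w₁ w₂ H (encode H w₁ w₂) refl

  private
    N = length (encode H w₁ w₂)

  uniform-all : ∀ l a → any (bad l a) all ≡ false → ∀ {s} → s Listed.∈ allRows → Uniform l a s
  uniform-all l a eq {s} s∈ = good⇒uniform l a s (any-false (bad l a) all eq s∈)

  not-uniform-all : ∀ l a → any (bad l a) all ≡ true → ¬ (∀ {s} → s Listed.∈ allRows → Uniform l a s)
  not-uniform-all l a eq uni = let s , s∈ , isBad = any-true (bad l a) all eq in bad⇒¬uniform l a s isBad (uni s∈)

  split⇒Split : ∀ l → split l ≡ true → Split l
  split⇒Split l eq =
    let a , a∈ , ok = any-true (λ a → not (any (bad l a) all)) H eq in a , a∈ , uniform-all l a (𝔹.not-injective ok)

  ¬split⇒¬Split : ∀ l → split l ≡ false → ¬ Split l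
  ¬split⇒¬Split l eq (a , a∈ , uni) =
    not-uniform-all l a (𝔹.not-injective (any-false (λ a → not (any (bad l a) all)) H eq a∈)) uni

  mixes⇒¬Graph : mixes ≡ true → ¬ Graph
  mixes⇒¬Graph eq g = let l , l∈ , no-split = any-true (not ∘ split) H eq in ¬split⇒¬Split l (𝔹.not-injective no-split) (g l∈)

  ¬mixes⇒Graph : mixes ≡ false → Graph
  ¬mixes⇒Graph eq {l} l∈ = split⇒Split l (𝔹.not-injective (any-false (not ∘ split) H eq l∈))

  looped⇒¬NoMono : looped ≡ true → ¬ NoMono
  looped⇒¬NoMono eq no-mono =
    let l , l∈ , isMono = any-true mono H eq in no-mono l∈ (uniform-all l l (𝔹.not-injective isMono))

  ¬looped⇒NoMono : looped ≡ false → NoMono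
  ¬looped⇒NoMono eq {l} l∈ = not-uniform-all l l (𝔹.not-injective (any-false mono H eq l∈))

  outside⇒¬span : outside ≡ true → ¬ Span H (w₁ ⊕ w₂)
  outside⇒¬span eq s =
    let v , on = bits-any isOne (eliminated N H (addIf true w₁ w₂)) eq in
    ball⇒≢𝟘 {v = v} on (eliminated-complete N H (addIf true w₁ w₂) H≤N s)

  ¬outside⇒span : outside ≡ false → Span H (w₁ ⊕ w₂)
  ¬outside⇒span eq = eliminated-sound N H (addIf true w₁ w₂) H≤N
    (ext λ v → trans (bits-none isOne (eliminated N H (addIf true w₁ w₂)) eq v) (sym (𝟘-at v)))

  ¬gap⇒Full : gap₁ ≡ false → Full
  ¬gap⇒Full eq = full-row w₁ (𝔹.∨-conicalˡ _ _ eq) , full-rows H (𝔹.∨-conicalʳ _ _ eq)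

  gap⇒¬Full : gap₁ ≡ true → ¬ Full
  gap⇒¬Full eq (full , all-full) with any (isZero ∘ just) (bits w₁) in wz
  ... | true  = gap-row w₁ wz full
  ... | false = let l , l∈ , gap = gap-rows H eq in gap (all-full l∈)

  decision : Reflects (Recurrent H w₁ w₂) accepted
  decision = by gap₁ gap₂ outside mixes looped split₂ crowded refl refl refl refl refl refl refl
    where
    -- The outcomes are generalised to variables with equations, so that matching on them evaluates
    -- `accept` and keeps what each outcome means.
    by : ∀ o₁ o₂ nz g m e f → gap₁ ≡ o₁ → gap₂ ≡ o₂ → outside ≡ nz → mixes ≡ g → looped ≡ m → split₂ ≡ e → crowded ≡ f →
         Reflects (Recurrent H w₁ w₂) (accept o₁ o₂ nz g m e f)
    by false _ _ _ _ _ _ eq₁ _ _ _ _ _ _ = ofʸ (full⇒recurrent (¬gap⇒Full eq₁))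
    by true _ true _ _ _ _ eq₁ _ eqs _ _ _ _ =
      ofⁿ λ r → outside⇒¬span eqs (recurrent⇒span r (gap⇒¬Full eq₁))
    by true true false true _ _ _ _ eq₂ eqs eqg _ _ _ =
      ofʸ λ π p i → reach-mixing p i (¬outside⇒span eqs) (mixes⇒¬Graph eqg) (gap-row w₂ eq₂)
    by true false false true _ _ _ eq₁ eq₂ _ _ _ _ _ =
      ofⁿ λ r → recurrent⇒≢𝟙 r (gap⇒¬Full eq₁) (full-row w₂ eq₂)
    by true _ false false _ false _ eq₁ _ _ eqg _ eqe _ =
      ofⁿ λ r → ¬split⇒¬Split w₂ eqe (proj₁ (recurrent⇒split r (gap⇒¬Full eq₁) (¬mixes⇒Graph eqg)))
    by true _ false false _ true false _ _ eqs eqg _ eqe eqf =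
      ofʸ λ π p i → reach-graph p i (¬outside⇒span eqs) (¬mixes⇒Graph eqg) (split⇒Split w₂ eqe) (inj₁ (uniform-all w₂ w₂ eqf))
    by true _ false false false true true _ _ eqs eqg eqm eqe _ =
      ofʸ λ π p i → reach-graph p i (¬outside⇒span eqs) (¬mixes⇒Graph eqg) (split⇒Split w₂ eqe) (inj₂ (¬looped⇒NoMono eqm))
    by true _ false false true true true eq₁ _ _ eqg eqm _ eqf =
      ofⁿ λ r → neither (proj₂ (recurrent⇒split r (gap⇒¬Full eq₁) (¬mixes⇒Graph eqg)))
      where
      neither : ¬ (Mono w₂ ⊎ NoMono)
      neither (inj₁ isMono)  = not-uniform-all w₂ w₂ eqf isMono
      neither (inj₂ no-mono) = looped⇒¬NoMono eqm no-mono

large⇒nonempty : (l : Subset n) → 2 < ∣ l ∣ → ∃[ v ] lookup l v ≡ true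
large⇒nonempty {n} l large = ≢𝟘⇒ball {x = l} λ l≡𝟘 → ℕ.n≮0 (subst (2 <_) (trans (cong ∣_∣ l≡𝟘) (Subset.∣⊥∣≡0 n)) large)

theorem2 : Σ[ M ∈ TuringMachine Symbol ] Σ[ c ∈ ℕ ] Σ[ k ∈ ℕ ]
    (∀ (n : ℕ) (H : Hypergraph n) →
    Connected H →
    (∀ (l : Subset n) → l is-hyperedge-of H → 2 < ∣ l ∣) →
    ∀ (w₁ : Configuration n) → ¬ IdenticallyZero w₁ →
    ∀ (w₂ : Configuration n) →
    DecidesWithin M (c * length (encode H w₁ w₂) ^ k + c)
    (encode H w₁ w₂)
    (Recurrent H w₁ w₂))
theorem2 =
  let M , c , k , output = decides-in-polynomial-time decide zero in
  M , c , k , λ n H connected large w₁ w₁≢0 w₂ →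
    let nonempty = λ {l} l∈ → large⇒nonempty l (large l l∈)
        w₁≢𝟘 = λ w₁≡𝟘 → w₁≢0 λ v → trans (cong (λ x → lookup x v) w₁≡𝟘) (𝟘-at v)
        inp = encode H w₁ w₂
    in Results.accepted w₁ w₂ H inp refl ,
       trans (output inp) (cong just (Results.decide-exec w₁ w₂ H inp refl)) ,
       Decision.decision connected nonempty w₁≢𝟘 w₂
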